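{- Let $n$ and $s$ be nonnegative integers with $s\le n$. Then, as an identity of rational functions in the indeterminates $q$ and $x$, $$\left(\sum_{k=s}^{n}\frac{(q^{ -2n};q^2)_k\,(x;q)_k\,q^k}{(q;q)_{k-s}(q;q)_{k+s}}\right)\left(\sum_{k=s}^{n}\frac{(q^{ -2n};q^2)_k\,(q/x;q)_k\,q^k}{(q;q)_{k-s}(q;q)_{k+s}}\right)$$ $$=\frac{(-1)^n(q^2;q^2)_n^2\,q^{ -n^2}}{(q^2;q^2)_{n-s}(q^2;q^2)_{n+s}}\sum_{k=s}^{n}\frac{(-1)^k(q^2;q^2)_{n+k}\,(x;q)_k\,(q/x;q)_k\,q^{k^2-2nk}}{(q^2;q^2)_{n-k}\,(q;q)_{k-s}\,(q;q)_{k+s}\,(q;q)_{2k}}.$$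
   Context: For an indeterminate $q$ and an integer $n\ge 0$: $(a;q)_0=1$ and $(a;q)_n=(1-a)(1-aq)\cdots(1-aq^{n-1})$. -}

module Defs where

open import Level using (Level; _⊔_) renaming (suc to lsuc; zero to 0ℓ)
open import Algebra.Bundles using (AbelianGroup; CommutativeRing; Semiring)
open import Algebra.Structures using (IsAbelianGroup; IsCommutativeRing)
open import Data.Fin.Base using (toℕ)
open import Data.Integer.Base as ℤ using (ℤ; +_; -[1+_])
import Data.Integer.Properties as ℤₚ
open import Data.List.Base using (List; []; _∷_; map)
open import Data.Nat.Base as ℕ using (ℕ; zero; suc; _∸_)
open import Data.Product.Base using (_,_)
open import Data.Sum.Base using (_⊎_; inj₁; inj₂)
open import Relation.Binary.Definitions using (Decidable)
open import Relation.Binary.Structures using (IsEquivalence)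
open import Relation.Nullary using (¬_; Dec; yes; no; contradiction)
import Algebra.Consequences.Setoid as Consequences
import Algebra.Definitions.RawSemiring as RawSemiringDefs
import Algebra.Properties.CommutativeSemigroup as CommutativeSemigroupProperties
import Algebra.Properties.Group as GroupProperties
import Algebra.Properties.Ring as RingProperties
import Algebra.Solver.Ring.NaturalCoefficients.Default as SemiringSolver
import Relation.Binary.Reasoning.Setoid as SetoidReasoning

record IntegralDomain (c ℓ : Level) : Set (lsuc (c ⊔ ℓ)) where
  field
    commutativeRing : CommutativeRing c ℓ
  open CommutativeRing commutativeRing public
  field
    _≟_             : Decidable _≈_
    1≉0             : ¬ 1# ≈ 0#
    noZeroDivisors  : ∀ x y → x * y ≈ 0# → x ≈ 0# ⊎ y ≈ 0#

-- Inversion is total, with the junk value 0⁻¹ = 0.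
record Field (c ℓ : Level) : Set (lsuc (c ⊔ ℓ)) where
  field
    commutativeRing : CommutativeRing c ℓ
  open CommutativeRing commutativeRing public
  infix 9 _⁻¹
  field
    _⁻¹             : Carrier → Carrier
    ⁻¹-cong         : ∀ {x y} → x ≈ y → x ⁻¹ ≈ y ⁻¹
    ⁻¹-inverseʳ     : ∀ {x} → ¬ x ≈ 0# → x * x ⁻¹ ≈ 1#
    0⁻¹≈0           : 0# ⁻¹ ≈ 0#
    _≟_             : Decidable _≈_
    1≉0             : ¬ 1# ≈ 0#

ℤ-domain : IntegralDomain 0ℓ 0ℓ
ℤ-domain = record
  { commutativeRing = ℤₚ.+-*-commutativeRing
  ; _≟_             = ℤ._≟_
  ; 1≉0             = λ ()
  ; noZeroDivisors  = λ x y → ℤₚ.i*j≡0⇒i≡0∨j≡0 x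
  }
  where import Data.Integer as ℤ

-- Univariate polynomials as coefficient lists, constant term first.  Trailing
-- zeros are allowed; equality compares all coefficients.
module Polynomial {c ℓ} (D : IntegralDomain c ℓ) where

  open IntegralDomain D hiding (zero)
  open RingProperties ring using (-0#≈0#)

  Poly : Set c
  Poly = List Carrier

  coeff : Poly → ℕ → Carrier
  coeff []      _       = 0#
  coeff (a ∷ p) zero    = a
  coeff (a ∷ p) (suc i) = coeff p i

  infix 4 _≋_
  record _≋_ (p r : Poly) : Set ℓ where
    constructor coeffwise
    field at : ∀ i → coeff p i ≈ coeff r i
  open _≋_ public

  scale : Carrier → Poly → Poly
  scale a = map (a *_)

  infixl 6 _+ₚ_
  _+ₚ_ : Poly → Poly → Poly
  []      +ₚ r       = r
  (a ∷ p) +ₚ []      = a ∷ p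
  (a ∷ p) +ₚ (b ∷ r) = a + b ∷ p +ₚ r

  infixl 7 _*ₚ_
  _*ₚ_ : Poly → Poly → Poly
  []      *ₚ r = []
  (a ∷ p) *ₚ r = scale a r +ₚ (0# ∷ p *ₚ r)

  -ₚ_ : Poly → Poly
  -ₚ_ = map (-_)

  constant : Carrier → Poly
  constant a = a ∷ []

  indeterminate : Poly
  indeterminate = 0# ∷ 1# ∷ []

  private
    ≋-refl : ∀ {p} → p ≋ p
    ≋-refl = coeffwise λ _ → refl

    ≋-sym : ∀ {p r} → p ≋ r → r ≋ p
    ≋-sym e = coeffwise λ i → sym (at e i)

    ≋-trans : ∀ {p r t} → p ≋ r → r ≋ t → p ≋ t
    ≋-trans e f = coeffwise λ i → trans (at e i) (at f i)

    ≋-isEquivalence : IsEquivalence _≋_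
    ≋-isEquivalence = record { refl = ≋-refl ; sym = ≋-sym ; trans = ≋-trans }

    coeff-+ : ∀ p r i → coeff (p +ₚ r) i ≈ coeff p i + coeff r i
    coeff-+ []      r       i       = sym (+-identityˡ _)
    coeff-+ (a ∷ p) []      i       = sym (+-identityʳ _)
    coeff-+ (a ∷ p) (b ∷ r) zero    = refl
    coeff-+ (a ∷ p) (b ∷ r) (suc i) = coeff-+ p r i

    coeff-neg : ∀ p i → coeff (-ₚ p) i ≈ - coeff p i
    coeff-neg []      i       = sym -0#≈0#
    coeff-neg (a ∷ p) zero    = refl
    coeff-neg (a ∷ p) (suc i) = coeff-neg p i

    coeff-scale : ∀ a p i → coeff (scale a p) i ≈ a * coeff p i
    coeff-scale a []      i       = sym (zeroʳ a)
    coeff-scale a (b ∷ p) zero    = refl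
    coeff-scale a (b ∷ p) (suc i) = coeff-scale a p i

    +ₚ-cong : ∀ {p p′ r r′} → p ≋ p′ → r ≋ r′ → p +ₚ r ≋ p′ +ₚ r′
    +ₚ-cong {p} {p′} {r} {r′} e f = coeffwise λ i →
      trans (coeff-+ p r i) (trans (+-cong (at e i) (at f i)) (sym (coeff-+ p′ r′ i)))

    +ₚ-assoc : ∀ p r t → (p +ₚ r) +ₚ t ≋ p +ₚ (r +ₚ t)
    +ₚ-assoc p r t = coeffwise λ i → let open SetoidReasoning setoid in begin
      coeff ((p +ₚ r) +ₚ t) i                ≈⟨ coeff-+ (p +ₚ r) t i ⟩
      coeff (p +ₚ r) i + coeff t i           ≈⟨ +-congʳ (coeff-+ p r i) ⟩
      (coeff p i + coeff r i) + coeff t i    ≈⟨ +-assoc _ _ _ ⟩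
      coeff p i + (coeff r i + coeff t i)    ≈⟨ +-congˡ (coeff-+ r t i) ⟨
      coeff p i + coeff (r +ₚ t) i           ≈⟨ coeff-+ p (r +ₚ t) i ⟨
      coeff (p +ₚ (r +ₚ t)) i                ∎

    +ₚ-comm : ∀ p r → p +ₚ r ≋ r +ₚ p
    +ₚ-comm p r = coeffwise λ i →
      trans (coeff-+ p r i) (trans (+-comm _ _) (sym (coeff-+ r p i)))

    +ₚ-identityʳ : ∀ p → p +ₚ [] ≋ p
    +ₚ-identityʳ p = +ₚ-comm p []

    -ₚ-cong : ∀ {p r} → p ≋ r → -ₚ p ≋ -ₚ r
    -ₚ-cong {p} {r} e = coeffwise λ i →
      trans (coeff-neg p i) (trans (-‿cong (at e i)) (sym (coeff-neg r i)))

    -ₚ-inverseʳ : ∀ p → p +ₚ -ₚ p ≋ []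
    -ₚ-inverseʳ p = coeffwise λ i →
      trans (coeff-+ p (-ₚ p) i) (trans (+-congˡ (coeff-neg p i)) (-‿inverseʳ _))

    +ₚ-isAbelianGroup : IsAbelianGroup _≋_ _+ₚ_ [] (-ₚ_)
    +ₚ-isAbelianGroup = record
      { isGroup = record
        { isMonoid = record
          { isSemigroup = record
            { isMagma = record { isEquivalence = ≋-isEquivalence ; ∙-cong = +ₚ-cong }
            ; assoc   = +ₚ-assoc
            }
          ; identity = (λ _ → ≋-refl) , +ₚ-identityʳ
          }
        ; inverse = (λ p → ≋-trans (+ₚ-comm (-ₚ p) p) (-ₚ-inverseʳ p)) , -ₚ-inverseʳ
        ; ⁻¹-cong = -ₚ-cong
        }
      ; comm = +ₚ-comm
      }

    +ₚ-abelianGroup : AbelianGroup c ℓ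
    +ₚ-abelianGroup = record { isAbelianGroup = +ₚ-isAbelianGroup }

    module +ₚ where
      open AbelianGroup +ₚ-abelianGroup public
      open CommutativeSemigroupProperties commutativeSemigroup public
        using (interchange; x∙yz≈y∙xz)

    open SetoidReasoning +ₚ.setoid

    ∷-cong : ∀ {a b p r} → a ≈ b → p ≋ r → a ∷ p ≋ b ∷ r
    ∷-cong e f = coeffwise λ { zero → e ; (suc i) → at f i }

    ∷-zero : ∀ {a p} → a ≈ 0# → p ≋ [] → a ∷ p ≋ []
    ∷-zero e f = coeffwise λ { zero → e ; (suc i) → at f i }

    head-zero : ∀ {a p} → a ∷ p ≋ [] → a ≈ 0#
    head-zero e = at e zero

    tail-zero : ∀ {a p} → a ∷ p ≋ [] → p ≋ []
    tail-zero e = coeffwise λ i → at e (suc i)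

    shift-+ : ∀ p r → 0# ∷ (p +ₚ r) ≋ (0# ∷ p) +ₚ (0# ∷ r)
    shift-+ p r = ∷-cong (sym (+-identityˡ 0#)) ≋-refl

    scale-cong : ∀ {a b p r} → a ≈ b → p ≋ r → scale a p ≋ scale b r
    scale-cong {a} {b} {p} {r} e f = coeffwise λ i →
      trans (coeff-scale a p i) (trans (*-cong e (at f i)) (sym (coeff-scale b r i)))

    scale-+ₚ : ∀ a p r → scale a (p +ₚ r) ≋ scale a p +ₚ scale a r
    scale-+ₚ a []      r       = ≋-refl
    scale-+ₚ a (b ∷ p) []      = ≋-refl
    scale-+ₚ a (b ∷ p) (d ∷ r) = ∷-cong (distribˡ a b d) (scale-+ₚ a p r)

    scale-* : ∀ a b p → scale (a * b) p ≋ scale a (scale b p)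
    scale-* a b []      = ≋-refl
    scale-* a b (d ∷ p) = ∷-cong (*-assoc a b d) (scale-* a b p)

    scale-0 : ∀ p → scale 0# p ≋ []
    scale-0 []      = ≋-refl
    scale-0 (a ∷ p) = ∷-zero (zeroˡ a) (scale-0 p)

    absorb : ∀ {a} p r → a ≈ 0# → scale a p +ₚ r ≋ r
    absorb p r e = +ₚ-cong (≋-trans (scale-cong e (≋-refl {p})) (scale-0 p)) (≋-refl {r})

    scale-1 : ∀ p → scale 1# p ≋ p
    scale-1 []      = ≋-refl
    scale-1 (a ∷ p) = ∷-cong (*-identityˡ a) (scale-1 p)

    *ₚ-congˡ : ∀ p {r t} → r ≋ t → p *ₚ r ≋ p *ₚ t
    *ₚ-congˡ []      e = ≋-refl
    *ₚ-congˡ (a ∷ p) e = +ₚ-cong (scale-cong refl e) (∷-cong refl (*ₚ-congˡ p e))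

    *ₚ-distribˡ : ∀ p r t → p *ₚ (r +ₚ t) ≋ p *ₚ r +ₚ p *ₚ t
    *ₚ-distribˡ []      r t = ≋-refl
    *ₚ-distribˡ (a ∷ p) r t = begin
      scale a (r +ₚ t) +ₚ (0# ∷ p *ₚ (r +ₚ t))
        ≈⟨ +ₚ-cong (scale-+ₚ a r t) (∷-cong refl (*ₚ-distribˡ p r t)) ⟩
      (scale a r +ₚ scale a t) +ₚ (0# ∷ (p *ₚ r +ₚ p *ₚ t))
        ≈⟨ +ₚ-cong ≋-refl (shift-+ (p *ₚ r) (p *ₚ t)) ⟩
      (scale a r +ₚ scale a t) +ₚ ((0# ∷ p *ₚ r) +ₚ (0# ∷ p *ₚ t))
        ≈⟨ +ₚ.interchange (scale a r) (scale a t) _ _ ⟩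
      (scale a r +ₚ (0# ∷ p *ₚ r)) +ₚ (scale a t +ₚ (0# ∷ p *ₚ t)) ∎

    *ₚ-zeroʳ : ∀ p → p *ₚ [] ≋ []
    *ₚ-zeroʳ []      = ≋-refl
    *ₚ-zeroʳ (a ∷ p) = ∷-zero refl (*ₚ-zeroʳ p)

    *ₚ-∷ : ∀ p b r → p *ₚ (b ∷ r) ≋ scale b p +ₚ (0# ∷ p *ₚ r)
    *ₚ-∷ []      b r = ≋-sym (∷-zero refl ≋-refl)
    *ₚ-∷ (a ∷ p) b r = ∷-cong (+-congʳ (*-comm a b)) (begin
      scale a r +ₚ p *ₚ (b ∷ r)
        ≈⟨ +ₚ-cong ≋-refl (*ₚ-∷ p b r) ⟩
      scale a r +ₚ (scale b p +ₚ (0# ∷ p *ₚ r))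
        ≈⟨ +ₚ.x∙yz≈y∙xz (scale a r) (scale b p) _ ⟩
      scale b p +ₚ (scale a r +ₚ (0# ∷ p *ₚ r)) ∎)

    *ₚ-comm : ∀ p r → p *ₚ r ≋ r *ₚ p
    *ₚ-comm []      r = ≋-sym (*ₚ-zeroʳ r)
    *ₚ-comm (a ∷ p) r = begin
      scale a r +ₚ (0# ∷ p *ₚ r) ≈⟨ +ₚ-cong ≋-refl (∷-cong refl (*ₚ-comm p r)) ⟩
      scale a r +ₚ (0# ∷ r *ₚ p) ≈⟨ *ₚ-∷ r a p ⟨
      r *ₚ (a ∷ p)               ∎

    *ₚ-cong : ∀ {p p′ r r′} → p ≋ p′ → r ≋ r′ → p *ₚ r ≋ p′ *ₚ r′
    *ₚ-cong {p} {p′} {r} {r′} e f = begin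
      p *ₚ r   ≈⟨ *ₚ-congˡ p f ⟩
      p *ₚ r′  ≈⟨ *ₚ-comm p r′ ⟩
      r′ *ₚ p  ≈⟨ *ₚ-congˡ r′ e ⟩
      r′ *ₚ p′ ≈⟨ *ₚ-comm r′ p′ ⟩
      p′ *ₚ r′ ∎

    scale-*ₚ : ∀ a p r → scale a p *ₚ r ≋ scale a (p *ₚ r)
    scale-*ₚ a []      r = ≋-refl
    scale-*ₚ a (b ∷ p) r = begin
      scale (a * b) r +ₚ (0# ∷ scale a p *ₚ r)
        ≈⟨ +ₚ-cong (scale-* a b r) (∷-cong (sym (zeroʳ a)) (scale-*ₚ a p r)) ⟩
      scale a (scale b r) +ₚ scale a (0# ∷ p *ₚ r)
        ≈⟨ scale-+ₚ a (scale b r) _ ⟨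
      scale a (scale b r +ₚ (0# ∷ p *ₚ r)) ∎

    shift-*ₚ : ∀ p r → (0# ∷ p) *ₚ r ≋ 0# ∷ p *ₚ r
    shift-*ₚ p r = +ₚ-cong (scale-0 r) ≋-refl

    *ₚ-distribʳ : ∀ p r t → (r +ₚ t) *ₚ p ≋ r *ₚ p +ₚ t *ₚ p
    *ₚ-distribʳ = Consequences.comm∧distrˡ⇒distrʳ +ₚ.setoid +ₚ-cong *ₚ-comm *ₚ-distribˡ

    *ₚ-assoc : ∀ p r t → (p *ₚ r) *ₚ t ≋ p *ₚ (r *ₚ t)
    *ₚ-assoc []      r t = ≋-refl
    *ₚ-assoc (a ∷ p) r t = begin
      (scale a r +ₚ (0# ∷ p *ₚ r)) *ₚ t
        ≈⟨ *ₚ-distribʳ t (scale a r) (0# ∷ p *ₚ r) ⟩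
      scale a r *ₚ t +ₚ (0# ∷ p *ₚ r) *ₚ t
        ≈⟨ +ₚ-cong (scale-*ₚ a r t) (shift-*ₚ (p *ₚ r) t) ⟩
      scale a (r *ₚ t) +ₚ (0# ∷ (p *ₚ r) *ₚ t)
        ≈⟨ +ₚ-cong ≋-refl (∷-cong refl (*ₚ-assoc p r t)) ⟩
      scale a (r *ₚ t) +ₚ (0# ∷ p *ₚ (r *ₚ t)) ∎

    *ₚ-identityˡ : ∀ p → constant 1# *ₚ p ≋ p
    *ₚ-identityˡ p = begin
      scale 1# p +ₚ (0# ∷ []) ≈⟨ +ₚ-cong (scale-1 p) (∷-zero refl (≋-refl {[]})) ⟩
      p +ₚ []                 ≈⟨ +ₚ-identityʳ p ⟩
      p                       ∎

  commutativeRingₚ : CommutativeRing c ℓ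
  commutativeRingₚ = record
    { isCommutativeRing = record
      { isRing = record
        { +-isAbelianGroup = +ₚ-isAbelianGroup
        ; *-cong           = *ₚ-cong
        ; *-assoc          = *ₚ-assoc
        ; *-identity       = *ₚ-identityˡ
                           , λ p → ≋-trans (*ₚ-comm p (constant 1#)) (*ₚ-identityˡ p)
        ; distrib          = *ₚ-distribˡ , *ₚ-distribʳ
        }
      ; *-comm = *ₚ-comm
      }
    }

  private
    zero? : ∀ p → Dec (p ≋ [])
    zero? []      = yes ≋-refl
    zero? (a ∷ p) with a ≟ 0# | zero? p
    ... | no ¬e | _     = no λ e → ¬e (head-zero e)
    ... | yes _ | no ¬e = no λ e → ¬e (tail-zero e)
    ... | yes e | yes f = yes (∷-zero e f)

    _≟ₚ_ : Decidable _≋_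
    p ≟ₚ r with zero? (p +ₚ -ₚ r)
    ... | yes e = yes (GroupProperties.x∙y⁻¹≈ε⇒x≈y +ₚ.group p r e)
    ... | no ¬e = no λ e → ¬e (≋-trans (+ₚ-cong e ≋-refl) (-ₚ-inverseʳ r))

    noZeroDivisors-head : ∀ a p r → ¬ a ≈ 0# → (a ∷ p) *ₚ r ≋ [] → r ≋ []
    noZeroDivisors-head a p []      a≉0 e = ≋-refl
    noZeroDivisors-head a p (b ∷ r) a≉0 e = ∷-zero b≈0 (noZeroDivisors-head a p r a≉0 f)
      where
      b≈0 : b ≈ 0#
      b≈0 with noZeroDivisors a b (trans (sym (+-identityʳ _)) (head-zero e))
      ... | inj₁ a≈0 = contradiction a≈0 a≉0
      ... | inj₂ b≈0 = b≈0

      f : (a ∷ p) *ₚ r ≋ []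
      f = tail-zero {0#} (begin
        0# ∷ (a ∷ p) *ₚ r                        ≈⟨ absorb (a ∷ p) _ b≈0 ⟨
        scale b (a ∷ p) +ₚ (0# ∷ (a ∷ p) *ₚ r)   ≈⟨ *ₚ-∷ (a ∷ p) b r ⟨
        (a ∷ p) *ₚ (b ∷ r)                       ≈⟨ e ⟩
        []                                       ∎)

    noZeroDivisorsₚ : ∀ p r → p *ₚ r ≋ [] → p ≋ [] ⊎ r ≋ []
    noZeroDivisorsₚ []      r e = inj₁ ≋-refl
    noZeroDivisorsₚ (a ∷ p) r e with a ≟ 0#
    ... | no a≉0  = inj₂ (noZeroDivisors-head a p r a≉0 e)
    ... | yes a≈0 with noZeroDivisorsₚ p r (tail-zero {0#} (begin
        0# ∷ p *ₚ r                 ≈⟨ absorb r _ a≈0 ⟨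
        scale a r +ₚ (0# ∷ p *ₚ r)  ≈⟨ e ⟩
        []                          ∎))
    ...   | inj₁ p≋0 = inj₁ (∷-zero a≈0 p≋0)
    ...   | inj₂ r≋0 = inj₂ r≋0

  domain : IntegralDomain c ℓ
  domain = record
    { commutativeRing = commutativeRingₚ
    ; _≟_             = _≟ₚ_
    ; 1≉0             = λ e → 1≉0 (head-zero e)
    ; noZeroDivisors  = noZeroDivisorsₚ
    }

module Fractions {c ℓ} (D : IntegralDomain c ℓ) where

  open IntegralDomain D hiding (zero)
  open RingProperties ring using (-‿distribˡ-*)
  open SetoidReasoning setoid
  open SemiringSolver commutativeSemiring using (solve; _:+_; _:*_; _:=_; con)

  record Frac : Set (c ⊔ ℓ) where
    constructor frac
    field
      num   : Carrier
      den   : Carrier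
      den≉0 : ¬ den ≈ 0#
  open Frac public

  infix 4 _≃_
  record _≃_ (x y : Frac) : Set ℓ where
    constructor crossMultiplied
    field cross : num x * den y ≈ num y * den x
  open _≃_ public

  private
    *-nonzero : ∀ {a b} → ¬ a ≈ 0# → ¬ b ≈ 0# → ¬ a * b ≈ 0#
    *-nonzero {a} {b} a≉0 b≉0 e with noZeroDivisors a b e
    ... | inj₁ a≈0 = a≉0 a≈0
    ... | inj₂ b≈0 = b≉0 b≈0

  fromDomain : Carrier → Frac
  fromDomain a = frac a 1# 1≉0

  0f 1f : Frac
  0f = fromDomain 0#
  1f = fromDomain 1#

  infixl 6 _+f_
  _+f_ : Frac → Frac → Frac
  frac a b b≉0 +f frac d e e≉0 = frac (a * e + d * b) (b * e) (*-nonzero b≉0 e≉0)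

  infixl 7 _*f_
  _*f_ : Frac → Frac → Frac
  frac a b b≉0 *f frac d e e≉0 = frac (a * d) (b * e) (*-nonzero b≉0 e≉0)

  -f_ : Frac → Frac
  -f frac a b b≉0 = frac (- a) b b≉0

  inv : Frac → Frac
  inv (frac a b b≉0) with a ≟ 0#
  ... | yes _  = 0f
  ... | no a≉0 = frac b a a≉0

  private
    cancelʳ : ∀ {a b m} → ¬ m ≈ 0# → a * m ≈ b * m → a ≈ b
    cancelʳ {a} {b} {m} m≉0 e with noZeroDivisors (a - b) m (begin
        (a - b) * m       ≈⟨ distribʳ m a (- b) ⟩
        a * m + - b * m   ≈⟨ +-cong e (sym (-‿distribˡ-* b m)) ⟩
        b * m - b * m     ≈⟨ -‿inverseʳ (b * m) ⟩
        0#                ∎)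
    ... | inj₁ a-b≈0 = GroupProperties.x∙y⁻¹≈ε⇒x≈y +-group a b a-b≈0
    ... | inj₂ m≈0   = contradiction m≈0 m≉0

    ≃-trans : ∀ {x y z} → x ≃ y → y ≃ z → x ≃ z
    ≃-trans {frac a b _} {frac d e e≉0} {frac g h _} (crossMultiplied p) (crossMultiplied r) =
      crossMultiplied (cancelʳ e≉0 (begin
        (a * h) * e  ≈⟨ solve 3 (λ a h e → (a :* h) :* e := (a :* e) :* h) refl a h e ⟩
        (a * e) * h  ≈⟨ *-congʳ p ⟩
        (d * b) * h  ≈⟨ solve 3 (λ d b h → (d :* b) :* h := (d :* h) :* b) refl d b h ⟩
        (d * h) * b  ≈⟨ *-congʳ r ⟩
        (g * e) * b  ≈⟨ solve 3 (λ g e b → (g :* e) :* b := (g :* b) :* e) refl g e b ⟩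
        (g * b) * e  ∎))

    ≃-isEquivalence : IsEquivalence _≃_
    ≃-isEquivalence = record
      { refl  = crossMultiplied refl
      ; sym   = λ e → crossMultiplied (sym (cross e))
      ; trans = ≃-trans
      }

    +f-cong : ∀ {x x′ y y′} → x ≃ x′ → y ≃ y′ → x +f y ≃ x′ +f y′
    +f-cong {frac a b _} {frac a′ b′ _} {frac d e _} {frac d′ e′ _}
            (crossMultiplied p) (crossMultiplied r) = crossMultiplied (begin
      (a * e + d * b) * (b′ * e′)
        ≈⟨ solve 6 (λ a b d e b′ e′ → (a :* e :+ d :* b) :* (b′ :* e′)
             := (a :* b′) :* (e :* e′) :+ (d :* e′) :* (b :* b′)) refl a b d e b′ e′ ⟩
      (a * b′) * (e * e′) + (d * e′) * (b * b′)
        ≈⟨ +-cong (*-congʳ p) (*-congʳ r) ⟩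
      (a′ * b) * (e * e′) + (d′ * e) * (b * b′)
        ≈⟨ solve 6 (λ a′ b d′ e b′ e′ → (a′ :* b) :* (e :* e′) :+ (d′ :* e) :* (b :* b′)
             := (a′ :* e′ :+ d′ :* b′) :* (b :* e)) refl a′ b d′ e b′ e′ ⟩
      (a′ * e′ + d′ * b′) * (b * e) ∎)

    *f-cong : ∀ {x x′ y y′} → x ≃ x′ → y ≃ y′ → x *f y ≃ x′ *f y′
    *f-cong {frac a b _} {frac a′ b′ _} {frac d e _} {frac d′ e′ _}
            (crossMultiplied p) (crossMultiplied r) = crossMultiplied (begin
      (a * d) * (b′ * e′)  ≈⟨ interchange a d b′ e′ ⟩
      (a * b′) * (d * e′)  ≈⟨ *-cong p r ⟩
      (a′ * b) * (d′ * e)  ≈⟨ interchange a′ b d′ e ⟩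
      (a′ * d′) * (b * e)  ∎)
      where open CommutativeSemigroupProperties *-commutativeSemigroup using (interchange)

    -f-cong : ∀ {x y} → x ≃ y → -f x ≃ -f y
    -f-cong {frac a b _} {frac d e _} (crossMultiplied p) = crossMultiplied (begin
      - a * e    ≈⟨ -‿distribˡ-* a e ⟨
      - (a * e)  ≈⟨ -‿cong p ⟩
      - (d * b)  ≈⟨ -‿distribˡ-* d b ⟩
      - d * b    ∎)

    +f-comm : ∀ x y → x +f y ≃ y +f x
    +f-comm (frac a b _) (frac d e _) = crossMultiplied
      (solve 4 (λ a b d e → (a :* e :+ d :* b) :* (e :* b)
        := (d :* b :+ a :* e) :* (b :* e)) refl a b d e)

    +f-assoc : ∀ x y z → (x +f y) +f z ≃ x +f (y +f z)
    +f-assoc (frac a b _) (frac d e _) (frac g h _) = crossMultiplied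
      (solve 6 (λ a b d e g h →
        ((a :* e :+ d :* b) :* h :+ g :* (b :* e)) :* (b :* (e :* h))
        := (a :* (e :* h) :+ (d :* h :+ g :* e) :* b) :* ((b :* e) :* h)) refl a b d e g h)

    +f-identityˡ : ∀ x → 0f +f x ≃ x
    +f-identityˡ (frac a b _) = crossMultiplied
      (solve 2 (λ a b → (con 0 :* b :+ a :* con 1) :* b := a :* (con 1 :* b)) refl a b)

    -f-inverseˡ : ∀ x → (-f x) +f x ≃ 0f
    -f-inverseˡ (frac a b _) = crossMultiplied (begin
      (- a * b + a * b) * 1#  ≈⟨ *-congʳ (+-congʳ (-‿distribˡ-* a b)) ⟨
      (- (a * b) + a * b) * 1# ≈⟨ *-congʳ (-‿inverseˡ (a * b)) ⟩
      0# * 1#                 ≈⟨ zeroˡ 1# ⟩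
      0#                      ≈⟨ zeroˡ (b * b) ⟨
      0# * (b * b)            ∎)

    *f-comm : ∀ x y → x *f y ≃ y *f x
    *f-comm (frac a b _) (frac d e _) = crossMultiplied
      (*-cong (*-comm a d) (*-comm e b))

    *f-assoc : ∀ x y z → (x *f y) *f z ≃ x *f (y *f z)
    *f-assoc (frac a b _) (frac d e _) (frac g h _) = crossMultiplied
      (*-cong (*-assoc a d g) (sym (*-assoc b e h)))

    *f-identityˡ : ∀ x → 1f *f x ≃ x
    *f-identityˡ (frac a b _) = crossMultiplied
      (trans (*-congʳ (*-identityˡ a)) (*-congˡ (sym (*-identityˡ b))))

    *f-distribˡ : ∀ x y z → x *f (y +f z) ≃ x *f y +f x *f z
    *f-distribˡ (frac a b _) (frac d e _) (frac g h _) = crossMultiplied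
      (solve 6 (λ a b d e g h →
        (a :* (d :* h :+ g :* e)) :* ((b :* e) :* (b :* h))
        := ((a :* d) :* (b :* h) :+ (a :* g) :* (b :* e)) :* (b :* (e :* h)))
        refl a b d e g h)

    module ≃ = IsEquivalence ≃-isEquivalence

  commutativeRingf : CommutativeRing (c ⊔ ℓ) ℓ
  commutativeRingf = record
    { Carrier = Frac
    ; _≈_     = _≃_
    ; _+_     = _+f_
    ; _*_     = _*f_
    ; -_      = -f_
    ; 0#      = 0f
    ; 1#      = 1f
    ; isCommutativeRing = record
      { isRing = record
        { +-isAbelianGroup = record
          { isGroup = record
            { isMonoid = record
              { isSemigroup = record
                { isMagma = record { isEquivalence = ≃-isEquivalence ; ∙-cong = +f-cong }
                ; assoc   = +f-assoc
                }
              ; identity = +f-identityˡ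
                         , λ x → ≃.trans (+f-comm x 0f) (+f-identityˡ x)
              }
            ; inverse = -f-inverseˡ
                      , λ x → ≃.trans (+f-comm x (-f x)) (-f-inverseˡ x)
            ; ⁻¹-cong = -f-cong
            }
          ; comm = +f-comm
          }
        ; *-cong     = *f-cong
        ; *-assoc    = *f-assoc
        ; *-identity = *f-identityˡ
                     , λ x → ≃.trans (*f-comm x 1f) (*f-identityˡ x)
        ; distrib    = *f-distribˡ
                     , λ x y z → ≃.trans (*f-comm (y +f z) x)
                         (≃.trans (*f-distribˡ x y z)
                           (+f-cong (*f-comm x y) (*f-comm x z)))
        }
      ; *-comm = *f-comm
      }
    }

  private
    num≈0⇒≃0 : ∀ {x} → num x ≈ 0# → x ≃ 0f
    num≈0⇒≃0 {x} e = crossMultiplied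
      (trans (*-congʳ e) (trans (zeroˡ 1#) (sym (zeroˡ (den x)))))

    ≃0⇒num≈0 : ∀ {x} → x ≃ 0f → num x ≈ 0#
    ≃0⇒num≈0 {x} (crossMultiplied e) =
      trans (sym (*-identityʳ (num x))) (trans e (zeroˡ (den x)))

    inv-cong : ∀ {x y} → x ≃ y → inv x ≃ inv y
    inv-cong {x@(frac a b _)} {y@(frac d e _)} x≃y with a ≟ 0# | d ≟ 0#
    ... | yes _   | yes _   = ≃.refl
    ... | yes a≈0 | no d≉0  =
      contradiction (≃0⇒num≈0 {y} (≃.trans (≃.sym x≃y) (num≈0⇒≃0 {x} a≈0))) d≉0
    ... | no a≉0  | yes d≈0 =
      contradiction (≃0⇒num≈0 {x} (≃.trans x≃y (num≈0⇒≃0 {y} d≈0))) a≉0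
    ... | no _    | no _    = crossMultiplied
      (trans (*-comm b d) (trans (sym (cross x≃y)) (*-comm a e)))

    inv-inverseʳ : ∀ {x} → ¬ x ≃ 0f → x *f inv x ≃ 1f
    inv-inverseʳ {x@(frac a b _)} x≄0 with a ≟ 0#
    ... | yes a≈0 = contradiction (num≈0⇒≃0 {x} a≈0) x≄0
    ... | no _    = crossMultiplied (trans (*-identityʳ (a * b))
                      (trans (*-comm a b) (sym (*-identityˡ (b * a)))))

    inv-0 : inv 0f ≃ 0f
    inv-0 with 0# ≟ 0#
    ... | yes _   = ≃.refl
    ... | no 0≉0  = contradiction refl 0≉0

    _≟f_ : Decidable _≃_
    x ≟f y with (num x * den y) ≟ (num y * den x)
    ... | yes e = yes (crossMultiplied e)
    ... | no ¬e = no λ e → ¬e (cross e)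

  fractionField : Field (c ⊔ ℓ) ℓ
  fractionField = record
    { commutativeRing = commutativeRingf
    ; _⁻¹             = inv
    ; ⁻¹-cong         = inv-cong
    ; ⁻¹-inverseʳ     = inv-inverseʳ
    ; 0⁻¹≈0           = inv-0
    ; _≟_             = _≟f_
    ; 1≉0             = λ e → 1≉0 (≃0⇒num≈0 {1f} e)
    }

module QSeries {c ℓ} (F : Field c ℓ) where

  open Field F hiding (zero)
  open RawSemiringDefs (Semiring.rawSemiring semiring) public using (_^_)
  open RawSemiringDefs (Semiring.rawSemiring semiring) using (sum)

  infixl 7 _/_
  _/_ : Carrier → Carrier → Carrier
  a / b = a * b ⁻¹

  infixr 8 _^ᶻ_
  _^ᶻ_ : Carrier → ℤ → Carrier
  a ^ᶻ (+ m)    = a ^ m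
  a ^ᶻ -[1+ m ] = (a ^ suc m) ⁻¹

  -- ⟪ a ⨾ b ⟫ k is (a;b)ₖ.
  ⟪_⨾_⟫ : Carrier → Carrier → ℕ → Carrier
  ⟪ a ⨾ b ⟫ zero    = 1#
  ⟪ a ⨾ b ⟫ (suc k) = ⟪ a ⨾ b ⟫ k * (1# - a * b ^ k)

  -- Both endpoints are included; the sum is empty if m > n.
  sumFromTo : ℕ → ℕ → (ℕ → Carrier) → Carrier
  sumFromTo m n f = sum {suc n ∸ m} (λ i → f (m ℕ.+ toℕ i))

  infix 5 sumFromTo
  syntax sumFromTo m n (λ k → e) = ∑[ k from m to n ] e

module ℤ[q]    = Polynomial ℤ-domain
module ℤ[q][x] = Polynomial ℤ[q].domain

-- ℚ(q,x), constructed as the fraction field of ℤ[q][x].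
module ℚ⟨q,x⟩ = Fractions ℤ[q][x].domain

open Field ℚ⟨q,x⟩.fractionField public using (_≈_; _*_; -_; 1#)
open QSeries ℚ⟨q,x⟩.fractionField public

q x : ℚ⟨q,x⟩.Frac
q = ℚ⟨q,x⟩.fromDomain (ℤ[q][x].constant ℤ[q].indeterminate)
x = ℚ⟨q,x⟩.fromDomain ℤ[q][x].indeterminate

{-# OPTIONS --safe #-}

-- Put c = q²ˢ⁺¹, N = n - s, Q = q²ᴺ, y = 1/Q.  After the shift k = s + j the
-- theorem becomes, for X Y = c,
--
--   U(X) U(Y) = P(X,Y),   U(X)   = Σⱼ aⱼ qʲ (X;q)ⱼ,
--                         P(X,Y) = Σⱼ b°ⱼ qʲ (X;q)ⱼ (Y;q)ⱼ.
--
-- U satisfies a three-term recurrence in X → qX, and U(X) U(Y) is again a single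
-- sum when X Y is qc or c/q, with (X;q)ⱼ (Y;q)ⱼ weighted by bⱼ qʲ, respectively
-- (qX;q)ⱼ (qY;q)ⱼ weighted by bⱼ q²ʲ, where b°ⱼ = bⱼ (1 - c q²ʲ).  These sums satisfy
-- the relations that the recurrence of U imposes on the products, so the formulas
-- propagate from X = 1 (where the claim is U(c) = (-1)ᴺ q^(-N²), a case of
-- q-Chu–Vandermonde) to all X = q⁻ᵐ.  Times Xᴺ, both sides are polynomials in X, so
-- they agree for all X.
module Submission where

open import Level using (_⊔_)
open import Algebra.Bundles using (CommutativeRing)
open import Data.Bool.Base using (Bool; true; false; T)
open import Data.Fin.Base using (toℕ)
import Data.Fin.Properties as Finₚ
open import Data.Integer as ℤ using (ℤ; +_; -[1+_])
import Data.Integer.Properties as ℤₚ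
open import Data.List.Base using (List; []; _∷_)
open import Data.List.Relation.Unary.All using (All; []; _∷_)
open import Data.Maybe.Base using (nothing)
open import Data.Nat as ℕ using (ℕ; zero; suc; _≤_; _∸_)
import Data.Nat.Properties as ℕₚ
open import Data.Nat.Solver using (module +-*-Solver)
open import Data.Product.Base as Product using (_,_; ∃; ∃-syntax; proj₂)
open import Data.Unit.Base using (tt)
open import Data.Vec.Base using (Vec; []; _∷_; tabulate)
open import Data.Vec.N-ary using (N-ary; _$ⁿ_)
open import Relation.Nullary using (¬_)
open import Relation.Nullary.Decidable using (toWitnessFalse)
open import Relation.Binary.PropositionalEquality as ≡ using (_≡_)
import Algebra.Properties.AbelianGroup as AbelianGroupProperties
import Algebra.Properties.CommutativeMonoid.Sum as CommutativeMonoidSum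
import Algebra.Properties.CommutativeSemigroup as CommutativeSemigroupProperties
import Algebra.Properties.Group as GroupProperties
import Algebra.Properties.Ring as RingProperties
import Algebra.Properties.Semiring.Exp as Exp
import Algebra.Properties.Semiring.Mult.TCOptimised as Mult
import Relation.Binary.Reasoning.Setoid as SetoidReasoning
import Tactic.RingSolver.Core.AlmostCommutativeRing as ACR
open import Tactic.RingSolver.Core.Polynomial.Parameters using (Homomorphism)
open import Defs using (Field; IntegralDomain; module QSeries; module ℤ[q]; module ℤ[q][x]; module ℚ⟨q,x⟩)

-- The recurrence alone cannot push a formula for X Y = c along, since multiplying it by U(Y)
-- changes the product of the arguments. Write c = q²ZD and let U(qZ) U(qD) be known. The recurrence
-- in D, times U(qZ), brings in U(qZ) U(q²D) and U(qZ) U(D), whose arguments multiply to qc and c/q: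
-- hence the two auxiliary sums. Reaching U(Z) U(q²D) also brings in U(Z) U(D), with product c/q²,
-- for which no sum is at hand; it is eliminated between the recurrences in Z and in D.
--
-- The induction needs no data from beyond X = 1: the coefficient 1 - X vanishes there and removes
-- the products in question. Its divisors are powers of q and the differences 1 - c qᵐ, which are
-- nonzero because q is not a root of unity.
--
-- The constant c is the product of x qˢ and (q/x) qˢ, the arguments left once (x;q)ₖ and (q/x;q)ₖ
-- have been shifted by s. The argument runs in any field with q and x nonzero and q not a root of
-- unity; ℚ(q,x) enters only at the end.

-- Normal forms with integer coefficients, and linear combinations of hypotheses.

module ℤ-RingSolver {c ℓ} (R : CommutativeRing c ℓ) where
  open CommutativeRing R hiding (zero)
  open RingProperties ring using (-‿distribˡ-*; -‿distribʳ-*; -0#≈0#; -‿involutive)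
  open AbelianGroupProperties +-abelianGroup using (⁻¹-∙-comm)
  open Mult semiring using (_×_; ×-homo-+; ×1-homo-*)
  open SetoidReasoning setoid

  -- Coefficients live in ℤ, where being zero is computable, so that cancelled terms disappear from
  -- normal forms without a zero test in `R`. The optimised `_×_` makes `+ 1` evaluate to `1#`
  -- itself, so solved equations contain the literal constants.
  fromℤ : ℤ → Carrier
  fromℤ (+ n)    = n × 1#
  fromℤ -[1+ n ] = - (suc n × 1#)

  private
    cancel-1+ : ∀ a b → (1# + a) + - (1# + b) ≈ a + - b
    cancel-1+ a b = begin
      (1# + a) + - (1# + b)     ≈⟨ +-congˡ (⁻¹-∙-comm 1# b) ⟨
      (1# + a) + (- 1# + - b)   ≈⟨ +-congʳ (+-comm 1# a) ⟩
      (a + 1#) + (- 1# + - b)   ≈⟨ +-assoc a 1# _ ⟩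
      a + (1# + (- 1# + - b))   ≈⟨ +-congˡ (+-assoc 1# (- 1#) (- b)) ⟨
      a + ((1# + - 1#) + - b)   ≈⟨ +-congˡ (+-congʳ (-‿inverseʳ 1#)) ⟩
      a + (0# + - b)            ≈⟨ +-congˡ (+-identityˡ (- b)) ⟩
      a + - b                   ∎

    fromℤ-⊖ : ∀ m n → fromℤ (m ℤ.⊖ n) ≈ m × 1# + - (n × 1#)
    fromℤ-⊖ zero    zero    = sym (-‿inverseʳ 0#)
    fromℤ-⊖ zero    (suc n) = sym (+-identityˡ _)
    fromℤ-⊖ (suc m) zero    = sym (trans (+-congˡ -0#≈0#) (+-identityʳ _))
    fromℤ-⊖ (suc m) (suc n) rewrite ℤₚ.[1+m]⊖[1+n]≡m⊖n m n =
      trans (fromℤ-⊖ m n) (trans (sym (cancel-1+ _ _))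
        (+-cong (sym (×-homo-+ 1# 1 m)) (-‿cong (sym (×-homo-+ 1# 1 n)))))

    fromℤ-neg : ∀ i → fromℤ (ℤ.- i) ≈ - fromℤ i
    fromℤ-neg (+ zero)  = sym -0#≈0#
    fromℤ-neg (+ suc n) = refl
    fromℤ-neg -[1+ n ]  = sym (-‿involutive _)

    fromℤ-+ : ∀ i j → fromℤ (i ℤ.+ j) ≈ fromℤ i + fromℤ j
    fromℤ-+ (+ m)    (+ n)    = ×-homo-+ 1# m n
    fromℤ-+ (+ m)    -[1+ n ] = fromℤ-⊖ m (suc n)
    fromℤ-+ -[1+ m ] (+ n)    = trans (fromℤ-⊖ n (suc m)) (+-comm _ _)
    fromℤ-+ -[1+ m ] -[1+ n ] = begin
      - (suc (suc (m ℕ.+ n)) × 1#)     ≡⟨ ≡.cong (λ k → - (suc k × 1#)) (ℕₚ.+-suc m n) ⟨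
      - ((suc m ℕ.+ suc n) × 1#)       ≈⟨ -‿cong (×-homo-+ 1# (suc m) (suc n)) ⟩
      - (suc m × 1# + suc n × 1#)      ≈⟨ ⁻¹-∙-comm _ _ ⟨
      - (suc m × 1#) + - (suc n × 1#)  ∎

    fromℤ-*⁺ : ∀ m j → fromℤ (+ m ℤ.* j) ≈ fromℤ (+ m) * fromℤ j
    fromℤ-*⁺ m (+ n) rewrite ≡.sym (ℤₚ.pos-* m n) = ×1-homo-* m n
    fromℤ-*⁺ m -[1+ n ] = begin
      fromℤ (+ m ℤ.* -[1+ n ])        ≡⟨ ≡.cong fromℤ (ℤₚ.neg-distribʳ-* (+ m) (+ suc n)) ⟨
      fromℤ (ℤ.- (+ m ℤ.* + suc n))   ≈⟨ fromℤ-neg (+ m ℤ.* + suc n) ⟩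
      - fromℤ (+ m ℤ.* + suc n)       ≈⟨ -‿cong (fromℤ-*⁺ m (+ suc n)) ⟩
      - (m × 1# * (suc n × 1#))       ≈⟨ -‿distribʳ-* _ _ ⟩
      m × 1# * - (suc n × 1#)         ∎

    fromℤ-* : ∀ i j → fromℤ (i ℤ.* j) ≈ fromℤ i * fromℤ j
    fromℤ-* (+ m)    j = fromℤ-*⁺ m j
    fromℤ-* -[1+ m ] j = begin
      fromℤ (-[1+ m ] ℤ.* j)        ≡⟨ ≡.cong fromℤ (ℤₚ.neg-distribˡ-* (+ suc m) j) ⟨
      fromℤ (ℤ.- (+ suc m ℤ.* j))   ≈⟨ fromℤ-neg (+ suc m ℤ.* j) ⟩
      - fromℤ (+ suc m ℤ.* j)       ≈⟨ -‿cong (fromℤ-*⁺ (suc m) j) ⟩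
      - (suc m × 1# * fromℤ j)      ≈⟨ -‿distribˡ-* _ _ ⟩
      - (suc m × 1#) * fromℤ j      ∎

    isZero : ℤ → Bool
    isZero (+ zero) = true
    isZero _        = false

    isZero-sound : ∀ i → T (isZero i) → 0# ≈ fromℤ i
    isZero-sound (+ zero) _ = refl

    homomorphism : Homomorphism _ _ _ _
    homomorphism = record
      { from = record { rawRing = CommutativeRing.rawRing ℤₚ.+-*-commutativeRing ; isZero = isZero }
      ; to   = ACR.fromCommutativeRing R (λ _ → nothing)
      ; morphism = record
        { ⟦_⟧    = fromℤ
        ; +-homo = fromℤ-+
        ; *-homo = fromℤ-*
        ; -‿homo = fromℤ-neg
        ; 0-homo = refl
        ; 1-homo = refl
        }
      ; Zero-C⟶Zero-R = isZero-sound
      }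

  open import Tactic.RingSolver.Core.Expression public
  open Eval rawRing fromℤ
  open import Tactic.RingSolver.Core.Polynomial.Base (Homomorphism.from homomorphism)
  open import Tactic.RingSolver.Core.Polynomial.Semantics homomorphism renaming (⟦_⟧ to ⟦_⟧ₚ)
  open import Tactic.RingSolver.Core.Polynomial.Homomorphism homomorphism
  open import Algebra.Properties.Semiring.Exp.TCOptimised semiring using (^-congˡ)

  private
    norm : ∀ {n} → Expr ℤ n → Poly n
    norm (Κ i)   = κ i
    norm (Ι i)   = ι i
    norm (e ⊕ f) = norm e ⊞ norm f
    norm (e ⊗ f) = norm e ⊠ norm f
    norm (⊝ e)   = ⊟ norm e
    norm (e ⊛ k) = norm e ⊡ k

    ⟦_⇓⟧ : ∀ {n} → Expr ℤ n → Vec Carrier n → Carrier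
    ⟦ e ⇓⟧ = ⟦ norm e ⟧ₚ

    correct : ∀ {n} (e : Expr ℤ n) ρ → ⟦ e ⇓⟧ ρ ≈ ⟦ e ⟧ ρ
    correct (Κ i)   ρ = κ-hom i ρ
    correct (Ι i)   ρ = ι-hom i ρ
    correct (e ⊕ f) ρ = trans (⊞-hom (norm e) (norm f) ρ) (+-cong (correct e ρ) (correct f ρ))
    correct (e ⊗ f) ρ = trans (⊠-hom (norm e) (norm f) ρ) (*-cong (correct e ρ) (correct f ρ))
    correct (⊝ e)   ρ = trans (⊟-hom (norm e) ρ) (-‿cong (correct e ρ))
    correct (e ⊛ k) ρ = trans (⊡-hom (norm e) k ρ) (^-congˡ k (correct e ρ))

  infixl 6 _:-_
  _:-_ : ∀ {n} → Expr ℤ n → Expr ℤ n → Expr ℤ n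
  e :- f = e ⊕ (⊝ f)

  :0 :1 : ∀ {n} → Expr ℤ n
  :0 = Κ (+ 0)
  :1 = Κ (+ 1)

  open import Relation.Binary.Reflection setoid Ι ⟦_⟧ ⟦_⇓⟧ correct public
    using (solve; _⊜_)

  -- cofactor ·⟨ l ≗ r ⟩ is a hypothesis l ≈ r.  A goal L ≈ R follows from its
  -- hypotheses if L - R is the sum of all cofactor * (l - r) identically.
  infix 6 _·⟨_≗_⟩
  infix 3 _⊢_≗_

  record Hypothesis (n : ℕ) : Set where
    constructor _·⟨_≗_⟩
    field cofactor lhs rhs : Expr ℤ n

  record Entailment (n : ℕ) : Set where
    constructor _⊢_≗_
    field
      hypotheses : List (Hypothesis n)
      lhs rhs    : Expr ℤ n

  private
    combination : ∀ {n} → List (Hypothesis n) → Expr ℤ n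
    combination []                    = :0
    combination (m ·⟨ l ≗ r ⟩ ∷ hyps) = m ⊗ (l :- r) ⊕ combination hyps

  Holds : ∀ {n} → Vec Carrier n → Hypothesis n → Set ℓ
  Holds ρ (_ ·⟨ l ≗ r ⟩) = ⟦ l ⟧ ρ ≈ ⟦ r ⟧ ρ

  private
    combination≈0 : ∀ {n} (ρ : Vec Carrier n) {hyps} → All (Holds ρ) hyps → ⟦ combination hyps ⟧ ρ ≈ 0#
    combination≈0 ρ []           = refl
    combination≈0 ρ (l≈r ∷ hyps) =
      trans (+-cong (trans (*-congˡ (trans (+-congʳ l≈r) (-‿inverseʳ _))) (zeroʳ _)) (combination≈0 ρ hyps))
        (+-identityʳ 0#)

    instantiate : ∀ {n} → N-ary n (Expr ℤ n) (Entailment n) → Entailment n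
    instantiate {n} f = _$ⁿ_ {A = Expr ℤ n} {B = Entailment n} f (tabulate Ι)

  -- The last premise compares two normal forms, so `refl` proves it as soon as the cofactors are
  -- right.
  linear-combination : ∀ {n} (ρ : Vec Carrier n) (f : N-ary n (Expr ℤ n) (Entailment n)) →
    let open Entailment (instantiate f) in
    All (Holds ρ) hypotheses → ⟦ lhs :- rhs ⇓⟧ ρ ≈ ⟦ combination hypotheses ⇓⟧ ρ → ⟦ lhs ⟧ ρ ≈ ⟦ rhs ⟧ ρ
  linear-combination ρ f hyps e = x∙y⁻¹≈ε⇒x≈y _ _
    (trans (sym (correct (lhs :- rhs) ρ)) (trans e
      (trans (correct (combination hypotheses) ρ) (combination≈0 ρ hyps))))
    where
    open Entailment (instantiate f)
    open GroupProperties +-group using (x∙y⁻¹≈ε⇒x≈y)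

-- Polynomial identities behind the telescoping sums, the induction step and the prefactor.

module RingIdentities {c ℓ} (R : CommutativeRing c ℓ) where
  open CommutativeRing R
  open ℤ-RingSolver R

  -- In the telescope lemmas w is qᵏ, the letters F, G, H and E are q-shifted factorials
  -- of length k, and primed letters are the same quantities at k + 1.  So are X₀, X₂,
  -- Y₀, Y₂ and, in P-telescope, B°.

  U-telescope₀ : ∀ q c Q Z A →
    (1# - q * Z) * (A * 1# * 1#) + (- (1# - c * Q) * (A * 1# * 1#) + - (Q * (c - q * Z)) * (A * 1# *
      1#))
      ≈ Z * q * A * (Q - 1# * 1#) * 1#
  U-telescope₀ = solve 5 (λ q c Q Z A →
    (:1 :- q ⊗ Z) ⊗ (A ⊗ :1 ⊗ :1) ⊕ (⊝ (:1 :- c ⊗ Q) ⊗ (A ⊗ :1 ⊗ :1) ⊕ ⊝ (Q ⊗ (c :- q ⊗ Z)) ⊗ (A ⊗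
      :1 ⊗ :1))
    ⊜ Z ⊗ q ⊗ A ⊗ (Q :- :1 ⊗ :1) ⊗ :1) refl

  U-telescope : ∀ q c y Q Z w A A′ H X₀ X₂ →
    (1# - q * Z) * X₂ ≈ H * (1# - q * Z * w) * (1# - q * Z * (q * w)) →
    X₀ ≈ (1# - Z) * H →
    A′ * ((1# - q * w) * (1# - c * w)) ≈ A * (1# - y * (w * w)) →
    y * Q ≈ 1# →
    Z * q * A * (Q - w * w) * H + ((1# - q * Z) * (A′ * (q * w) * X₂) + (- (1# - c * Q) * (A′ * (q *
      w) * (H * (1# - q * Z * w))) + - (Q * (c - q * Z)) * (A′ * (q * w) * X₀)))
      ≈ Z * q * A′ * (Q - q * w * (q * w)) * (H * (1# - q * Z * w))
  U-telescope q c y Q Z w A A′ H X₀ X₂ h1 h2 h3 h4 = linear-combination (q ∷ c ∷ y ∷ Q ∷ Z ∷ w ∷ A ∷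
    A′ ∷ H ∷ X₀ ∷ X₂ ∷ [])
    (λ q c y Q Z w A A′ H X₀ X₂ →
      (A′ ⊗ (q ⊗ w)) ·⟨ (:1 :- q ⊗ Z) ⊗ X₂ ≗ H ⊗ (:1 :- q ⊗ Z ⊗ w) ⊗ (:1 :- q ⊗ Z ⊗ (q ⊗ w)) ⟩ ∷
      (⊝ (Q ⊗ (c :- q ⊗ Z)) ⊗ (A′ ⊗ (q ⊗ w))) ·⟨ X₀ ≗ (:1 :- Z) ⊗ H ⟩ ∷
      (⊝ (Z ⊗ q ⊗ H ⊗ Q)) ·⟨ A′ ⊗ ((:1 :- q ⊗ w) ⊗ (:1 :- c ⊗ w)) ≗ A ⊗ (:1 :- y ⊗ (w ⊗ w)) ⟩ ∷
      (Z ⊗ q ⊗ H ⊗ A ⊗ (w ⊗ w)) ·⟨ y ⊗ Q ≗ :1 ⟩ ∷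
      [] ⊢ Z ⊗ q ⊗ A ⊗ (Q :- w ⊗ w) ⊗ H ⊕ ((:1 :- q ⊗ Z) ⊗ (A′ ⊗ (q ⊗ w) ⊗ X₂) ⊕ (⊝ (:1 :- c ⊗ Q) ⊗
        (A′ ⊗ (q ⊗ w) ⊗ (H ⊗ (:1 :- q ⊗ Z ⊗ w))) ⊕ ⊝ (Q ⊗ (c :- q ⊗ Z)) ⊗ (A′ ⊗ (q ⊗ w) ⊗ X₀)))
        ≗ Z ⊗ q ⊗ A′ ⊗ (Q :- q ⊗ w ⊗ (q ⊗ w)) ⊗ (H ⊗ (:1 :- q ⊗ Z ⊗ w))) (h1 ∷ h2 ∷ h3 ∷ h4 ∷ [])
          refl

  -- After removal of the common factor B w F G this is (1 - d w) + d w (1 - a w) = 1 - a d w².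
  R-term : ∀ c a d w B B° F G G₂ F₂ →
    (1# - d) * G₂ ≈ G * (1# - d * w) →
    (1# - a) * F₂ ≈ F * (1# - a * w) →
    B° ≈ B * (1# - c * (w * w)) →
    c ≈ a * d →
    (1# - d) * (B * w * (F * G₂)) + d * (1# - a) * (B * (w * w) * (F₂ * G))
      ≈ B° * w * (F * G)
  R-term c a d w B B° F G G₂ F₂ h1 h2 h3 h4 = linear-combination (c ∷ a ∷ d ∷ w ∷ B ∷ B° ∷ F ∷ G ∷
    G₂ ∷ F₂ ∷ [])
    (λ c a d w B B° F G G₂ F₂ →
      (B ⊗ w ⊗ F) ·⟨ (:1 :- d) ⊗ G₂ ≗ G ⊗ (:1 :- d ⊗ w) ⟩ ∷
      (d ⊗ (B ⊗ (w ⊗ w)) ⊗ G) ·⟨ (:1 :- a) ⊗ F₂ ≗ F ⊗ (:1 :- a ⊗ w) ⟩ ∷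
      (⊝ (w ⊗ (F ⊗ G))) ·⟨ B° ≗ B ⊗ (:1 :- c ⊗ (w ⊗ w)) ⟩ ∷
      (B ⊗ w ⊗ w ⊗ w ⊗ F ⊗ G) ·⟨ c ≗ a ⊗ d ⟩ ∷
      [] ⊢ (:1 :- d) ⊗ (B ⊗ w ⊗ (F ⊗ G₂)) ⊕ d ⊗ (:1 :- a) ⊗ (B ⊗ (w ⊗ w) ⊗ (F₂ ⊗ G))
        ≗ B° ⊗ w ⊗ (F ⊗ G)) (h1 ∷ h2 ∷ h3 ∷ h4 ∷ []) refl

  P-telescope₀ : ∀ q y Q Z D B B° →
    let a = q * Z
        d = q * D
        c = q * (q * (Z * D))
        K = (1# - c * Q) * (1# - c * Q) * y in
    B° ≈ B * (1# - c * (1# * 1#)) →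
    y * Q ≈ 1# →
    a * ((1# - d) * (1# - d)) * (B° * 1# * (1# * 1#)) + (- (d * ((1# - a) * (1# - a))) * (B° * 1# *
      (1# * 1#)) + (- (K * (a * (1# - d))) * (B * (1# * 1#) * (1# * 1#)) + K * (d * (1# - a)) * (B *
      (1# * 1#) * (1# * 1#))))
      ≈ (a - d) * B * (1# - y * (1# * 1#)) * (1# - c * c * Q * (1# * 1#)) * (1# * 1#)
  P-telescope₀ q y Q Z D B B° h1 h2 = linear-combination (q ∷ y ∷ Q ∷ Z ∷ D ∷ B ∷ B° ∷ [])
    (λ q y Q Z D B B° →
      let a = q ⊗ Z
          d = q ⊗ D
          c = q ⊗ (q ⊗ (Z ⊗ D))
          K = (:1 :- c ⊗ Q) ⊗ (:1 :- c ⊗ Q) ⊗ y in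
      (a ⊗ ((:1 :- d) ⊗ (:1 :- d)) :- d ⊗ ((:1 :- a) ⊗ (:1 :- a))) ·⟨ B° ≗ B ⊗ (:1 :- c ⊗ (:1 ⊗ :1))
        ⟩ ∷
      ((a :- d) ⊗ B ⊗ ((:1 ⊕ :1) ⊗ c :- Q ⊗ (c ⊗ c) :- c ⊗ c)) ·⟨ y ⊗ Q ≗ :1 ⟩ ∷
      [] ⊢ a ⊗ ((:1 :- d) ⊗ (:1 :- d)) ⊗ (B° ⊗ :1 ⊗ (:1 ⊗ :1)) ⊕ (⊝ (d ⊗ ((:1 :- a) ⊗ (:1 :- a))) ⊗
        (B° ⊗ :1 ⊗ (:1 ⊗ :1)) ⊕ (⊝ (K ⊗ (a ⊗ (:1 :- d))) ⊗ (B ⊗ (:1 ⊗ :1) ⊗ (:1 ⊗ :1)) ⊕ K ⊗ (d ⊗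
        (:1 :- a)) ⊗ (B ⊗ (:1 ⊗ :1) ⊗ (:1 ⊗ :1))))
        ≗ (a :- d) ⊗ B ⊗ (:1 :- y ⊗ (:1 ⊗ :1)) ⊗ (:1 :- c ⊗ c ⊗ Q ⊗ (:1 ⊗ :1)) ⊗ (:1 ⊗ :1)) (h1 ∷ h2
          ∷ []) refl

  -- The combination of summands changes sign when the roles of Z and D are exchanged; this accounts
  -- for the factor `a - d` of the certificate. Its other factors, 1 - y w² and 1 - c² Q w², are the
  -- numerator of the ratio of consecutive `b`.
  P-telescope : ∀ q y Q Z D w B B′ B° F G X₀ X₂ Y₀ Y₂ →
    let a = q * Z
        d = q * D
        c = q * (q * (Z * D))
        v = q * w
        K = (1# - c * Q) * (1# - c * Q) * y
        F′ = F * (1# - a * w)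
        G′ = G * (1# - d * w) in
    (1# - d) * Y₂ ≈ G′ * (1# - d * v) →
    X₀ ≈ (1# - Z) * F →
    (1# - a) * X₂ ≈ F′ * (1# - a * v) →
    Y₀ ≈ (1# - D) * G →
    B° ≈ B′ * (1# - c * (v * v)) →
    B′ * ((1# - q * w) * (1# - c * w) * (1# - c * (q * (w * w))) * (1# - c * (v * v))) ≈ B * ((1# -
      y * (w * w)) * (1# - c * c * Q * (w * w))) →
    y * Q ≈ 1# →
    (a - d) * B * (1# - y * (w * w)) * (1# - c * c * Q * (w * w)) * (F * G) + (a * ((1# - d) * (1# -
      d)) * (B° * v * (X₀ * Y₂)) + (- (d * ((1# - a) * (1# - a))) * (B° * v * (X₂ * Y₀)) + (- (K *
      (a * (1# - d))) * (B′ * (v * v) * (F′ * Y₂)) + K * (d * (1# - a)) * (B′ * (v * v) * (X₂ *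
      G′)))))
      ≈ (a - d) * B′ * (1# - y * (v * v)) * (1# - c * c * Q * (v * v)) * (F′ * G′)
  P-telescope q y Q Z D w B B′ B° F G X₀ X₂ Y₀ Y₂ h1 h2 h3 h4 h5 h6 h7 = linear-combination (q ∷ y ∷
    Q ∷ Z ∷ D ∷ w ∷ B ∷ B′ ∷ B° ∷ F ∷ G ∷ X₀ ∷ X₂ ∷ Y₀ ∷ Y₂ ∷ [])
    (λ q y Q Z D w B B′ B° F G X₀ X₂ Y₀ Y₂ →
      let a = q ⊗ Z
          d = q ⊗ D
          c = q ⊗ (q ⊗ (Z ⊗ D))
          v = q ⊗ w
          K = (:1 :- c ⊗ Q) ⊗ (:1 :- c ⊗ Q) ⊗ y
          F′ = F ⊗ (:1 :- a ⊗ w)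
          G′ = G ⊗ (:1 :- d ⊗ w) in
      (a ⊗ (:1 :- d) ⊗ B° ⊗ v ⊗ X₀ :- K ⊗ a ⊗ B′ ⊗ (v ⊗ v) ⊗ F′) ·⟨ (:1 :- d) ⊗ Y₂ ≗ G′ ⊗ (:1 :- d ⊗
        v) ⟩ ∷
      (a ⊗ (:1 :- d) ⊗ B° ⊗ v ⊗ (G′ ⊗ (:1 :- d ⊗ v))) ·⟨ X₀ ≗ (:1 :- Z) ⊗ F ⟩ ∷
      (K ⊗ d ⊗ B′ ⊗ (v ⊗ v) ⊗ G′ :- d ⊗ (:1 :- a) ⊗ B° ⊗ v ⊗ Y₀) ·⟨ (:1 :- a) ⊗ X₂ ≗ F′ ⊗ (:1 :- a ⊗
        v) ⟩ ∷
      (⊝ (d ⊗ (:1 :- a) ⊗ B° ⊗ v ⊗ (F′ ⊗ (:1 :- a ⊗ v)))) ·⟨ Y₀ ≗ (:1 :- D) ⊗ G ⟩ ∷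
      (v ⊗ (a ⊗ (:1 :- d) ⊗ ((:1 :- Z) ⊗ F) ⊗ (G′ ⊗ (:1 :- d ⊗ v)) :- d ⊗ (:1 :- a) ⊗ ((:1 :- D) ⊗
        G) ⊗ (F′ ⊗ (:1 :- a ⊗ v)))) ·⟨ B° ≗ B′ ⊗ (:1 :- c ⊗ (v ⊗ v)) ⟩ ∷
      (⊝ ((a :- d) ⊗ F ⊗ G)) ·⟨ B′ ⊗ ((:1 :- q ⊗ w) ⊗ (:1 :- c ⊗ w) ⊗ (:1 :- c ⊗ (q ⊗ (w ⊗ w))) ⊗
        (:1 :- c ⊗ (v ⊗ v))) ≗ B ⊗ ((:1 :- y ⊗ (w ⊗ w)) ⊗ (:1 :- c ⊗ c ⊗ Q ⊗ (w ⊗ w))) ⟩ ∷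
      ((a :- d) ⊗ B′ ⊗ F′ ⊗ G′ ⊗ ((:1 ⊕ :1) ⊗ c ⊗ (v ⊗ v) :- c ⊗ c ⊗ (v ⊗ v) ⊗ (Q ⊕ v ⊗ v))) ·⟨ y ⊗
        Q ≗ :1 ⟩ ∷
      [] ⊢ (a :- d) ⊗ B ⊗ (:1 :- y ⊗ (w ⊗ w)) ⊗ (:1 :- c ⊗ c ⊗ Q ⊗ (w ⊗ w)) ⊗ (F ⊗ G) ⊕ (a ⊗ ((:1 :-
        d) ⊗ (:1 :- d)) ⊗ (B° ⊗ v ⊗ (X₀ ⊗ Y₂)) ⊕ (⊝ (d ⊗ ((:1 :- a) ⊗ (:1 :- a))) ⊗ (B° ⊗ v ⊗ (X₂ ⊗
        Y₀)) ⊕ (⊝ (K ⊗ (a ⊗ (:1 :- d))) ⊗ (B′ ⊗ (v ⊗ v) ⊗ (F′ ⊗ Y₂)) ⊕ K ⊗ (d ⊗ (:1 :- a)) ⊗ (B′ ⊗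
        (v ⊗ v) ⊗ (X₂ ⊗ G′)))))
        ≗ (a :- d) ⊗ B′ ⊗ (:1 :- y ⊗ (v ⊗ v)) ⊗ (:1 :- c ⊗ c ⊗ Q ⊗ (v ⊗ v)) ⊗ (F′ ⊗ G′)) (h1 ∷ h2 ∷
          h3 ∷ h4 ∷ h5 ∷ h6 ∷ h7 ∷ []) refl

  -- The recurrence in D is multiplied by `Ua`. Because c = a d, its last coefficient contains c - d
  -- = - d (1 - a), so the product `Ua * UD` is needed only up to the factor 1 - a, which may
  -- vanish.
  advance-R : ∀ c y Q a d Ua Ud UD U₂D p r r′ →
    (1# - d) * U₂D + (- (1# - c * Q) * Ud + - (Q * (c - d)) * UD) ≈ 0# →
    Ua * Ud ≈ p →
    c ≈ a * d →
    (1# - a) * (Ua * UD) ≈ (1# - a) * ((1# - c * Q) * y * r′) →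
    y * Q ≈ 1# →
    p ≈ (1# - d) * r + d * (1# - a) * r′ →
    (1# - d) * (Ua * U₂D)
      ≈ (1# - d) * ((1# - c * Q) * r)
  advance-R c y Q a d Ua Ud UD U₂D p r r′ h1 h2 h3 h4 h5 h6 = linear-combination (c ∷ y ∷ Q ∷ a ∷ d
    ∷ Ua ∷ Ud ∷ UD ∷ U₂D ∷ p ∷ r ∷ r′ ∷ [])
    (λ c y Q a d Ua Ud UD U₂D p r r′ →
      Ua ·⟨ (:1 :- d) ⊗ U₂D ⊕ (⊝ (:1 :- c ⊗ Q) ⊗ Ud ⊕ ⊝ (Q ⊗ (c :- d)) ⊗ UD) ≗ :0 ⟩ ∷
      (:1 :- c ⊗ Q) ·⟨ Ua ⊗ Ud ≗ p ⟩ ∷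
      (Ua ⊗ UD ⊗ Q) ·⟨ c ≗ a ⊗ d ⟩ ∷
      (⊝ (Q ⊗ d)) ·⟨ (:1 :- a) ⊗ (Ua ⊗ UD) ≗ (:1 :- a) ⊗ ((:1 :- c ⊗ Q) ⊗ y ⊗ r′) ⟩ ∷
      (⊝ (d ⊗ (:1 :- a) ⊗ (:1 :- c ⊗ Q) ⊗ r′)) ·⟨ y ⊗ Q ≗ :1 ⟩ ∷
      (:1 :- c ⊗ Q) ·⟨ p ≗ (:1 :- d) ⊗ r ⊕ d ⊗ (:1 :- a) ⊗ r′ ⟩ ∷
      [] ⊢ (:1 :- d) ⊗ (Ua ⊗ U₂D)
        ≗ (:1 :- d) ⊗ ((:1 :- c ⊗ Q) ⊗ r)) (h1 ∷ h2 ∷ h3 ∷ h4 ∷ h5 ∷ h6 ∷ []) refl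

  -- The recurrence in Z is read backwards, as an equation for its value at the lowest argument.
  -- There c - a = - a (1 - d), whence the factor Q a (1 - d) to be cancelled.
  advance-R′ : ∀ c y Q a d Ua Ud UZ U₂Z p r r′ →
    (1# - a) * U₂Z + (- (1# - c * Q) * Ua + - (Q * (c - a)) * UZ) ≈ 0# →
    c ≈ a * d →
    (1# - a) * (U₂Z * Ud) ≈ (1# - a) * ((1# - c * Q) * r) →
    Ua * Ud ≈ p →
    p ≈ (1# - a) * r + a * (1# - d) * r′ →
    y * Q ≈ 1# →
    Q * (a * (1# - d)) * (UZ * Ud)
      ≈ Q * (a * (1# - d)) * ((1# - c * Q) * y * r′)
  advance-R′ c y Q a d Ua Ud UZ U₂Z p r r′ h1 h2 h3 h4 h5 h6 = linear-combination (c ∷ y ∷ Q ∷ a ∷ d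
    ∷ Ua ∷ Ud ∷ UZ ∷ U₂Z ∷ p ∷ r ∷ r′ ∷ [])
    (λ c y Q a d Ua Ud UZ U₂Z p r r′ →
      Ud ·⟨ (:1 :- a) ⊗ U₂Z ⊕ (⊝ (:1 :- c ⊗ Q) ⊗ Ua ⊕ ⊝ (Q ⊗ (c :- a)) ⊗ UZ) ≗ :0 ⟩ ∷
      (Q ⊗ UZ ⊗ Ud) ·⟨ c ≗ a ⊗ d ⟩ ∷
      (⊝ :1) ·⟨ (:1 :- a) ⊗ (U₂Z ⊗ Ud) ≗ (:1 :- a) ⊗ ((:1 :- c ⊗ Q) ⊗ r) ⟩ ∷
      (:1 :- c ⊗ Q) ·⟨ Ua ⊗ Ud ≗ p ⟩ ∷
      (:1 :- c ⊗ Q) ·⟨ p ≗ (:1 :- a) ⊗ r ⊕ a ⊗ (:1 :- d) ⊗ r′ ⟩ ∷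
      (⊝ ((:1 :- c ⊗ Q) ⊗ a ⊗ (:1 :- d) ⊗ r′)) ·⟨ y ⊗ Q ≗ :1 ⟩ ∷
      [] ⊢ Q ⊗ (a ⊗ (:1 :- d)) ⊗ (UZ ⊗ Ud)
        ≗ Q ⊗ (a ⊗ (:1 :- d)) ⊗ ((:1 :- c ⊗ Q) ⊗ y ⊗ r′)) (h1 ∷ h2 ∷ h3 ∷ h4 ∷ h5 ∷ h6 ∷ []) refl

  -- The recurrence in D times a (1 - d) U(Z), and the one in Z times d (1 - a) U(D), contain the
  -- same multiple of U(Z) U(D). Their difference therefore links only products with known sums to
  -- the wanted one, with the coefficients of the relation assumed for those sums.
  advance-P : ∀ c y Q a d Ua Ud UZ U₂Z UD U₂D p₀ p₂ r₀′ r₁′ →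
    (1# - d) * U₂D + (- (1# - c * Q) * Ud + - (Q * (c - d)) * UD) ≈ 0# →
    UZ * Ud ≈ (1# - c * Q) * y * r₁′ →
    c ≈ a * d →
    (1# - a) * U₂Z + (- (1# - c * Q) * Ua + - (Q * (c - a)) * UZ) ≈ 0# →
    (1# - a) * (Ua * UD) ≈ (1# - a) * ((1# - c * Q) * y * r₀′) →
    (1# - a) * (U₂Z * UD) ≈ (1# - a) * p₀ →
    a * ((1# - d) * (1# - d)) * p₂ + (- (d * ((1# - a) * (1# - a))) * p₀ + (- ((1# - c * Q) * (1# -
      c * Q) * y * (a * (1# - d))) * r₁′ + (1# - c * Q) * (1# - c * Q) * y * (d * (1# - a)) * r₀′))
      ≈ 0# →
    a * ((1# - d) * (1# - d)) * (UZ * U₂D)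
      ≈ a * ((1# - d) * (1# - d)) * p₂
  advance-P c y Q a d Ua Ud UZ U₂Z UD U₂D p₀ p₂ r₀′ r₁′ h1 h2 h3 h4 h5 h6 h7 = linear-combination (c
    ∷ y ∷ Q ∷ a ∷ d ∷ Ua ∷ Ud ∷ UZ ∷ U₂Z ∷ UD ∷ U₂D ∷ p₀ ∷ p₂ ∷ r₀′ ∷ r₁′ ∷ [])
    (λ c y Q a d Ua Ud UZ U₂Z UD U₂D p₀ p₂ r₀′ r₁′ →
      (a ⊗ (:1 :- d) ⊗ UZ) ·⟨ (:1 :- d) ⊗ U₂D ⊕ (⊝ (:1 :- c ⊗ Q) ⊗ Ud ⊕ ⊝ (Q ⊗ (c :- d)) ⊗ UD) ≗ :0
        ⟩ ∷
      (a ⊗ (:1 :- d) ⊗ (:1 :- c ⊗ Q)) ·⟨ UZ ⊗ Ud ≗ (:1 :- c ⊗ Q) ⊗ y ⊗ r₁′ ⟩ ∷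
      (a ⊗ (:1 :- d) ⊗ Q ⊗ UZ ⊗ UD :- d ⊗ (:1 :- a) ⊗ UD ⊗ Q ⊗ UZ) ·⟨ c ≗ a ⊗ d ⟩ ∷
      (⊝ (d ⊗ (:1 :- a) ⊗ UD)) ·⟨ (:1 :- a) ⊗ U₂Z ⊕ (⊝ (:1 :- c ⊗ Q) ⊗ Ua ⊕ ⊝ (Q ⊗ (c :- a)) ⊗ UZ) ≗
        :0 ⟩ ∷
      (⊝ (d ⊗ (:1 :- c ⊗ Q))) ·⟨ (:1 :- a) ⊗ (Ua ⊗ UD) ≗ (:1 :- a) ⊗ ((:1 :- c ⊗ Q) ⊗ y ⊗ r₀′) ⟩ ∷
      (d ⊗ (:1 :- a)) ·⟨ (:1 :- a) ⊗ (U₂Z ⊗ UD) ≗ (:1 :- a) ⊗ p₀ ⟩ ∷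
      (⊝ :1) ·⟨ a ⊗ ((:1 :- d) ⊗ (:1 :- d)) ⊗ p₂ ⊕ (⊝ (d ⊗ ((:1 :- a) ⊗ (:1 :- a))) ⊗ p₀ ⊕ (⊝ ((:1
        :- c ⊗ Q) ⊗ (:1 :- c ⊗ Q) ⊗ y ⊗ (a ⊗ (:1 :- d))) ⊗ r₁′ ⊕ (:1 :- c ⊗ Q) ⊗ (:1 :- c ⊗ Q) ⊗ y ⊗
        (d ⊗ (:1 :- a)) ⊗ r₀′)) ≗ :0 ⟩ ∷
      [] ⊢ a ⊗ ((:1 :- d) ⊗ (:1 :- d)) ⊗ (UZ ⊗ U₂D)
        ≗ a ⊗ ((:1 :- d) ⊗ (:1 :- d)) ⊗ p₂) (h1 ∷ h2 ∷ h3 ∷ h4 ∷ h5 ∷ h6 ∷ h7 ∷ []) refl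

  K-telescope₀ : ∀ q y d →
    1# * d * 1# + q * y * (1# * d * 1#)
      ≈ (1# + q * y * 1#) * 1# * d
  K-telescope₀ = solve 3 (λ q y d →
    :1 ⊗ d ⊗ :1 ⊕ q ⊗ y ⊗ (:1 ⊗ d ⊗ :1)
    ⊜ (:1 ⊕ q ⊗ y ⊗ :1) ⊗ :1 ⊗ d) refl

  -- Here `E` is (q²y;q²)ₖ, `E′` is (y;q²)ₖ₊₁, and `d`, `d′` are the inverses of (q;q)ₖ and
  -- (q;q)ₖ₊₁.
  K-telescope : ∀ q y w z E E′ d d′ →
    d′ * (1# - q * w) ≈ d →
    E′ ≈ (1# - y) * E →
    z ≈ w * w →
    (1# + q * y * w) * E * d + (E′ * d′ * (q * w) + q * y * (E * (1# - q * q * y * z) * d′ * (q *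
      w)))
      ≈ (1# + q * y * (q * w)) * (E * (1# - q * q * y * z)) * d′
  K-telescope q y w z E E′ d d′ h1 h2 h3 = linear-combination (q ∷ y ∷ w ∷ z ∷ E ∷ E′ ∷ d ∷ d′ ∷ [])
    (λ q y w z E E′ d d′ →
      (⊝ ((:1 ⊕ q ⊗ y ⊗ w) ⊗ E)) ·⟨ d′ ⊗ (:1 :- q ⊗ w) ≗ d ⟩ ∷
      (d′ ⊗ (q ⊗ w)) ·⟨ E′ ≗ (:1 :- y) ⊗ E ⟩ ∷
      (E ⊗ d′ ⊗ (q ⊗ q ⊗ y)) ·⟨ z ≗ w ⊗ w ⟩ ∷
      [] ⊢ (:1 ⊕ q ⊗ y ⊗ w) ⊗ E ⊗ d ⊕ (E′ ⊗ d′ ⊗ (q ⊗ w) ⊕ q ⊗ y ⊗ (E ⊗ (:1 :- q ⊗ q ⊗ y ⊗ z) ⊗ d′ ⊗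
        (q ⊗ w)))
        ≗ (:1 ⊕ q ⊗ y ⊗ (q ⊗ w)) ⊗ (E ⊗ (:1 :- q ⊗ q ⊗ y ⊗ z)) ⊗ d′) (h1 ∷ h2 ∷ h3 ∷ []) refl

  K-recurrence : ∀ s qy t E d w →
    s + qy * (t + E * d * w) ≈ 0# →
    E ≈ 0# →
    s
      ≈ - qy * t
  K-recurrence s qy t E d w h1 h2 = linear-combination (s ∷ qy ∷ t ∷ E ∷ d ∷ w ∷ [])
    (λ s qy t E d w →
      :1 ·⟨ s ⊕ qy ⊗ (t ⊕ E ⊗ d ⊗ w) ≗ :0 ⟩ ∷
      (⊝ (qy ⊗ d ⊗ w)) ·⟨ E ≗ :0 ⟩ ∷
      [] ⊢ s
        ≗ ⊝ qy ⊗ t) (h1 ∷ h2 ∷ []) refl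

  -- The new factor 1 - y z, multiplied by H = 1/y, is H - w² = - w² (1 - q² v): it supplies the
  -- sign, the power of q, and the factor that completes `Em`.
  reversal-step : ∀ A y z w q q² v Em H Hk N s En →
    A * w * (Em * (1# - q² * v)) * Hk ≈ N * s * En →
    y * H ≈ 1# →
    z ≈ w * w →
    H ≈ q² * v * (w * w) →
    A * (1# - y * z) * (q * w) * Em * (H * Hk)
      ≈ - 1# * N * (s * (q * (w * w))) * En
  reversal-step A y z w q q² v Em H Hk N s En h1 h2 h3 h4 = linear-combination (A ∷ y ∷ z ∷ w ∷ q ∷
    q² ∷ v ∷ Em ∷ H ∷ Hk ∷ N ∷ s ∷ En ∷ [])
    (λ A y z w q q² v Em H Hk N s En →
      (⊝ (q ⊗ w ⊗ w)) ·⟨ A ⊗ w ⊗ (Em ⊗ (:1 :- q² ⊗ v)) ⊗ Hk ≗ N ⊗ s ⊗ En ⟩ ∷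
      (⊝ (A ⊗ (q ⊗ w) ⊗ Em ⊗ Hk ⊗ z)) ·⟨ y ⊗ H ≗ :1 ⟩ ∷
      (⊝ (A ⊗ (q ⊗ w) ⊗ Em ⊗ Hk)) ·⟨ z ≗ w ⊗ w ⟩ ∷
      (A ⊗ (q ⊗ w) ⊗ Em ⊗ Hk) ·⟨ H ≗ q² ⊗ v ⊗ (w ⊗ w) ⟩ ∷
      [] ⊢ A ⊗ (:1 :- y ⊗ z) ⊗ (q ⊗ w) ⊗ Em ⊗ (H ⊗ Hk)
        ≗ ⊝ :1 ⊗ N ⊗ (s ⊗ (q ⊗ (w ⊗ w))) ⊗ En) (h1 ∷ h2 ∷ h3 ∷ h4 ∷ []) refl

  -- The first two hypotheses are reversals of q-shifted factorials at s and at k, and the last is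
  -- the exponent identity 2ns + N² = s² + n². The common factor on both sides clears every negative
  -- power of q.
  prefactor : ∀ Ys qs EN Hs Yk qk ENj Hk κ qNN qn qnn qz qkk qss sn sk ss sN En →
    Ys * qs * EN * Hs ≈ ss * qss * En →
    Yk * qk * ENj * Hk ≈ sk * qkk * En →
    κ * qNN ≈ sN →
    qn * qnn ≈ 1# →
    qz * Hk ≈ qkk →
    sn ≈ ss * sN →
    Hs * qNN ≈ qss * qnn →
    Hs * Hk * qNN * qnn * (sn * (En * En) * qn * (sk * qz))
      ≈ Hs * Hk * qNN * qnn * (Ys * qs * EN * (Yk * qk * ENj) * κ)
  prefactor Ys qs EN Hs Yk qk ENj Hk κ qNN qn qnn qz qkk qss sn sk ss sN En h1 h2 h3 h4 h5 h6 h7 =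
    linear-combination (Ys ∷ qs ∷ EN ∷ Hs ∷ Yk ∷ qk ∷ ENj ∷ Hk ∷ κ ∷ qNN ∷ qn ∷ qnn ∷ qz ∷ qkk ∷ qss
    ∷ sn ∷ sk ∷ ss ∷ sN ∷ En ∷ [])
    (λ Ys qs EN Hs Yk qk ENj Hk κ qNN qn qnn qz qkk qss sn sk ss sN En →
      (⊝ (Yk ⊗ qk ⊗ ENj ⊗ Hk ⊗ κ ⊗ qNN ⊗ qnn)) ·⟨ Ys ⊗ qs ⊗ EN ⊗ Hs ≗ ss ⊗ qss ⊗ En ⟩ ∷
      (⊝ (ss ⊗ qss ⊗ En ⊗ κ ⊗ qNN ⊗ qnn)) ·⟨ Yk ⊗ qk ⊗ ENj ⊗ Hk ≗ sk ⊗ qkk ⊗ En ⟩ ∷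
      (⊝ (ss ⊗ qss ⊗ En ⊗ sk ⊗ qkk ⊗ En ⊗ qnn)) ·⟨ κ ⊗ qNN ≗ sN ⟩ ∷
      (Hs ⊗ Hk ⊗ qNN ⊗ sn ⊗ En ⊗ En ⊗ sk ⊗ qz) ·⟨ qn ⊗ qnn ≗ :1 ⟩ ∷
      (Hs ⊗ qNN ⊗ sn ⊗ En ⊗ En ⊗ sk) ·⟨ qz ⊗ Hk ≗ qkk ⟩ ∷
      (Hs ⊗ qNN ⊗ En ⊗ En ⊗ sk ⊗ qkk) ·⟨ sn ≗ ss ⊗ sN ⟩ ∷
      (ss ⊗ sN ⊗ En ⊗ En ⊗ sk ⊗ qkk) ·⟨ Hs ⊗ qNN ≗ qss ⊗ qnn ⟩ ∷
      [] ⊢ Hs ⊗ Hk ⊗ qNN ⊗ qnn ⊗ (sn ⊗ (En ⊗ En) ⊗ qn ⊗ (sk ⊗ qz))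
        ≗ Hs ⊗ Hk ⊗ qNN ⊗ qnn ⊗ (Ys ⊗ qs ⊗ EN ⊗ (Yk ⊗ qk ⊗ ENj) ⊗ κ)) (h1 ∷ h2 ∷ h3 ∷ h4 ∷ h5 ∷ h6 ∷
          h7 ∷ []) refl

  cancel-E : ∀ l EN iEN ENj iENj Ys qs κ Yk Yj qk qj →
    l ≈ Ys * qs * EN * (Yk * qk * ENj) * κ →
    EN * iEN ≈ 1# →
    ENj * iENj ≈ 1# →
    Yk ≈ Ys * Yj →
    qk ≈ qs * qj →
    l * (iEN * iENj)
      ≈ Ys * qs * (Ys * Yj * (qs * qj)) * κ
  cancel-E l EN iEN ENj iENj Ys qs κ Yk Yj qk qj h1 h2 h3 h4 h5 = linear-combination (l ∷ EN ∷ iEN ∷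
    ENj ∷ iENj ∷ Ys ∷ qs ∷ κ ∷ Yk ∷ Yj ∷ qk ∷ qj ∷ [])
    (λ l EN iEN ENj iENj Ys qs κ Yk Yj qk qj →
      (iEN ⊗ iENj) ·⟨ l ≗ Ys ⊗ qs ⊗ EN ⊗ (Yk ⊗ qk ⊗ ENj) ⊗ κ ⟩ ∷
      (iENj ⊗ Ys ⊗ qs ⊗ (Yk ⊗ qk ⊗ ENj) ⊗ κ) ·⟨ EN ⊗ iEN ≗ :1 ⟩ ∷
      (Ys ⊗ qs ⊗ (Yk ⊗ qk) ⊗ κ) ·⟨ ENj ⊗ iENj ≗ :1 ⟩ ∷
      (Ys ⊗ qs ⊗ qk ⊗ κ) ·⟨ Yk ≗ Ys ⊗ Yj ⟩ ∷
      (Ys ⊗ qs ⊗ (Ys ⊗ Yj) ⊗ κ) ·⟨ qk ≗ qs ⊗ qj ⟩ ∷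
      [] ⊢ l ⊗ (iEN ⊗ iENj)
        ≗ Ys ⊗ qs ⊗ (Ys ⊗ Yj ⊗ (qs ⊗ qj)) ⊗ κ) (h1 ∷ h2 ∷ h3 ∷ h4 ∷ h5 ∷ []) refl

  separate-E : ∀ u iEN iEns sk Ens T X Z qz iENj g →
    Ens * iEns ≈ 1# →
    u * (iEN * iEns) * (sk * (Ens * T) * X * Z * qz * (iENj * g))
      ≈ u * (sk * qz) * (iEN * iENj) * (T * g * (X * Z))
  separate-E u iEN iEns sk Ens T X Z qz iENj g h1 = linear-combination (u ∷ iEN ∷ iEns ∷ sk ∷ Ens ∷
    T ∷ X ∷ Z ∷ qz ∷ iENj ∷ g ∷ [])
    (λ u iEN iEns sk Ens T X Z qz iENj g →
      (u ⊗ iEN ⊗ (sk ⊗ T ⊗ X ⊗ Z ⊗ qz ⊗ (iENj ⊗ g))) ·⟨ Ens ⊗ iEns ≗ :1 ⟩ ∷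
      [] ⊢ u ⊗ (iEN ⊗ iEns) ⊗ (sk ⊗ (Ens ⊗ T) ⊗ X ⊗ Z ⊗ qz ⊗ (iENj ⊗ g))
        ≗ u ⊗ (sk ⊗ qz) ⊗ (iEN ⊗ iENj) ⊗ (T ⊗ g ⊗ (X ⊗ Z))) (h1 ∷ []) refl

  regroup : ∀ Ys qs Yj qj κ T g₀ g₁ g₂ g₃ xs xj ys yj →
    Ys * qs * (Ys * Yj * (qs * qj)) * κ * (T * (g₀ * (g₁ * g₂) * (g₁ * g₃)) * (xs * xj * (ys * yj)))
      ≈ Ys * qs * g₁ * xs * (Ys * qs * g₁ * ys) * (κ * (Yj * T) * (g₀ * g₂ * g₃) * qj * (xj * yj))
  regroup = solve 14 (λ Ys qs Yj qj κ T g₀ g₁ g₂ g₃ xs xj ys yj →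
    Ys ⊗ qs ⊗ (Ys ⊗ Yj ⊗ (qs ⊗ qj)) ⊗ κ ⊗ (T ⊗ (g₀ ⊗ (g₁ ⊗ g₂) ⊗ (g₁ ⊗ g₃)) ⊗ (xs ⊗ xj ⊗ (ys ⊗ yj)))
    ⊜ Ys ⊗ qs ⊗ g₁ ⊗ xs ⊗ (Ys ⊗ qs ⊗ g₁ ⊗ ys) ⊗ (κ ⊗ (Yj ⊗ T) ⊗ (g₀ ⊗ g₂ ⊗ g₃) ⊗ qj ⊗ (xj ⊗ yj)))
      refl

-- Cancellation in fields and finite sums.

module FieldProperties {f ℓ} (F : Field f ℓ) where
  open Field F hiding (zero)
  open SetoidReasoning setoid

  ⁻¹-inverseˡ : ∀ {x} → ¬ x ≈ 0# → x ⁻¹ * x ≈ 1#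
  ⁻¹-inverseˡ x≉0 = trans (*-comm _ _) (⁻¹-inverseʳ x≉0)

  *-cancelˡ : ∀ {m x y} → ¬ m ≈ 0# → m * x ≈ m * y → x ≈ y
  *-cancelˡ {m} {x} {y} m≉0 e = begin
    x               ≈⟨ *-identityˡ x ⟨
    1# * x          ≈⟨ *-congʳ (⁻¹-inverseˡ m≉0) ⟨
    m ⁻¹ * m * x    ≈⟨ *-assoc _ _ _ ⟩
    m ⁻¹ * (m * x)  ≈⟨ *-congˡ e ⟩
    m ⁻¹ * (m * y)  ≈⟨ *-assoc _ _ _ ⟨
    m ⁻¹ * m * y    ≈⟨ *-congʳ (⁻¹-inverseˡ m≉0) ⟩
    1# * y          ≈⟨ *-identityˡ y ⟩
    y               ∎

  *-nonzero : ∀ {x y} → ¬ x ≈ 0# → ¬ y ≈ 0# → ¬ x * y ≈ 0#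
  *-nonzero {x} x≉0 y≉0 e = y≉0 (*-cancelˡ x≉0 (trans e (sym (zeroʳ x))))

  1-x≉0 : ∀ {x} → ¬ x ≈ 1# → ¬ 1# - x ≈ 0#
  1-x≉0 {x} x≉1 e = x≉1 (sym (x∙y⁻¹≈ε⇒x≈y 1# x e))
    where open GroupProperties +-group using (x∙y⁻¹≈ε⇒x≈y)

module Sums {f ℓ} (F : Field f ℓ) where
  open Field F hiding (zero)
  open QSeries F using (sumFromTo)
  open CommutativeMonoidSum +-commutativeMonoid using (sum; sum-cong-≋; sum-init-last)
  open CommutativeSemigroupProperties +-commutativeSemigroup using (interchange)

  -- The last term is split off, as telescoping requires; `sum` splits off the first.
  ∑≤ : ℕ → (ℕ → Carrier) → Carrier
  ∑≤ zero    t = t 0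
  ∑≤ (suc n) t = ∑≤ n t + t (suc n)

  ∑≤-cong′ : ∀ n {t u} → (∀ {k} → k ℕ.≤ n → t k ≈ u k) → ∑≤ n t ≈ ∑≤ n u
  ∑≤-cong′ zero    e = e ℕ.z≤n
  ∑≤-cong′ (suc n) e = +-cong (∑≤-cong′ n λ k≤n → e (ℕₚ.m≤n⇒m≤1+n k≤n)) (e ℕₚ.≤-refl)

  ∑≤-cong : ∀ n {t u} → (∀ k → t k ≈ u k) → ∑≤ n t ≈ ∑≤ n u
  ∑≤-cong n e = ∑≤-cong′ n λ {k} _ → e k

  ∑≤-+ : ∀ n t u → ∑≤ n t + ∑≤ n u ≈ ∑≤ n (λ k → t k + u k)
  ∑≤-+ zero    t u = refl
  ∑≤-+ (suc n) t u = trans (interchange _ _ _ _) (+-congʳ (∑≤-+ n t u))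

  ∑≤-* : ∀ n x t → x * ∑≤ n t ≈ ∑≤ n (λ k → x * t k)
  ∑≤-* zero    x t = refl
  ∑≤-* (suc n) x t = trans (distribˡ _ _ _) (+-congʳ (∑≤-* n x t))

  ∑≤-+* : ∀ n {x t s u} → s ≈ ∑≤ n u → x * ∑≤ n t + s ≈ ∑≤ n (λ k → x * t k + u k)
  ∑≤-+* n e = trans (+-cong (∑≤-* n _ _) e) (∑≤-+ n _ _)

  ∑≤-head : ∀ n {t} → (∀ k → t (suc k) ≈ 0#) → ∑≤ n t ≈ t 0
  ∑≤-head zero    e = refl
  ∑≤-head (suc n) e = trans (+-cong (∑≤-head n e) (e n)) (+-identityʳ _)

  telescope : ∀ {t} (g : ℕ → Carrier) → t 0 ≈ g 0 → (∀ n → g n + t (suc n) ≈ g (suc n)) →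
              ∀ n → ∑≤ n t ≈ g n
  telescope g base step zero    = base
  telescope g base step (suc n) = trans (+-congʳ (telescope g base step n)) (step n)

  sumFromTo-∑≤ : ∀ s n t → sumFromTo s (s ℕ.+ n) t ≈ ∑≤ n (λ k → t (s ℕ.+ k))
  sumFromTo-∑≤ s n t = trans
    (reflexive (≡.cong (λ l → sum {l} (λ i → t (s ℕ.+ toℕ i))) length))
    (sum-∑≤ n (λ k → t (s ℕ.+ k)))
    where
    length : suc (s ℕ.+ n) ℕ.∸ s ≡.≡ suc n
    length = ≡.trans (≡.cong (ℕ._∸ s) (≡.sym (ℕₚ.+-suc s n))) (ℕₚ.m+n∸m≡n s (suc n))
    sum-∑≤ : ∀ n u → sum {suc n} (λ i → u (toℕ i)) ≈ ∑≤ n u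
    sum-∑≤ zero    u = +-identityʳ (u 0)
    sum-∑≤ (suc n) u = trans (sum-init-last {suc n} (λ i → u (toℕ i)))
      (+-cong (trans (sum-cong-≋ {suc n} λ i → reflexive (≡.cong u (Finₚ.toℕ-inject₁ i))) (sum-∑≤ n u))
              (reflexive (≡.cong u (Finₚ.toℕ-fromℕ (suc n)))))

-- Relations between sums of q-shifted factorials at shifted arguments.

module Recurrences {f ℓ} (F : Field f ℓ) (q : Field.Carrier F) where
  open Field F hiding (zero)
  open QSeries F
  open Sums F
  open RingIdentities commutativeRing
  open ℤ-RingSolver commutativeRing using (solve; _⊗_; _⊜_)
  open SetoidReasoning setoid

  ⟪⟫-shift : ∀ X k → ⟪ X ⨾ q ⟫ (suc k) ≈ (1# - X) * ⟪ q * X ⨾ q ⟫ k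
  ⟪⟫-shift X zero    = trans (*-identityˡ _) (trans (+-congˡ (-‿cong (*-identityʳ X))) (sym (*-identityʳ _)))
  ⟪⟫-shift X (suc k) = begin
    ⟪ X ⨾ q ⟫ (suc k) * (1# - X * (q * q ^ k))         ≈⟨ *-cong (⟪⟫-shift X k) (+-congˡ (-‿cong X*q*w)) ⟩
    (1# - X) * ⟪ q * X ⨾ q ⟫ k * (1# - q * X * q ^ k)  ≈⟨ *-assoc _ _ _ ⟩
    (1# - X) * ⟪ q * X ⨾ q ⟫ (suc k)                   ∎
    where
    X*q*w : X * (q * q ^ k) ≈ q * X * q ^ k
    X*q*w = trans (sym (*-assoc _ _ _)) (*-congʳ (*-comm X q))

  ⟪⟫-cong : ∀ k {X Y} → X ≈ Y → ⟪ X ⨾ q ⟫ k ≈ ⟪ Y ⨾ q ⟫ k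
  ⟪⟫-cong zero    e = refl
  ⟪⟫-cong (suc k) e = *-cong (⟪⟫-cong k e) (+-congˡ (-‿cong (*-congʳ e)))

  S₁ : ℕ → (ℕ → Carrier) → Carrier → Carrier
  S₁ n e X = ∑≤ n λ k → e k * ⟪ X ⨾ q ⟫ k

  S₂ : ℕ → (ℕ → Carrier) → Carrier → Carrier → Carrier
  S₂ n e X Y = ∑≤ n λ k → e k * (⟪ X ⨾ q ⟫ k * ⟪ Y ⨾ q ⟫ k)

  S₁-cong : ∀ n {e X Y} → X ≈ Y → S₁ n e X ≈ S₁ n e Y
  S₁-cong n h = ∑≤-cong n λ k → *-congˡ (⟪⟫-cong k h)

  S₂-cong : ∀ n {e X X′ Y Y′} → X ≈ X′ → Y ≈ Y′ → S₂ n e X Y ≈ S₂ n e X′ Y′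
  S₂-cong n h h′ = ∑≤-cong n λ k → *-congˡ (*-cong (⟪⟫-cong k h) (⟪⟫-cong k h′))

  module _ (c y Q : Carrier) (y*Q≈1 : y * Q ≈ 1#) where

    -- The partial sums of the left side have the closed form `g`, which contains Q - q²ᵏ and so
    -- vanishes at the upper limit, where Q = q²ⁿ.
    U-recurrence : ∀ (a : ℕ → Carrier) →
      (∀ k → a (suc k) * ((1# - q * q ^ k) * (1# - c * q ^ k)) ≈ a k * (1# - y * (q ^ k * q ^ k))) →
      ∀ n → Q ≈ q ^ n * q ^ n → ∀ Z → let U = S₁ n (λ k → a k * q ^ k) in
      (1# - q * Z) * U (q * (q * Z)) + (- (1# - c * Q) * U (q * Z) + - (Q * (c - q * Z)) * U Z) ≈ 0#
    U-recurrence a a-step n Q≈ Z = begin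
      _  ≈⟨ ∑≤-+* n (∑≤-+* n (∑≤-* n _ _)) ⟩
      _  ≈⟨ telescope {t} g base step n ⟩
      Z * q * a n * (Q - q ^ n * q ^ n) * ⟪ q * Z ⨾ q ⟫ n
         ≈⟨ *-congʳ (*-congˡ (trans (+-congʳ Q≈) (-‿inverseʳ _))) ⟩
      Z * q * a n * 0# * ⟪ q * Z ⨾ q ⟫ n
         ≈⟨ trans (*-congʳ (zeroʳ _)) (zeroˡ _) ⟩
      0# ∎
      where
      t g : ℕ → Carrier
      t k = (1# - q * Z) * (a k * q ^ k * ⟪ q * (q * Z) ⨾ q ⟫ k)
          + (- (1# - c * Q) * (a k * q ^ k * ⟪ q * Z ⨾ q ⟫ k) + - (Q * (c - q * Z)) * (a k * q ^ k * ⟪ Z ⨾ q ⟫ k))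
      g k = Z * q * a k * (Q - q ^ k * q ^ k) * ⟪ q * Z ⨾ q ⟫ k
      base : t 0 ≈ g 0
      base = U-telescope₀ q c Q Z (a 0)
      step : ∀ k → g k + t (suc k) ≈ g (suc k)
      step k = U-telescope q c y Q Z (q ^ k) (a k) (a (suc k)) (⟪ q * Z ⨾ q ⟫ k) (⟪ Z ⨾ q ⟫ (suc k))
        (⟪ q * (q * Z) ⨾ q ⟫ (suc k))
        (sym (⟪⟫-shift (q * Z) (suc k))) (⟪⟫-shift Z k) (a-step k) y*Q≈1

  module _ (b b° : ℕ → Carrier) (Z D : Carrier) where
    private
      c : Carrier
      c = q * (q * (Z * D))

    module _ (b°-def : ∀ k → b° k ≈ b k * (1# - c * (q ^ k * q ^ k))) where

      -- True term by term, so no boundary condition is involved. The arguments of the first sum on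
      -- the right multiply to qc; those of the second are q times a pair whose product is c/q.
      R-relation : ∀ n →
        S₂ n (λ k → b° k * q ^ k) (q * Z) (q * D) ≈
        (1# - q * D) * S₂ n (λ k → b k * q ^ k) (q * Z) (q * (q * D))
          + q * D * (1# - q * Z) * S₂ n (λ k → b k * (q ^ k * q ^ k)) (q * (q * Z)) (q * D)
      R-relation n = sym (begin
        _ ≈⟨ ∑≤-+* n (∑≤-* n _ _) ⟩
        _ ≈⟨ ∑≤-cong n (λ k → R-term c (q * Z) (q * D) (q ^ k) (b k) (b° k) _ _ _ _
               (sym (⟪⟫-shift (q * D) k)) (sym (⟪⟫-shift (q * Z) k)) (b°-def k) c≈) ⟩
        _ ∎)
        where
        c≈ : c ≈ q * Z * (q * D)
        c≈ = solve 3 (λ q Z D → q ⊗ (q ⊗ (Z ⊗ D)) ⊜ q ⊗ Z ⊗ (q ⊗ D)) refl q Z D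

      module _ (y Q : Carrier) (y*Q≈1 : y * Q ≈ 1#)
               (b-step : ∀ k → b (suc k) * ((1# - q * q ^ k) * (1# - c * q ^ k)
                           * (1# - c * (q * (q ^ k * q ^ k))) * (1# - c * (q * q ^ k * (q * q ^ k))))
                         ≈ b k * ((1# - y * (q ^ k * q ^ k)) * (1# - c * c * Q * (q ^ k * q ^ k)))) where

        -- This is the relation that eliminating U(Z) U(D) from the two recurrences would force on
        -- the sums. It is true only after summation: the partial sums are `g`, whose factor 1 - y
        -- q²ᵏ vanishes at k = n.
        P-relation : ∀ n → Q ≈ q ^ n * q ^ n → let K = (1# - c * Q) * (1# - c * Q) * y in
          q * Z * ((1# - q * D) * (1# - q * D)) * S₂ n (λ k → b° k * q ^ k) Z (q * (q * D))
          + (- (q * D * ((1# - q * Z) * (1# - q * Z))) * S₂ n (λ k → b° k * q ^ k) (q * (q * Z)) D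
          + (- (K * (q * Z * (1# - q * D))) * S₂ n (λ k → b k * (q ^ k * q ^ k)) (q * Z) (q * (q * D))
          + K * (q * D * (1# - q * Z)) * S₂ n (λ k → b k * (q ^ k * q ^ k)) (q * (q * Z)) (q * D))) ≈ 0#
        P-relation n Q≈ = begin
          _ ≈⟨ ∑≤-+* n (∑≤-+* n (∑≤-+* n (∑≤-* n _ _))) ⟩
          _ ≈⟨ telescope g (P-telescope₀ q y Q Z D (b 0) (b° 0) (b°-def 0) y*Q≈1) step n ⟩
          g n ≈⟨ *-congʳ (*-congʳ (*-congˡ 1-y*w²≈0)) ⟩
          _ ≈⟨ trans (*-congʳ (trans (*-congʳ (zeroʳ _)) (zeroˡ _))) (zeroˡ _) ⟩
          0# ∎
          where
          1-y*w²≈0 : 1# - y * (q ^ n * q ^ n) ≈ 0#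
          1-y*w²≈0 = trans (+-congˡ (-‿cong (trans (*-congˡ (sym Q≈)) y*Q≈1))) (-‿inverseʳ 1#)
          g : ℕ → Carrier
          g k = (q * Z - q * D) * b k * (1# - y * (q ^ k * q ^ k)) * (1# - c * c * Q * (q ^ k * q ^ k))
                * (⟪ q * Z ⨾ q ⟫ k * ⟪ q * D ⨾ q ⟫ k)
          step : ∀ k → g k + _ ≈ g (suc k)
          step k = P-telescope q y Q Z D (q ^ k) (b k) (b (suc k)) (b° (suc k)) _ _ _ _ _ _
            (sym (⟪⟫-shift (q * D) (suc k))) (⟪⟫-shift Z k) (sym (⟪⟫-shift (q * Z) (suc k))) (⟪⟫-shift D k)
            (b°-def (suc k)) (b-step k) y*Q≈1

-- Polynomial functions and their roots.

module PolynomialFunctions {f ℓ} (F : Field f ℓ) where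
  open Field F hiding (zero)
  open FieldProperties F
  open Sums F
  open ℤ-RingSolver commutativeRing using (solve; _⊗_; _⊕_; _:-_; :0; _⊜_)
  open SetoidReasoning setoid

  -- The index bounds the number of coefficients.
  data Polynomial : ℕ → (Carrier → Carrier) → Set (f ⊔ ℓ) where
    null   : ∀ {p} → (∀ X → p X ≈ 0#) → Polynomial 0 p
    horner : ∀ {n p p′} a → Polynomial n p′ → (∀ X → p X ≈ a + X * p′ X) → Polynomial (suc n) p

  IsPolynomial : (Carrier → Carrier) → Set (f ⊔ ℓ)
  IsPolynomial p = ∃ λ n → Polynomial n p

  Polynomial-resp : ∀ {n p r} → (∀ X → p X ≈ r X) → Polynomial n p → Polynomial n r
  Polynomial-resp e (null h)       = null λ X → trans (sym (e X)) (h X)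
  Polynomial-resp e (horner a P h) = horner a P λ X → trans (sym (e X)) (h X)

  Polynomial-+ : ∀ {m n p r} → Polynomial m p → Polynomial n r → Polynomial (m ℕ.⊔ n) (λ X → p X + r X)
  Polynomial-+ (null h) R = Polynomial-resp (λ X → sym (trans (+-congʳ (h X)) (+-identityˡ _))) R
  Polynomial-+ P@(horner _ _ _) (null h) = Polynomial-resp (λ X → sym (trans (+-congˡ (h X)) (+-identityʳ _))) P
  Polynomial-+ {p = p} {r} (horner {p′ = p′} a P h) (horner {p′ = r′} b R h′) = horner (a + b) (Polynomial-+ P R) λ
    X → begin
    p X + r X                            ≈⟨ +-cong (h X) (h′ X) ⟩
    (a + X * p′ X) + (b + X * r′ X)      ≈⟨ solve 5
      (λ a b X p r → (a ⊕ X ⊗ p) ⊕ (b ⊕ X ⊗ r) ⊜ (a ⊕ b) ⊕ X ⊗ (p ⊕ r)) refl a b X (p′ X) (r′ X) ⟩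
    (a + b) + X * (p′ X + r′ X)          ∎

  Polynomial-scale : ∀ {n p} c → Polynomial n p → Polynomial n (λ X → c * p X)
  Polynomial-scale c (null h) = null λ X → trans (*-congˡ (h X)) (zeroʳ c)
  Polynomial-scale {p = p} c (horner {p′ = p′} a P h) = horner (c * a) (Polynomial-scale c P) λ X → begin
    c * p X                  ≈⟨ *-congˡ (h X) ⟩
    c * (a + X * p′ X)       ≈⟨ solve 4 (λ c a X p → c ⊗ (a ⊕ X ⊗ p) ⊜ c ⊗ a ⊕ X ⊗ (c ⊗ p)) refl c a X (p′ X) ⟩
    c * a + X * (c * p′ X)   ∎

  constant : ∀ c → IsPolynomial (λ _ → c)
  constant c = 1 , horner c (null λ _ → refl) λ X → sym (trans (+-congˡ (zeroʳ X)) (+-identityʳ c))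

  identity : IsPolynomial (λ X → X)
  identity = 2 , horner 0# (proj₂ (constant 1#)) λ X → sym (trans (+-identityˡ _) (*-identityʳ X))

  resp : ∀ {p r} → (∀ X → p X ≈ r X) → IsPolynomial p → IsPolynomial r
  resp e (n , P) = n , Polynomial-resp e P

  infixl 6 _⊞_
  infixl 7 _⊠_

  _⊞_ : ∀ {p r} → IsPolynomial p → IsPolynomial r → IsPolynomial (λ X → p X + r X)
  (_ , P) ⊞ (_ , R) = _ , Polynomial-+ P R

  _⊠_ : ∀ {p r} → IsPolynomial p → IsPolynomial r → IsPolynomial (λ X → p X * r X)
  (_ , null h) ⊠ _ = 0 , null λ X → trans (*-congʳ (h X)) (zeroˡ _)
  _⊠_ {p} {r} (_ , horner {p′ = p′} a P h) (n , R) =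
    let m , PR = (_ , P) ⊠ (n , R) in
    resp (λ X → begin
      a * r X + (0# + X * (p′ X * r X))  ≈⟨ solve 4 (λ a X p r → a ⊗ r ⊕ (:0 ⊕ X ⊗ (p ⊗ r)) ⊜ (a ⊕ X ⊗ p) ⊗ r) refl
        a X (p′ X) (r X) ⟩
      (a + X * p′ X) * r X               ≈⟨ *-congʳ (h X) ⟨
      p X * r X                          ∎)
    ((n , Polynomial-scale a R) ⊞ (suc m , horner 0# PR λ _ → refl))

  ∑-polynomial : ∀ n {t : ℕ → Carrier → Carrier} → (∀ k → IsPolynomial (t k)) →
                 IsPolynomial (λ X → ∑≤ n (λ k → t k X))
  ∑-polynomial zero    P = P 0
  ∑-polynomial (suc n) P = ∑-polynomial n P ⊞ P (suc n)

  -- Synthetic division: if p = a + X p′ and g is the quotient of p′ by X - r, then p′(r) + X g is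
  -- the quotient of p.
  divide : ∀ {n p} → Polynomial (suc n) p → ∀ r →
           ∃[ g ] Polynomial n g Product.× (∀ X → p X ≈ p r + (X - r) * g X)
  divide {p = p} (horner {p′ = p′} a (null z) h) r = (λ _ → 0#) , null (λ _ → refl) , λ X → begin
    p X                    ≈⟨ p≈a X ⟩
    a                      ≈⟨ p≈a r ⟨
    p r                    ≈⟨ +-identityʳ _ ⟨
    p r + 0#               ≈⟨ +-congˡ (zeroʳ _) ⟨
    p r + (X - r) * 0#     ∎
    where
    p≈a : ∀ X → p X ≈ a
    p≈a X = trans (h X) (trans (+-congˡ (trans (*-congˡ (z X)) (zeroʳ X))) (+-identityʳ a))
  divide {p = p} (horner {p′ = p′} a P@(horner _ _ _) h) r =
    let g , G , e = divide P r in
    (λ X → p′ r + X * g X) , horner (p′ r) G (λ _ → refl) , λ X → begin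
      p X                                              ≈⟨ h X ⟩
      a + X * p′ X                                     ≈⟨ +-congˡ (*-congˡ (e X)) ⟩
      a + X * (p′ r + (X - r) * g X)
        ≈⟨ solve 5 (λ a X r p g → a ⊕ X ⊗ (p ⊕ (X :- r) ⊗ g) ⊜ (a ⊕ r ⊗ p) ⊕ (X :- r) ⊗ (p ⊕ X ⊗ g)) refl a X r
        (p′ r) (g X) ⟩
      (a + r * p′ r) + (X - r) * (p′ r + X * g X)      ≈⟨ +-congʳ (h r) ⟨
      p r + (X - r) * (p′ r + X * g X)                 ∎

  -- Each root divided out lowers the number of coefficients by one, and the later roots pass to the
  -- quotient. An infinite sequence of roots makes it unnecessary to know the degree.
  many-roots : ∀ {n p} → Polynomial n p → (r : ℕ → Carrier) → (∀ {i j} → i ℕ.< j → ¬ r j ≈ r i) →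
               (∀ i → p (r i) ≈ 0#) → ∀ X → p X ≈ 0#
  many-roots {zero}  (null h) r distinct root X = h X
  many-roots {suc n} {p} P r distinct root X =
    let g , G , e = divide P (r 0)
        g-root i = *-cancelˡ (λ z → distinct (ℕ.s≤s ℕ.z≤n) (x∙y⁻¹≈ε⇒x≈y _ _ z)) (begin
          (r (suc i) - r 0) * g (r (suc i))              ≈⟨ +-identityˡ _ ⟨
          0# + (r (suc i) - r 0) * g (r (suc i))         ≈⟨ +-congʳ (root 0) ⟨
          p (r 0) + (r (suc i) - r 0) * g (r (suc i))    ≈⟨ e (r (suc i)) ⟨
          p (r (suc i))                                  ≈⟨ root (suc i) ⟩
          0#                                             ≈⟨ zeroʳ _ ⟨
          (r (suc i) - r 0) * 0#                         ∎)
    in begin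
    p X                          ≈⟨ e X ⟩
    p (r 0) + (X - r 0) * g X    ≈⟨ +-cong (root 0)
      (*-congˡ (many-roots G (λ i → r (suc i)) (λ i<j → distinct (ℕ.s≤s i<j)) g-root X)) ⟩
    0# + (X - r 0) * 0#          ≈⟨ trans (+-identityˡ _) (zeroʳ _) ⟩
    0#                           ∎
    where open GroupProperties +-group using (x∙y⁻¹≈ε⇒x≈y)

-- The product formula for X Y = c: induction over X = q⁻ᵐ, then extension to all X.

module ProductFormula {f ℓ} (F : Field f ℓ) where
  open Field F hiding (zero)
  open QSeries F

  -- The coefficients enter through their ratios and `a 0` only. The constant factor of `b` is left
  -- open; the premise `U c ≈ b° 0` of the final formula fixes it.
  module Formula
    (q c y Q : Carrier) (n : ℕ) (a b b° : ℕ → Carrier)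
    (q≉0 : ¬ q ≈ 0#) (c≉0 : ¬ c ≈ 0#)
    (q^≉1 : ∀ k → ¬ q ^ suc k ≈ 1#) (cq^≉1 : ∀ k → ¬ c * q ^ k ≈ 1#)
    (y*Q≈1 : y * Q ≈ 1#) (Q≈ : Q ≈ q ^ n * q ^ n)
    (a-step : ∀ k → a (suc k) * ((1# - q * q ^ k) * (1# - c * q ^ k)) ≈ a k * (1# - y * (q ^ k * q ^ k)))
    (b°-def : ∀ k → b° k ≈ b k * (1# - c * (q ^ k * q ^ k)))
    (b-step : ∀ k → b (suc k) * ((1# - q * q ^ k) * (1# - c * q ^ k)
                * (1# - c * (q * (q ^ k * q ^ k))) * (1# - c * (q * q ^ k * (q * q ^ k))))
              ≈ b k * ((1# - y * (q ^ k * q ^ k)) * (1# - c * c * Q * (q ^ k * q ^ k))))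
    (a0≈1 : a 0 ≈ 1#) where

    open FieldProperties F
    open Sums F
    open Recurrences F q
    open RingIdentities commutativeRing
    open ℤ-RingSolver commutativeRing using (solve; _⊗_; _⊕_; _:-_; ⊝_; :1; _⊜_)
    open PolynomialFunctions F
    open SetoidReasoning setoid
    open Exp semiring using (^-homo-*; ^-cong)

    U : Carrier → Carrier
    U = S₁ n (λ k → a k * q ^ k)

    -- In the induction U(X) U(Y) is (1 - cQ) R(X,Y) when X Y = qc, and (1 - cQ) y R′(qX,qY) when X
    -- Y = c/q: `R′` takes arguments that are already shifted.
    P R R′ : Carrier → Carrier → Carrier
    P  = S₂ n (λ k → b° k * q ^ k)
    R  = S₂ n (λ k → b k * q ^ k)
    R′ = S₂ n (λ k → b k * (q ^ k * q ^ k))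

    module _ (Z D : Carrier) where
      -- The factors 1 - q Z make the last three fields vacuous at the start qZ = 1 of the induction.
      record Products : Set ℓ where
        field
          U*U≈P    : U (q * Z) * U (q * D) ≈ P (q * Z) (q * D)
          previous : (1# - q * Z) * (U (q * (q * Z)) * U D) ≈ (1# - q * Z) * P (q * (q * Z)) D
          U*U≈R    : (1# - q * Z) * (U (q * (q * Z)) * U (q * D)) ≈ (1# - q * Z) *
            ((1# - c * Q) * R (q * (q * Z)) (q * D))
          U*U≈R′   : (1# - q * Z) * (U (q * Z) * U D) ≈ (1# - q * Z) * ((1# - c * Q) * y * R′ (q * (q * Z)) (q * D))

      module Advance (c≈ : c ≈ q * (q * (Z * D))) (Z≉0 : ¬ Z ≈ 0#) (qD≉1 : ¬ q * D ≈ 1#) (products : Products) where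
        open Products products

        private
          c′ : Carrier
          c′ = q * (q * (Z * D))

          c≈ad : c ≈ q * Z * (q * D)
          c≈ad = trans c≈ (solve 3 (λ q Z D → q ⊗ (q ⊗ (Z ⊗ D)) ⊜ q ⊗ Z ⊗ (q ⊗ D)) refl q Z D)

          1-c-cong : ∀ u → 1# - c * u ≈ 1# - c′ * u
          1-c-cong u = +-congˡ (-‿cong (*-congʳ c≈))

          b°-def′ : ∀ k → b° k ≈ b k * (1# - c′ * (q ^ k * q ^ k))
          b°-def′ k = trans (b°-def k) (*-congˡ (1-c-cong _))

          b°-def″ : ∀ k → b° k ≈ b k * (1# - q * (q * (D * Z)) * (q ^ k * q ^ k))
          b°-def″ k = trans (b°-def′ k) (*-congˡ (+-congˡ (-‿cong (*-congʳ (*-congˡ (*-congˡ (*-comm Z D)))))))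

          qZ≉0 : ¬ q * Z ≈ 0#
          qZ≉0 = *-nonzero q≉0 Z≉0

          1-qD≉0 : ¬ 1# - q * D ≈ 0#
          1-qD≉0 = 1-x≉0 qD≉1

          Q≉0 : ¬ Q ≈ 0#
          Q≉0 Q≈0 = 1≉0 (trans (sym y*Q≈1) (trans (*-congˡ Q≈0) (zeroʳ y)))

          U-recZ : _
          U-recZ = U-recurrence c y Q y*Q≈1 a a-step n Q≈ Z

          U-recD : _
          U-recD = U-recurrence c y Q y*Q≈1 a a-step n Q≈ D

          relation₁ : P (q * Z) (q * D) ≈ (1# - q * D) * R (q * Z) (q * (q * D)) + q * D * (1# - q * Z) * R′
            (q * (q * Z)) (q * D)
          relation₁ = R-relation b b° Z D b°-def′ n

          S₂-comm : ∀ e X Y → S₂ n e X Y ≈ S₂ n e Y X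
          S₂-comm e X Y = ∑≤-cong n λ k → *-congˡ (*-comm _ _)

          relation₂ : P (q * Z) (q * D) ≈ (1# - q * Z) * R (q * (q * Z)) (q * D) + q * Z * (1# - q * D) * R′ (q * Z)
            (q * (q * D))
          relation₂ = begin
            P (q * Z) (q * D)  ≈⟨ S₂-comm _ _ _ ⟩
            P (q * D) (q * Z)  ≈⟨ R-relation b b° D Z b°-def″ n ⟩
            (1# - q * Z) * R (q * D) (q * (q * Z)) + q * Z * (1# - q * D) * R′ (q * (q * D)) (q * Z)
                               ≈⟨ +-cong (*-congˡ (S₂-comm _ _ _)) (*-congˡ (S₂-comm _ _ _)) ⟩
            (1# - q * Z) * R (q * (q * Z)) (q * D) + q * Z * (1# - q * D) * R′ (q * Z) (q * (q * D)) ∎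

          b-step′ : ∀ k → b (suc k) * ((1# - q * q ^ k) * (1# - c′ * q ^ k)
                      * (1# - c′ * (q * (q ^ k * q ^ k))) * (1# - c′ * (q * q ^ k * (q * q ^ k))))
                    ≈ b k * ((1# - y * (q ^ k * q ^ k)) * (1# - c′ * c′ * Q * (q ^ k * q ^ k)))
          b-step′ k = begin
            _ ≈⟨ *-congˡ (*-cong (*-cong (*-congˡ (1-c-cong _)) (1-c-cong _)) (1-c-cong _)) ⟨
            _ ≈⟨ b-step k ⟩
            _ ≈⟨ *-congˡ (*-congˡ (+-congˡ (-‿cong (*-congʳ (*-congʳ (*-cong c≈ c≈)))))) ⟩
            _ ∎

          relation₃ : q * Z * ((1# - q * D) * (1# - q * D)) * P Z (q * (q * D))
            + (- (q * D * ((1# - q * Z) * (1# - q * Z))) * P (q * (q * Z)) D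
            + (- ((1# - c * Q) * (1# - c * Q) * y * (q * Z * (1# - q * D))) * R′ (q * Z) (q * (q * D))
            + (1# - c * Q) * (1# - c * Q) * y * (q * D * (1# - q * Z)) * R′ (q * (q * Z)) (q * D))) ≈ 0#
          relation₃ = begin
            _ ≈⟨ +-congˡ (+-congˡ (+-cong (*-congʳ (-‿cong (*-congʳ K-cong))) (*-congʳ (*-congʳ K-cong)))) ⟩
            _ ≈⟨ P-relation b b° Z D b°-def′ y Q y*Q≈1 b-step′ n Q≈ ⟩
            0# ∎
            where
            K-cong : (1# - c * Q) * (1# - c * Q) * y ≈ (1# - c′ * Q) * (1# - c′ * Q) * y
            K-cong = *-congʳ (*-cong (1-c-cong Q) (1-c-cong Q))

        -- This is the instance of `U*U≈R` that the next step of the induction will consume.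
        U*U≈R⁺ : U (q * Z) * U (q * (q * D)) ≈ (1# - c * Q) * R (q * Z) (q * (q * D))
        U*U≈R⁺ = *-cancelˡ 1-qD≉0
          (advance-R c y Q (q * Z) (q * D) _ _ _ _ _ _ _ U-recD U*U≈P c≈ad U*U≈R′ y*Q≈1 relation₁)

        U*U≈R′⁺ : U Z * U (q * D) ≈ (1# - c * Q) * y * R′ (q * Z) (q * (q * D))
        U*U≈R′⁺ = *-cancelˡ (*-nonzero Q≉0 (*-nonzero qZ≉0 1-qD≉0))
          (advance-R′ c y Q (q * Z) (q * D) _ _ _ _ _ _ _ U-recZ c≈ad U*U≈R U*U≈P relation₂ y*Q≈1)

        U*U≈P⁺ : U Z * U (q * (q * D)) ≈ P Z (q * (q * D))
        U*U≈P⁺ = *-cancelˡ (*-nonzero qZ≉0 (*-nonzero 1-qD≉0 1-qD≉0))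
          (advance-P c y Q (q * Z) (q * D) _ _ _ _ _ _ _ _ _ _ U-recD U*U≈R′⁺ c≈ad U-recZ U*U≈R′ previous relation₃)

    private
      p : Carrier
      p = q ⁻¹

      q*p^ : ∀ m → q * p ^ suc m ≈ p ^ m
      q*p^ m = trans (sym (*-assoc _ _ _)) (trans (*-congʳ (⁻¹-inverseʳ q≉0)) (*-identityˡ _))

      p^*q^ : ∀ m → p ^ m * q ^ m ≈ 1#
      p^*q^ zero    = *-identityˡ 1#
      p^*q^ (suc m) = begin
        p ^ suc m * (q * q ^ m)  ≈⟨ *-assoc _ _ _ ⟨
        p ^ suc m * q * q ^ m    ≈⟨ *-congʳ (trans (*-comm _ _) (q*p^ m)) ⟩
        p ^ m * q ^ m            ≈⟨ p^*q^ m ⟩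
        1#                       ∎

      p^≉0 : ∀ m → ¬ p ^ m ≈ 0#
      p^≉0 m p^≈0 = 1≉0 (trans (sym (p^*q^ m)) (trans (*-congʳ p^≈0) (zeroˡ _)))

      -- Offset by one so that q Zₘ = q⁻ᵐ and q Dₘ = c qᵐ. The neighbouring arguments Z and q²Z are
      -- then reached without dividing by q inside the induction step.
      Zₘ Dₘ : ℕ → Carrier
      Zₘ m = p ^ suc m
      Dₘ m = c * p * q ^ m

      qDₘ : ∀ m → q * Dₘ m ≈ c * q ^ m
      qDₘ m = begin
        q * (c * p * q ^ m)    ≈⟨ solve 4 (λ q c p w → q ⊗ (c ⊗ p ⊗ w) ⊜ q ⊗ p ⊗ (c ⊗ w)) refl q c p (q ^ m) ⟩
        q * p * (c * q ^ m)    ≈⟨ *-congʳ (⁻¹-inverseʳ q≉0) ⟩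
        1# * (c * q ^ m)       ≈⟨ *-identityˡ _ ⟩
        c * q ^ m              ∎

      Dₘ-suc : ∀ m → Dₘ (suc m) ≈ q * Dₘ m
      Dₘ-suc m = solve 4 (λ c p q w → c ⊗ p ⊗ (q ⊗ w) ⊜ q ⊗ (c ⊗ p ⊗ w)) refl c p q (q ^ m)

      p^*Y : ∀ m {Y} → p ^ m * Y ≈ c → Y ≈ q * Dₘ m
      p^*Y m {Y} e = trans (*-cancelˡ (p^≉0 m) (begin
        p ^ m * Y              ≈⟨ e ⟩
        c                      ≈⟨ *-identityʳ c ⟨
        c * 1#                 ≈⟨ *-congˡ (p^*q^ m) ⟨
        c * (p ^ m * q ^ m)    ≈⟨ solve 3 (λ c p q → c ⊗ (p ⊗ q) ⊜ p ⊗ (c ⊗ q)) refl c (p ^ m) (q ^ m) ⟩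
        p ^ m * (c * q ^ m)    ∎)) (sym (qDₘ m))

      c≈ : ∀ m → c ≈ q * (q * (Zₘ m * Dₘ m))
      c≈ m = begin
        c                                      ≈⟨ *-identityʳ c ⟨
        c * 1#                                 ≈⟨ *-congˡ (*-identityˡ 1#) ⟨
        c * (1# * 1#)                          ≈⟨ *-congˡ (*-cong (p^*q^ m) (⁻¹-inverseʳ q≉0)) ⟨
        c * (p ^ m * q ^ m * (q * p))          ≈⟨ *-congˡ (*-congʳ (*-congʳ (q*p^ m))) ⟨
        c * (q * Zₘ m * q ^ m * (q * p))       ≈⟨ solve 5
          (λ c q p z w → c ⊗ (q ⊗ z ⊗ w ⊗ (q ⊗ p)) ⊜ q ⊗ (q ⊗ (z ⊗ (c ⊗ p ⊗ w)))) refl c q p (Zₘ m) (q ^ m) ⟩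
        q * (q * (Zₘ m * Dₘ m))                ∎

      ⟪1⟫-suc : ∀ k → ⟪ 1# ⨾ q ⟫ (suc k) ≈ 0#
      ⟪1⟫-suc k = trans (⟪⟫-shift 1# k) (trans (*-congʳ (-‿inverseʳ 1#)) (zeroˡ _))

      U-cong : ∀ {X Y} → X ≈ Y → U X ≈ U Y
      U-cong = S₁-cong n

      U1 : U 1# ≈ 1#
      U1 = trans (∑≤-head n λ k → trans (*-congˡ (⟪1⟫-suc k)) (zeroʳ _))
        (trans (*-identityʳ _) (trans (*-identityʳ _) a0≈1))

      P1 : ∀ Y → P 1# Y ≈ b° 0
      P1 Y = trans (∑≤-head n λ k → trans (*-congˡ (trans (*-congʳ (⟪1⟫-suc k)) (zeroˡ _))) (zeroʳ _))
        (trans (*-congˡ (*-identityˡ 1#)) (trans (*-identityʳ _) (*-identityʳ _)))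

      -- Since q Zₘ₊₁ = Zₘ and Dₘ₊₁ = q Dₘ, the new formulas are those of the step just made, and
      -- the old formula for `P` becomes `previous`. They hold outright and are only weakened by the
      -- factor 1 - qZ.
      advance : ∀ m → Products (Zₘ m) (Dₘ m) → Products (Zₘ (suc m)) (Dₘ (suc m))
      advance m products = record
        { U*U≈P    = trans (*-cong (U-cong qZ′) (U-cong qD′)) (trans U*U≈P⁺ (sym (S₂-cong n qZ′ qD′)))
        ; previous = *-congˡ (trans (*-cong (U-cong qqZ′) (U-cong D′)) (trans U*U≈P (sym (S₂-cong n qqZ′ D′))))
        ; U*U≈R    = *-congˡ (trans (*-cong (U-cong qqZ′) (U-cong qD′))
          (trans U*U≈R⁺ (*-congˡ (sym (S₂-cong n qqZ′ qD′)))))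
        ; U*U≈R′   = *-congˡ (trans (*-cong (U-cong qZ′) (U-cong D′))
          (trans U*U≈R′⁺ (*-congˡ (sym (S₂-cong n qqZ′ qD′)))))
        }
        where
        open Products products
        open Advance (Zₘ m) (Dₘ m) (c≈ m) (p^≉0 (suc m)) (λ e → cq^≉1 m (trans (sym (qDₘ m)) e)) products
        D′ : Dₘ (suc m) ≈ q * Dₘ m
        D′ = Dₘ-suc m
        qD′ : q * Dₘ (suc m) ≈ q * (q * Dₘ m)
        qD′ = *-congˡ D′
        qZ′ : q * Zₘ (suc m) ≈ Zₘ m
        qZ′ = q*p^ (suc m)
        qqZ′ : q * (q * Zₘ (suc m)) ≈ q * Zₘ m
        qqZ′ = *-congˡ qZ′

      products : U c ≈ b° 0 → ∀ m → Products (Zₘ m) (Dₘ m)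
      products Uc (suc m) = advance m (products Uc m)
      products Uc zero    = record
        { U*U≈P    = begin
            U (q * Zₘ 0) * U (q * Dₘ 0)  ≈⟨ *-cong (trans (U-cong (q*p^ 0)) U1) (trans (U-cong qD₀) Uc) ⟩
            1# * b° 0                    ≈⟨ *-identityˡ _ ⟩
            b° 0                         ≈⟨ P1 (q * Dₘ 0) ⟨
            P 1# (q * Dₘ 0)              ≈⟨ S₂-cong n (q*p^ 0) refl ⟨
            P (q * Zₘ 0) (q * Dₘ 0)      ∎
        ; previous = vanish
        ; U*U≈R    = vanish
        ; U*U≈R′   = vanish
        }
        where
        qD₀ : q * Dₘ 0 ≈ c
        qD₀ = trans (qDₘ 0) (*-identityʳ c)
        vanish : ∀ {u v} → (1# - q * Zₘ 0) * u ≈ (1# - q * Zₘ 0) * v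
        vanish = trans (*-congʳ 1-qZ₀) (trans (zeroˡ _) (sym (trans (*-congʳ 1-qZ₀) (zeroˡ _))))
          where
          1-qZ₀ : 1# - q * Zₘ 0 ≈ 0#
          1-qZ₀ = trans (+-congˡ (-‿cong (q*p^ 0))) (-‿inverseʳ 1#)

      product-formula-p^ : U c ≈ b° 0 → ∀ m {Y} → p ^ m * Y ≈ c → U (p ^ m) * U Y ≈ P (p ^ m) Y
      product-formula-p^ Uc m {Y} e = begin
        U (p ^ m) * U Y                ≈⟨ *-cong (U-cong (q*p^ m)) (U-cong (sym (p^*Y m e))) ⟨
        U (q * Zₘ m) * U (q * Dₘ m)    ≈⟨ Products.U*U≈P (products Uc m) ⟩
        P (q * Zₘ m) (q * Dₘ m)        ≈⟨ S₂-cong n (q*p^ m) (sym (p^*Y m e)) ⟩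
        P (p ^ m) Y                    ∎

      -- With j = i + 1 + k, equality would force qᵏ⁺¹ = 1.
      p^-distinct : ∀ {i j} → i ℕ.< j → ¬ p ^ j ≈ p ^ i
      p^-distinct {i} {j} i<j e with ℕₚ.m≤n⇒∃[o]m+o≡n i<j
      ... | k , ≡.refl = q^≉1 k (begin
        q ^ suc k                                  ≈⟨ *-identityˡ _ ⟨
        1# * q ^ suc k                             ≈⟨ *-congʳ (p^*q^ i) ⟨
        p ^ i * q ^ i * q ^ suc k                  ≈⟨ *-congʳ (*-congʳ e) ⟨
        p ^ (suc i ℕ.+ k) * q ^ i * q ^ suc k      ≈⟨ *-assoc _ _ _ ⟩
        p ^ (suc i ℕ.+ k) * (q ^ i * q ^ suc k)    ≈⟨ *-congˡ (^-homo-* q i (suc k)) ⟨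
        p ^ (suc i ℕ.+ k) * q ^ (i ℕ.+ suc k)      ≈⟨ *-congˡ (^-cong (refl {q}) (ℕₚ.+-suc i k)) ⟩
        p ^ (suc i ℕ.+ k) * q ^ (suc i ℕ.+ k)      ≈⟨ p^*q^ (suc i ℕ.+ k) ⟩
        1#                                         ∎)

      -- With X Y = c, this is X ^ k * ⟪ Y ⨾ q ⟫ k.
      reflected : ℕ → Carrier → Carrier
      reflected zero    X = 1#
      reflected (suc k) X = reflected k X * (X - c * q ^ k)

      module _ {X Y} (X*Y≈c : X * Y ≈ c) where
        ^*⟪⟫ : ∀ k → X ^ k * ⟪ Y ⨾ q ⟫ k ≈ reflected k X
        ^*⟪⟫ zero    = *-identityˡ 1#
        ^*⟪⟫ (suc k) = begin
          X * X ^ k * (⟪ Y ⨾ q ⟫ k * (1# - Y * q ^ k))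
            ≈⟨ solve 5 (λ X Xk Y Yk w → X ⊗ Xk ⊗ (Yk ⊗ (:1 :- Y ⊗ w)) ⊜ Xk ⊗ Yk ⊗ (X :- X ⊗ Y ⊗ w)) refl X (X ^ k) Y
            (⟪ Y ⨾ q ⟫ k) (q ^ k) ⟩
          X ^ k * ⟪ Y ⨾ q ⟫ k * (X - X * Y * q ^ k)         ≈⟨ *-cong (^*⟪⟫ k) (+-congˡ (-‿cong (*-congʳ X*Y≈c))) ⟩
          reflected k X * (X - c * q ^ k)                   ∎

        ^n*⟪⟫ : ∀ {k} → k ℕ.≤ n → X ^ n * ⟪ Y ⨾ q ⟫ k ≈ X ^ (n ℕ.∸ k) * reflected k X
        ^n*⟪⟫ {k} k≤n = begin
          X ^ n * ⟪ Y ⨾ q ⟫ k                          ≈⟨ *-congʳ (^-cong (refl {X}) (ℕₚ.m∸n+n≡m k≤n)) ⟨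
          X ^ (n ℕ.∸ k ℕ.+ k) * ⟪ Y ⨾ q ⟫ k            ≈⟨ *-congʳ (^-homo-* X (n ℕ.∸ k) k) ⟩
          X ^ (n ℕ.∸ k) * X ^ k * ⟪ Y ⨾ q ⟫ k          ≈⟨ *-assoc _ _ _ ⟩
          X ^ (n ℕ.∸ k) * (X ^ k * ⟪ Y ⨾ q ⟫ k)        ≈⟨ *-congˡ (^*⟪⟫ k) ⟩
          X ^ (n ℕ.∸ k) * reflected k X                ∎

      -- These are Xⁿ U(c/X) and Xⁿ P(X, c/X) with the division carried out factor by factor, which
      -- makes them polynomials in X.
      V W : Carrier → Carrier
      V X = ∑≤ n λ k → a k * q ^ k * (X ^ (n ℕ.∸ k) * reflected k X)
      W X = ∑≤ n λ k → b° k * q ^ k * (⟪ X ⨾ q ⟫ k * (X ^ (n ℕ.∸ k) * reflected k X))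

      V≈ : ∀ {X Y} → X * Y ≈ c → X ^ n * U Y ≈ V X
      V≈ {X} X*Y≈c = trans (∑≤-* n _ _) (∑≤-cong′ n λ k≤n →
        trans (solve 3 (λ x e y → x ⊗ (e ⊗ y) ⊜ e ⊗ (x ⊗ y)) refl _ _ _) (*-congˡ (^n*⟪⟫ X*Y≈c k≤n)))

      W≈ : ∀ {X Y} → X * Y ≈ c → X ^ n * P X Y ≈ W X
      W≈ {X} X*Y≈c = trans (∑≤-* n _ _) (∑≤-cong′ n λ k≤n →
        trans (solve 4 (λ x e z y → x ⊗ (e ⊗ (z ⊗ y)) ⊜ e ⊗ (z ⊗ (x ⊗ y))) refl _ _ _ _)
          (*-congˡ (*-congˡ (^n*⟪⟫ X*Y≈c k≤n))))

      difference : Carrier → Carrier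
      difference X = U X * V X + - 1# * W X

      difference≈ : ∀ {X Y} → X * Y ≈ c → difference X ≈ X ^ n * (U X * U Y - P X Y)
      difference≈ {X} {Y} e = begin
        U X * V X + - 1# * W X                            ≈⟨ +-cong (*-congˡ (V≈ e)) (*-congˡ (W≈ e)) ⟨
        U X * (X ^ n * U Y) + - 1# * (X ^ n * P X Y)
          ≈⟨ solve 4 (λ x u v w → u ⊗ (x ⊗ v) ⊕ ⊝ :1 ⊗ (x ⊗ w) ⊜ x ⊗ (u ⊗ v :- w)) refl (X ^ n) (U X) (U Y) (P X Y)
          ⟩
        X ^ n * (U X * U Y - P X Y)                       ∎

      difference-polynomial : IsPolynomial difference
      difference-polynomial =
        ∑-polynomial n (λ k → constant _ ⊠ pochhammer k)
          ⊠ ∑-polynomial n (λ k → constant _ ⊠ (power (n ℕ.∸ k) ⊠ reflection k))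
        ⊞ constant _ ⊠ ∑-polynomial n (λ k → constant _ ⊠ (pochhammer k ⊠ (power (n ℕ.∸ k) ⊠ reflection k)))
        where
        power : ∀ k → IsPolynomial (_^ k)
        power zero    = constant 1#
        power (suc k) = identity ⊠ power k
        pochhammer : ∀ k → IsPolynomial (λ X → ⟪ X ⨾ q ⟫ k)
        pochhammer zero    = constant 1#
        pochhammer (suc k) = pochhammer k ⊠ (constant 1# ⊞ resp
          (λ X → solve 2 (λ X w → ⊝ w ⊗ X ⊜ ⊝ (X ⊗ w)) refl X (q ^ k)) (constant (- (q ^ k)) ⊠ identity))
        reflection : ∀ k → IsPolynomial (reflected k)
        reflection zero    = constant 1#
        reflection (suc k) = reflection k ⊠ (identity ⊞ constant (- (c * q ^ k)))

    -- The polynomial `difference` vanishes at every q⁻ᵐ, whose partner is c qᵐ, and hence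
    -- everywhere. As c is nonzero so is X, and Xⁿ can be cancelled.
    product-formula : U c ≈ b° 0 → ∀ X Y → X * Y ≈ c → U X * U Y ≈ P X Y
    product-formula Uc X Y X*Y≈c = x∙y⁻¹≈ε⇒x≈y _ _ (*-cancelˡ (X^≉0 n) (begin
      X ^ n * (U X * U Y - P X Y)  ≈⟨ difference≈ X*Y≈c ⟨
      difference X                 ≈⟨ many-roots (proj₂ difference-polynomial) (p ^_) p^-distinct root X ⟩
      0#                           ≈⟨ zeroʳ _ ⟨
      X ^ n * 0#                   ∎))
      where
      open GroupProperties +-group using (x∙y⁻¹≈ε⇒x≈y)
      X^≉0 : ∀ k → ¬ X ^ k ≈ 0#
      X^≉0 zero    = 1≉0
      X^≉0 (suc k) = *-nonzero (λ X≈0 → c≉0 (trans (sym X*Y≈c) (trans (*-congʳ X≈0) (zeroˡ Y)))) (X^≉0 k)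
      root : ∀ m → difference (p ^ m) ≈ 0#
      root m = begin
        difference (p ^ m)                     ≈⟨ difference≈ e ⟩
        (p ^ m) ^ n * (U (p ^ m) * U (c * q ^ m) - P (p ^ m) (c * q ^ m))
          ≈⟨ *-congˡ (trans (+-congʳ (product-formula-p^ Uc m e)) (-‿inverseʳ _)) ⟩
        (p ^ m) ^ n * 0#                       ≈⟨ zeroʳ _ ⟩
        0#                                     ∎
        where
        e : p ^ m * (c * q ^ m) ≈ c
        e = begin
          p ^ m * (c * q ^ m)    ≈⟨ solve 3 (λ p c w → p ⊗ (c ⊗ w) ⊜ c ⊗ (p ⊗ w)) refl (p ^ m) c (q ^ m) ⟩
          c * (p ^ m * q ^ m)    ≈⟨ *-congˡ (p^*q^ m) ⟩
          c * 1#                 ≈⟨ *-identityʳ c ⟩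
          c                      ∎

-- Splitting, reversal and a summation formula for q-shifted factorials.

module QPochhammer {f ℓ} (F : Field f ℓ) (q : Field.Carrier F) where
  open Field F hiding (zero)
  open QSeries F
  open FieldProperties F
  open Sums F
  open RingIdentities commutativeRing
  open ℤ-RingSolver commutativeRing using (solve; _⊗_; ⊝_; :1; _⊜_)
  open SetoidReasoning setoid
  open Exp semiring using (^-homo-*)
  open Recurrences F (q ^ 2) using () renaming (⟪⟫-shift to ⟪⟫-shift²)

  ^2 : ∀ z → z ^ 2 ≈ z * z
  ^2 z = *-congˡ (*-identityʳ z)

  [q^2]^ : ∀ k → (q ^ 2) ^ k ≈ q ^ k * q ^ k
  [q^2]^ zero    = sym (*-identityˡ 1#)
  [q^2]^ (suc k) = begin
    q ^ 2 * (q ^ 2) ^ k            ≈⟨ *-cong (^2 q) ([q^2]^ k) ⟩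
    q * q * (q ^ k * q ^ k)        ≈⟨ solve 2 (λ q w → q ⊗ q ⊗ (w ⊗ w) ⊜ q ⊗ w ⊗ (q ⊗ w)) refl q (q ^ k) ⟩
    q * q ^ k * (q * q ^ k)        ∎

  ⟪⟫-+ : ∀ X b m k → ⟪ X ⨾ b ⟫ (m ℕ.+ k) ≈ ⟪ X ⨾ b ⟫ m * ⟪ X * b ^ m ⨾ b ⟫ k
  ⟪⟫-+ X b m zero    rewrite ℕₚ.+-identityʳ m = sym (*-identityʳ _)
  ⟪⟫-+ X b m (suc k) rewrite ℕₚ.+-suc m k = begin
    ⟪ X ⨾ b ⟫ (m ℕ.+ k) * (1# - X * b ^ (m ℕ.+ k))
      ≈⟨ *-cong (⟪⟫-+ X b m k) (+-congˡ (-‿cong (trans (*-congˡ (^-homo-* b m k)) (sym (*-assoc _ _ _))))) ⟩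
    ⟪ X ⨾ b ⟫ m * ⟪ X * b ^ m ⨾ b ⟫ k * (1# - X * b ^ m * b ^ k)
      ≈⟨ *-assoc _ _ _ ⟩
    ⟪ X ⨾ b ⟫ m * ⟪ X * b ^ m ⨾ b ⟫ (suc k) ∎

  ⟪⟫-congˡ : ∀ b k {X Y} → X ≈ Y → ⟪ X ⨾ b ⟫ k ≈ ⟪ Y ⨾ b ⟫ k
  ⟪⟫-congˡ b k = Recurrences.⟪⟫-cong F b k

  ⟪⟫≉0 : ∀ {X b} → (∀ k → ¬ X * b ^ k ≈ 1#) → ∀ k → ¬ ⟪ X ⨾ b ⟫ k ≈ 0#
  ⟪⟫≉0 h zero    = 1≉0
  ⟪⟫≉0 h (suc k) = *-nonzero (⟪⟫≉0 h k) (1-x≉0 (h k))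

  ⁻¹-absorb : ∀ {d d′ m} → ¬ d ≈ 0# → ¬ m ≈ 0# → d′ ≈ d * m → d′ ⁻¹ * m ≈ d ⁻¹
  ⁻¹-absorb {d} {d′} {m} d≉0 m≉0 e = *-cancelˡ d≉0 (begin
    d * (d′ ⁻¹ * m)    ≈⟨ solve 3 (λ d i m → d ⊗ (i ⊗ m) ⊜ d ⊗ m ⊗ i) refl d (d′ ⁻¹) m ⟩
    d * m * d′ ⁻¹      ≈⟨ *-congˡ (⁻¹-cong e) ⟩
    d * m * (d * m) ⁻¹ ≈⟨ ⁻¹-inverseʳ (*-nonzero d≉0 m≉0) ⟩
    1#                 ≈⟨ ⁻¹-inverseʳ d≉0 ⟨
    d * d ⁻¹           ∎)

  ⁻¹-* : ∀ {d m} → ¬ d ≈ 0# → ¬ m ≈ 0# → (d * m) ⁻¹ ≈ d ⁻¹ * m ⁻¹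
  ⁻¹-* {d} {m} d≉0 m≉0 = *-cancelˡ m≉0 (begin
    m * (d * m) ⁻¹     ≈⟨ *-comm _ _ ⟩
    (d * m) ⁻¹ * m     ≈⟨ ⁻¹-absorb d≉0 m≉0 refl ⟩
    d ⁻¹               ≈⟨ *-identityʳ _ ⟨
    d ⁻¹ * 1#          ≈⟨ *-congˡ (⁻¹-inverseʳ m≉0) ⟨
    d ⁻¹ * (m * m ⁻¹)  ≈⟨ solve 3 (λ d m i → d ⊗ (m ⊗ i) ⊜ m ⊗ (d ⊗ i)) refl (d ⁻¹) m (m ⁻¹) ⟩
    m * (d ⁻¹ * m ⁻¹)  ∎)

  ^≉0 : ¬ q ≈ 0# → ∀ k → ¬ q ^ k ≈ 0#
  ^≉0 q≉0 zero    = 1≉0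
  ^≉0 q≉0 (suc k) = *-nonzero q≉0 (^≉0 q≉0 k)

  module _ (q≉0 : ¬ q ≈ 0#) where
    -- Negative powers are handled only next to a power that clears them, so that all later exponent
    -- arithmetic is in ℕ.
    ^ᶻ-⊖ : ∀ a b → q ^ᶻ (a ℤ.⊖ b) * q ^ b ≈ q ^ a
    ^ᶻ-⊖ a       zero    = *-identityʳ _
    ^ᶻ-⊖ zero    (suc b) = ⁻¹-inverseˡ (^≉0 q≉0 (suc b))
    ^ᶻ-⊖ (suc a) (suc b) = begin
      q ^ᶻ (suc a ℤ.⊖ suc b) * (q * q ^ b)  ≡⟨ ≡.cong (λ i → q ^ᶻ i * (q * q ^ b)) (ℤₚ.[1+m]⊖[1+n]≡m⊖n a b) ⟩
      q ^ᶻ (a ℤ.⊖ b) * (q * q ^ b)          ≈⟨ solve 3 (λ z q w → z ⊗ (q ⊗ w) ⊜ q ⊗ (z ⊗ w)) refl _ q (q ^ b) ⟩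
      q * (q ^ᶻ (a ℤ.⊖ b) * q ^ b)          ≈⟨ *-congˡ (^ᶻ-⊖ a b) ⟩
      q * q ^ a                             ∎

    ^ᶻ-minus : ∀ a b → q ^ᶻ (+ a ℤ.- + b) * q ^ b ≈ q ^ a
    ^ᶻ-minus a b = trans (reflexive (≡.cong (λ i → q ^ᶻ i * q ^ b) (ℤₚ.m-n≡m⊖n a b))) (^ᶻ-⊖ a b)

    ^ᶻ-neg : ∀ b → q ^ᶻ (ℤ.- (+ b)) * q ^ b ≈ 1#
    ^ᶻ-neg zero    = *-identityʳ _
    ^ᶻ-neg (suc b) = ^ᶻ-⊖ 0 (suc b)

  q^suc² : ∀ k → q ^ (suc k ℕ.* suc k) ≈ q ^ (k ℕ.* k) * (q * (q ^ k * q ^ k))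
  q^suc² k = begin
    q ^ (suc k ℕ.* suc k)                    ≡⟨ ≡.cong (q ^_)
      (solveℕ 1 (λ k → (conℕ 1 :+ k) :* (conℕ 1 :+ k) := k :* k :+ (conℕ 1 :+ (k :+ k))) ≡.refl k) ⟩
    q ^ (k ℕ.* k ℕ.+ suc (k ℕ.+ k))          ≈⟨ ^-homo-* q (k ℕ.* k) _ ⟩
    q ^ (k ℕ.* k) * (q * q ^ (k ℕ.+ k))      ≈⟨ *-congˡ (*-congˡ (^-homo-* q k k)) ⟩
    q ^ (k ℕ.* k) * (q * (q ^ k * q ^ k))    ∎
    where open +-*-Solver renaming (solve to solveℕ; con to conℕ)

  module _ (q^≉1 : ∀ k → ¬ q ^ suc k ≈ 1#) where

    -- As (q⁻²ⁿ;q²)ₖ = (q⁻ⁿ;q)ₖ (-q⁻ⁿ;q)ₖ, the sum is ₂φ₁(q⁻ⁿ, -q⁻ⁿ; 0; q, q). The induction passes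
    -- from (n + 1, y) to (n, q²y), which preserves the hypothesis on y.
    K-sum : ∀ n y → y * (q ^ n * q ^ n) ≈ 1# →
            ∑≤ n (λ k → ⟪ y ⨾ q ^ 2 ⟫ k * ⟪ q ⨾ q ⟫ k ⁻¹ * q ^ k) * q ^ (n ℕ.* n) ≈ (- 1#) ^ n
    K-sum zero    y e = begin
      1# * 1# ⁻¹ * 1# * 1#  ≈⟨ trans (*-identityʳ _) (*-identityʳ _) ⟩
      1# * 1# ⁻¹            ≈⟨ ⁻¹-inverseʳ 1≉0 ⟩
      1#                    ∎
    K-sum (suc n) y e = begin
      σ (suc n) y * q ^ (suc n ℕ.* suc n)
        ≈⟨ *-congˡ (q^suc² n) ⟩
      σ (suc n) y * (q ^ (n ℕ.* n) * (q * (q ^ n * q ^ n)))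
        ≈⟨ *-congʳ σ-suc ⟩
      - (q * y) * σ n (q * q * y) * (q ^ (n ℕ.* n) * (q * (q ^ n * q ^ n)))
        ≈⟨ solve 5 (λ q y w t u → ⊝ (q ⊗ y) ⊗ t ⊗ (u ⊗ (q ⊗ (w ⊗ w))) ⊜ ⊝ :1 ⊗ (y ⊗ (q ⊗ w ⊗ (q ⊗ w))) ⊗ (t ⊗ u))
             refl q y (q ^ n) (σ n (q * q * y)) (q ^ (n ℕ.* n)) ⟩
      - 1# * (y * (q * q ^ n * (q * q ^ n))) * (σ n (q * q * y) * q ^ (n ℕ.* n))
        ≈⟨ *-cong (trans (*-congˡ e) (*-identityʳ _)) (K-sum n (q * q * y) e′) ⟩
      - 1# * (- 1#) ^ n ∎
      where
      σ : ℕ → Carrier → Carrier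
      σ n y = ∑≤ n (λ k → ⟪ y ⨾ q ^ 2 ⟫ k * ⟪ q ⨾ q ⟫ k ⁻¹ * q ^ k)

      e′ : q * q * y * (q ^ n * q ^ n) ≈ 1#
      e′ = trans (solve 3 (λ q y w → q ⊗ q ⊗ y ⊗ (w ⊗ w) ⊜ y ⊗ (q ⊗ w ⊗ (q ⊗ w))) refl q y (q ^ n)) e

      E : ℕ → Carrier
      E k = ⟪ q * q * y ⨾ q ^ 2 ⟫ k

      -- The last factor is 1 - q²y q²ⁿ. Its vanishing serves twice: the telescoped sum is zero, and
      -- the sum at q²y loses its top term, which lowers its upper limit to n.
      E-suc≈0 : E (suc n) ≈ 0#
      E-suc≈0 = trans (*-congˡ (trans (+-congˡ (-‿cong (trans (*-congˡ ([q^2]^ n)) e′))) (-‿inverseʳ 1#))) (zeroʳ _)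

      d : ℕ → Carrier
      d k = ⟪ q ⨾ q ⟫ k ⁻¹

      d-step : ∀ k → d (suc k) * (1# - q * q ^ k) ≈ d k
      d-step k = ⁻¹-absorb (⟪⟫≉0 q^≉1 k) (1-x≉0 (q^≉1 k)) refl

      g : ℕ → Carrier
      g k = (1# + q * y * q ^ k) * E k * d k

      telescoped : σ (suc n) y + q * y * σ (suc n) (q * q * y) ≈ 0#
      telescoped = begin
        _  ≈⟨ +-congˡ (∑≤-* (suc n) _ _) ⟩
        _  ≈⟨ ∑≤-+ (suc n) _ _ ⟩
        _  ≈⟨ telescope g (K-telescope₀ q y (d 0)) (λ k →
                K-telescope q y (q ^ k) ((q ^ 2) ^ k) (E k) (⟪ y ⨾ q ^ 2 ⟫ (suc k)) (d k) (d (suc k)) (d-step k)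
                  (trans (⟪⟫-shift² y k) (*-congˡ (⟪⟫-congˡ (q ^ 2) k (*-congʳ (^2 q))))) ([q^2]^ k)) (suc n) ⟩
        g (suc n)  ≈⟨ trans (*-congʳ (trans (*-congˡ E-suc≈0) (zeroʳ _))) (zeroˡ _) ⟩
        0# ∎

      σ-suc : σ (suc n) y ≈ - (q * y) * σ n (q * q * y)
      σ-suc = K-recurrence (σ (suc n) y) (q * y) (σ n (q * q * y)) (E (suc n)) (d (suc n)) (q ^ suc n) telescoped
        E-suc≈0

  -- The denominator-free form of (q⁻²ⁿ;q²)ₖ = (-1)ᵏ q^(k² - k - 2nk) (q²;q²)ₙ / (q²;q²)ₙ₋ₖ. The
  -- separate argument m = n - k grows as k decreases in the recursion.
  reversal : ∀ {n y} m k → m ℕ.+ k ≡.≡ n → y * (q ^ n * q ^ n) ≈ 1# →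
    ⟪ y ⨾ q ^ 2 ⟫ k * q ^ k * ⟪ q ^ 2 ⨾ q ^ 2 ⟫ m * (q ^ n * q ^ n) ^ k
      ≈ (- 1#) ^ k * q ^ (k ℕ.* k) * ⟪ q ^ 2 ⨾ q ^ 2 ⟫ n
  reversal m zero    ≡.refl e rewrite ℕₚ.+-identityʳ m = begin
    1# * 1# * ⟪ q ^ 2 ⨾ q ^ 2 ⟫ m * 1#  ≈⟨ *-identityʳ _ ⟩
    1# * 1# * ⟪ q ^ 2 ⨾ q ^ 2 ⟫ m       ∎
  reversal {n} {y} m (suc k) m+k≡n e = begin
    _ ≈⟨ reversal-step (⟪ y ⨾ q ^ 2 ⟫ k) y ((q ^ 2) ^ k) (q ^ k) q (q ^ 2) ((q ^ 2) ^ m) (⟪ q ^ 2 ⨾ q ^ 2 ⟫ m)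
           (q ^ n * q ^ n) ((q ^ n * q ^ n) ^ k) ((- 1#) ^ k) (q ^ (k ℕ.* k)) (⟪ q ^ 2 ⨾ q ^ 2 ⟫ n)
           (reversal (suc m) k (≡.trans (≡.sym (ℕₚ.+-suc m k)) m+k≡n) e) e ([q^2]^ k) H≈ ⟩
    - 1# * (- 1#) ^ k * (q ^ (k ℕ.* k) * (q * (q ^ k * q ^ k))) * ⟪ q ^ 2 ⨾ q ^ 2 ⟫ n
      ≈⟨ *-congʳ (*-congˡ exponent) ⟨
    _ ∎
    where
    H≈ : q ^ n * q ^ n ≈ q ^ 2 * (q ^ 2) ^ m * (q ^ k * q ^ k)
    H≈ = begin
      q ^ n * q ^ n                              ≈⟨ [q^2]^ n ⟨
      (q ^ 2) ^ n                                ≡⟨ ≡.cong ((q ^ 2) ^_) (≡.trans (≡.sym m+k≡n) (ℕₚ.+-suc m k)) ⟩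
      q ^ 2 * (q ^ 2) ^ (m ℕ.+ k)                ≈⟨ *-congˡ (^-homo-* (q ^ 2) m k) ⟩
      q ^ 2 * ((q ^ 2) ^ m * (q ^ 2) ^ k)        ≈⟨ *-assoc _ _ _ ⟨
      q ^ 2 * (q ^ 2) ^ m * (q ^ 2) ^ k          ≈⟨ *-congˡ ([q^2]^ k) ⟩
      q ^ 2 * (q ^ 2) ^ m * (q ^ k * q ^ k)      ∎
    exponent : q ^ (suc k ℕ.* suc k) ≈ q ^ (k ℕ.* k) * (q * (q ^ k * q ^ k))
    exponent = q^suc² k


-- From the product formula to the theorem over a field, by the shift k = s + j.

module Specialisation {f ℓ} (F : Field f ℓ) where
  open Field F hiding (zero)
  open QSeries F

  module Formula (q x : Carrier)
    (q≉0 : ¬ q ≈ 0#) (q^≉1 : ∀ k → ¬ q ^ suc k ≈ 1#) (x≉0 : ¬ x ≈ 0#) (s N : ℕ) where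

    open QPochhammer F q
    open FieldProperties F
    open Sums F
    open RingIdentities commutativeRing
    open ℤ-RingSolver commutativeRing using (solve; _⊗_; _⊜_)
    open SetoidReasoning setoid
    open Exp semiring using (^-homo-*; ^-cong; ^-congˡ; ^-assocʳ)
    open +-*-Solver using (_:+_; _:*_; _:=_) renaming (solve to solveℕ; con to conℕ)

    n : ℕ
    n = s ℕ.+ N

    -- `Y` is the theorem's q⁻²ⁿ, and `y` = q⁻²ᴺ is the base left after the first s factors of
    -- (Y;q²)ₖ are split off. `κ` is the value U(c), which normalises `b`.
    Y c y Q κ : Carrier
    Y = q ^ᶻ (ℤ.- (+ (2 ℕ.* n)))
    c = q ^ suc (s ℕ.+ s)
    y = Y * (q ^ 2) ^ s
    Q = q ^ N * q ^ N
    κ = (- 1#) ^ N * (q ^ (N ℕ.* N)) ⁻¹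

    q^2n : q ^ (2 ℕ.* n) ≈ q ^ n * q ^ n
    q^2n = trans (^-cong (refl {q}) (≡.cong (n ℕ.+_) (ℕₚ.+-identityʳ n))) (^-homo-* q n n)

    q^n≈ : q ^ n ≈ q ^ s * q ^ N
    q^n≈ = ^-homo-* q s N

    Y*H≈1 : Y * (q ^ n * q ^ n) ≈ 1#
    Y*H≈1 = trans (*-congˡ (sym q^2n)) (^ᶻ-neg q≉0 (2 ℕ.* n))

    y*Q≈1 : y * Q ≈ 1#
    y*Q≈1 = begin
      Y * (q ^ 2) ^ s * (q ^ N * q ^ N)                  ≈⟨ *-congʳ (*-congˡ ([q^2]^ s)) ⟩
      Y * (q ^ s * q ^ s) * (q ^ N * q ^ N)
        ≈⟨ solve 3 (λ Y s N → Y ⊗ (s ⊗ s) ⊗ (N ⊗ N) ⊜ Y ⊗ (s ⊗ N ⊗ (s ⊗ N))) refl Y (q ^ s) (q ^ N) ⟩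
      Y * (q ^ s * q ^ N * (q ^ s * q ^ N))              ≈⟨ *-congˡ (*-cong q^n≈ q^n≈) ⟨
      Y * (q ^ n * q ^ n)                                ≈⟨ Y*H≈1 ⟩
      1#                                                 ∎

    cq^ : ∀ k → c * q ^ k ≈ q ^ suc (s ℕ.+ s ℕ.+ k)
    cq^ k = sym (^-homo-* q (suc (s ℕ.+ s)) k)

    cq^≉1 : ∀ k → ¬ c * q ^ k ≈ 1#
    cq^≉1 k e = q^≉1 (s ℕ.+ s ℕ.+ k) (trans (sym (cq^ k)) e)

    ⟪q⟫≉0 : ∀ k → ¬ ⟪ q ⨾ q ⟫ k ≈ 0#
    ⟪q⟫≉0 = ⟪⟫≉0 q^≉1

    ⟪c⟫≉0 : ∀ k → ¬ ⟪ c ⨾ q ⟫ k ≈ 0#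
    ⟪c⟫≉0 = ⟪⟫≉0 cq^≉1

    -- The factor (c²Q;q²)ₖ is what the theorem's (q²;q²)ₙ₊ₖ leaves after the shift. `b` has one
    -- more factor of (c;q) in the denominator than `b°`, namely 1 - c q²ᵏ.
    a b b° : ℕ → Carrier
    a k  = ⟪ y ⨾ q ^ 2 ⟫ k * (⟪ q ⨾ q ⟫ k * ⟪ c ⨾ q ⟫ k) ⁻¹
    b k  = κ * (⟪ y ⨾ q ^ 2 ⟫ k * ⟪ c * c * Q ⨾ q ^ 2 ⟫ k) * (⟪ q ⨾ q ⟫ k * ⟪ c ⨾ q ⟫ k * ⟪ c ⨾ q ⟫ (suc (k ℕ.+ k)))
      ⁻¹
    b° k = κ * (⟪ y ⨾ q ^ 2 ⟫ k * ⟪ c * c * Q ⨾ q ^ 2 ⟫ k) * (⟪ q ⨾ q ⟫ k * ⟪ c ⨾ q ⟫ k * ⟪ c ⨾ q ⟫ (k ℕ.+ k)) ⁻¹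

    1-z : ∀ u k → 1# - u * (q ^ 2) ^ k ≈ 1# - u * (q ^ k * q ^ k)
    1-z u k = +-congˡ (-‿cong (*-congˡ ([q^2]^ k)))

    a-step : ∀ k → a (suc k) * ((1# - q * q ^ k) * (1# - c * q ^ k)) ≈ a k * (1# - y * (q ^ k * q ^ k))
    a-step k = begin
      ⟪ y ⨾ q ^ 2 ⟫ k * (1# - y * (q ^ 2) ^ k) * d′ ⁻¹ * m     ≈⟨ *-assoc _ _ _ ⟩
      ⟪ y ⨾ q ^ 2 ⟫ k * (1# - y * (q ^ 2) ^ k) * (d′ ⁻¹ * m)   ≈⟨ *-cong (*-congˡ (1-z y k))
        (⁻¹-absorb (*-nonzero (⟪q⟫≉0 k) (⟪c⟫≉0 k)) (*-nonzero (1-x≉0 (q^≉1 k)) (1-x≉0 (cq^≉1 k)))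
          (solve 4 (λ g u h v → g ⊗ u ⊗ (h ⊗ v) ⊜ g ⊗ h ⊗ (u ⊗ v)) refl _ _ _ _)) ⟩
      ⟪ y ⨾ q ^ 2 ⟫ k * (1# - y * (q ^ k * q ^ k)) * (⟪ q ⨾ q ⟫ k * ⟪ c ⨾ q ⟫ k) ⁻¹
        ≈⟨ solve 3 (λ a b c → a ⊗ b ⊗ c ⊜ a ⊗ c ⊗ b) refl _ _ _ ⟩
      a k * (1# - y * (q ^ k * q ^ k)) ∎
      where
      d′ m : Carrier
      d′ = ⟪ q ⨾ q ⟫ (suc k) * ⟪ c ⨾ q ⟫ (suc k)
      m  = (1# - q * q ^ k) * (1# - c * q ^ k)

    1-cw² : ∀ k → 1# - c * q ^ (k ℕ.+ k) ≈ 1# - c * (q ^ k * q ^ k)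
    1-cw² k = +-congˡ (-‿cong (*-congˡ (^-homo-* q k k)))

    b°-def : ∀ k → b° k ≈ b k * (1# - c * (q ^ k * q ^ k))
    b°-def k = sym (begin
      b k * (1# - c * (q ^ k * q ^ k))  ≈⟨ *-congˡ (1-cw² k) ⟨
      b k * (1# - c * q ^ (k ℕ.+ k))    ≈⟨ *-assoc _ _ _ ⟩
      _ ≈⟨ *-congˡ (⁻¹-absorb (*-nonzero (*-nonzero (⟪q⟫≉0 k) (⟪c⟫≉0 k)) (⟪c⟫≉0 (k ℕ.+ k)))
        (1-x≉0 (cq^≉1 (k ℕ.+ k))) (sym (*-assoc _ _ _))) ⟩
      b° k ∎)

    -- The last two factors on the left, 1 - c q²ᵏ⁺¹ and 1 - c q²ᵏ⁺², come from (c;q)₂ₖ₊₁ growing to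
    -- (c;q)₂ₖ₊₃.
    b-step : ∀ k → b (suc k) * ((1# - q * q ^ k) * (1# - c * q ^ k)
               * (1# - c * (q * (q ^ k * q ^ k))) * (1# - c * (q * q ^ k * (q * q ^ k))))
             ≈ b k * ((1# - y * (q ^ k * q ^ k)) * (1# - c * c * Q * (q ^ k * q ^ k)))
    b-step k = begin
      κ * (t * (1# - y * (q ^ 2) ^ k) * (u * (1# - c * c * Q * (q ^ 2) ^ k))) * d′ ⁻¹ * _
        ≈⟨ *-cong (*-congʳ (*-congˡ (*-cong (*-congˡ (1-z y k)) (*-congˡ (1-z (c * c * Q) k)))))
          (sym (*-cong (*-congˡ odd) even)) ⟩
      κ * (t * (1# - y * (q ^ k * q ^ k)) * (u * (1# - c * c * Q * (q ^ k * q ^ k)))) * d′ ⁻¹ * m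
        ≈⟨ *-assoc _ _ _ ⟩
      κ * (t * (1# - y * (q ^ k * q ^ k)) * (u * (1# - c * c * Q * (q ^ k * q ^ k)))) * (d′ ⁻¹ * m)
        ≈⟨ *-congˡ (⁻¹-absorb d≉0 m≉0 d′≈) ⟩
      κ * (t * (1# - y * (q ^ k * q ^ k)) * (u * (1# - c * c * Q * (q ^ k * q ^ k)))) * d ⁻¹
        ≈⟨ solve 6 (λ κ t v u w d → κ ⊗ (t ⊗ v ⊗ (u ⊗ w)) ⊗ d ⊜ κ ⊗ (t ⊗ u) ⊗ d ⊗ (v ⊗ w)) refl κ t _ u _ (d ⁻¹) ⟩
      b k * ((1# - y * (q ^ k * q ^ k)) * (1# - c * c * Q * (q ^ k * q ^ k))) ∎
      where
      t u d d′ m : Carrier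
      t = ⟪ y ⨾ q ^ 2 ⟫ k
      u = ⟪ c * c * Q ⨾ q ^ 2 ⟫ k
      d = ⟪ q ⨾ q ⟫ k * ⟪ c ⨾ q ⟫ k * ⟪ c ⨾ q ⟫ (suc (k ℕ.+ k))
      d′ = ⟪ q ⨾ q ⟫ (suc k) * ⟪ c ⨾ q ⟫ (suc k) * ⟪ c ⨾ q ⟫ (suc (suc k ℕ.+ suc k))
      m = (1# - q * q ^ k) * (1# - c * q ^ k) * (1# - c * q ^ suc (k ℕ.+ k)) * (1# - c * q ^ (suc k ℕ.+ suc k))
      odd : 1# - c * q ^ suc (k ℕ.+ k) ≈ 1# - c * (q * (q ^ k * q ^ k))
      odd = +-congˡ (-‿cong (*-congˡ (*-congˡ (^-homo-* q k k))))
      even : 1# - c * q ^ (suc k ℕ.+ suc k) ≈ 1# - c * (q * q ^ k * (q * q ^ k))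
      even = 1-cw² (suc k)
      d≉0 : ¬ d ≈ 0#
      d≉0 = *-nonzero (*-nonzero (⟪q⟫≉0 k) (⟪c⟫≉0 k)) (⟪c⟫≉0 (suc (k ℕ.+ k)))
      m≉0 : ¬ m ≈ 0#
      m≉0 = *-nonzero (*-nonzero (*-nonzero (1-x≉0 (q^≉1 k)) (1-x≉0 (cq^≉1 k)))
        (1-x≉0 (cq^≉1 (suc (k ℕ.+ k))))) (1-x≉0 (cq^≉1 (suc k ℕ.+ suc k)))
      d′≈ : d′ ≈ d * m
      d′≈ = begin
        d′ ≈⟨ *-congˡ (*-congʳ (reflexive (≡.cong (λ i → ⟪ c ⨾ q ⟫ (suc i)) (ℕₚ.+-suc k k)))) ⟩
        ⟪ q ⨾ q ⟫ (suc k) * ⟪ c ⨾ q ⟫ (suc k) * (⟪ c ⨾ q ⟫ (suc (suc (k ℕ.+ k))) * (1# - c * q ^ (suc k ℕ.+ suc k)))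
          ≈⟨ solve 7 (λ g u h v e w z → g ⊗ u ⊗ (h ⊗ v) ⊗ (e ⊗ w ⊗ z) ⊜ g ⊗ h ⊗ e ⊗ (u ⊗ v ⊗ w ⊗ z)) refl _ _ _ _ _
            _ _ ⟩
        d * m ∎

    1⁻¹ : 1# ⁻¹ ≈ 1#
    1⁻¹ = trans (sym (*-identityˡ _)) (⁻¹-inverseʳ 1≉0)

    a0≈1 : a 0 ≈ 1#
    a0≈1 = trans (*-identityˡ _) (trans (⁻¹-cong (*-identityˡ 1#)) 1⁻¹)

    κ*q^N² : κ * q ^ (N ℕ.* N) ≈ (- 1#) ^ N
    κ*q^N² = trans (*-assoc _ _ _) (trans (*-congˡ (⁻¹-inverseˡ (^≉0 q≉0 (N ℕ.* N)))) (*-identityʳ _))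

    open ProductFormula.Formula F q c y Q N a b b° q≉0 (^≉0 q≉0 (suc (s ℕ.+ s))) q^≉1 cq^≉1 y*Q≈1 refl
      a-step b°-def b-step a0≈1 using (U; P; product-formula)

    -- At X = c the factor (c;q)ₖ cancels against the denominator of `a`, which leaves the sum
    -- evaluated by `K-sum`.
    U-c : U c ≈ b° 0
    U-c = *-cancelˡ (^≉0 q≉0 (N ℕ.* N)) (begin
      q ^ (N ℕ.* N) * U c              ≈⟨ *-comm _ _ ⟩
      U c * q ^ (N ℕ.* N)              ≈⟨ *-congʳ (∑≤-cong N λ k → begin
        ⟪ y ⨾ q ^ 2 ⟫ k * (⟪ q ⨾ q ⟫ k * ⟪ c ⨾ q ⟫ k) ⁻¹ * q ^ k * ⟪ c ⨾ q ⟫ k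
          ≈⟨ solve 4 (λ t d w g → t ⊗ d ⊗ w ⊗ g ⊜ t ⊗ (d ⊗ g) ⊗ w) refl _ _ _ _ ⟩
        ⟪ y ⨾ q ^ 2 ⟫ k * ((⟪ q ⨾ q ⟫ k * ⟪ c ⨾ q ⟫ k) ⁻¹ * ⟪ c ⨾ q ⟫ k) * q ^ k
          ≈⟨ *-congʳ (*-congˡ (⁻¹-absorb (⟪q⟫≉0 k) (⟪c⟫≉0 k) refl)) ⟩
        ⟪ y ⨾ q ^ 2 ⟫ k * ⟪ q ⨾ q ⟫ k ⁻¹ * q ^ k ∎) ⟩
      _                                ≈⟨ K-sum q^≉1 N y y*Q≈1 ⟩
      (- 1#) ^ N                       ≈⟨ κ*q^N² ⟨
      κ * q ^ (N ℕ.* N)                ≈⟨ *-comm _ _ ⟩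
      q ^ (N ℕ.* N) * κ                ≈⟨ *-congˡ b°0 ⟨
      q ^ (N ℕ.* N) * b° 0             ∎)
      where
      b°0 : b° 0 ≈ κ
      b°0 = trans (*-cong (trans (*-congˡ (*-identityˡ 1#)) (*-identityʳ κ))
        (trans (⁻¹-cong (trans (*-identityʳ _) (*-identityʳ _))) 1⁻¹)) (*-identityʳ κ)

    C : Carrier
    C = ⟪ Y ⨾ q ^ 2 ⟫ s * q ^ s * ⟪ q ⨾ q ⟫ (s ℕ.+ s) ⁻¹

    ⟪q⟫-split : ∀ {m} j → m ≡.≡ s ℕ.+ s ℕ.+ j → ⟪ q ⨾ q ⟫ m ≈ ⟪ q ⨾ q ⟫ (s ℕ.+ s) * ⟪ c ⨾ q ⟫ j
    ⟪q⟫-split j ≡.refl = ⟪⟫-+ q q (s ℕ.+ s) j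

    s+j∸s : ∀ j → ⟪ q ⨾ q ⟫ (s ℕ.+ j ∸ s) ≈ ⟪ q ⨾ q ⟫ j
    s+j∸s j = reflexive (≡.cong ⟪ q ⨾ q ⟫ (ℕₚ.m+n∸m≡n s j))

    s+j+s : ∀ j → s ℕ.+ j ℕ.+ s ≡.≡ s ℕ.+ s ℕ.+ j
    s+j+s j = solveℕ 2 (λ s j → s :+ j :+ s := s :+ s :+ j) ≡.refl s j

    left : Carrier → ℕ → Carrier
    left z k = (⟪ Y ⨾ q ^ 2 ⟫ k * ⟪ z ⨾ q ⟫ k * q ^ k) / (⟪ q ⨾ q ⟫ (k ∸ s) * ⟪ q ⨾ q ⟫ (k ℕ.+ s))

    -- The shift turns (z;q)ₖ into (z;q)ₛ (z qˢ;q)ⱼ and (q;q)ₖ₊ₛ into (q;q)₂ₛ (c;q)ⱼ. What does not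
    -- depend on j is collected in `C` and (z;q)ₛ.
    left≈ : ∀ z j → left z (s ℕ.+ j) ≈ C * ⟪ z ⨾ q ⟫ s * (a j * q ^ j * ⟪ z * q ^ s ⨾ q ⟫ j)
    left≈ z j = begin
      left z (s ℕ.+ j)
        ≈⟨ *-cong (*-cong (*-cong (⟪⟫-+ Y (q ^ 2) s j) (⟪⟫-+ z q s j)) (^-homo-* q s j))
             (trans (⁻¹-cong (*-cong (s+j∸s j) (⟪q⟫-split j (s+j+s j))))
               (trans (⁻¹-* (⟪q⟫≉0 j) (*-nonzero (⟪q⟫≉0 (s ℕ.+ s)) (⟪c⟫≉0 j)))
                 (*-congˡ (⁻¹-* (⟪q⟫≉0 (s ℕ.+ s)) (⟪c⟫≉0 j))))) ⟩
      _ ≈⟨ solve 9 (λ Ys Yj zs zj qs qj g g₂ c →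
             (Ys ⊗ Yj) ⊗ (zs ⊗ zj) ⊗ (qs ⊗ qj) ⊗ (g ⊗ (g₂ ⊗ c)) ⊜ Ys ⊗ qs ⊗ g₂ ⊗ zs ⊗ (Yj ⊗ (g ⊗ c) ⊗ qj ⊗ zj))
             refl _ _ _ _ _ _ _ _ _ ⟩
      C * ⟪ z ⨾ q ⟫ s * (⟪ y ⨾ q ^ 2 ⟫ j * (⟪ q ⨾ q ⟫ j ⁻¹ * ⟪ c ⨾ q ⟫ j ⁻¹) * q ^ j * ⟪ z * q ^ s ⨾ q ⟫ j)
        ≈⟨ *-congˡ (*-congʳ (*-congʳ (*-congˡ (⁻¹-* (⟪q⟫≉0 j) (⟪c⟫≉0 j))))) ⟨
      C * ⟪ z ⨾ q ⟫ s * (a j * q ^ j * ⟪ z * q ^ s ⨾ q ⟫ j) ∎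

    left-sum : ∀ z → sumFromTo s n (left z) ≈ C * ⟪ z ⨾ q ⟫ s * U (z * q ^ s)
    left-sum z = begin
      sumFromTo s n (left z)               ≈⟨ sumFromTo-∑≤ s N (left z) ⟩
      ∑≤ N (λ j → left z (s ℕ.+ j))        ≈⟨ ∑≤-cong N (left≈ z) ⟩
      _                                    ≈⟨ ∑≤-* N _ _ ⟨
      C * ⟪ z ⨾ q ⟫ s * U (z * q ^ s)      ∎

    E : ℕ → Carrier
    E = ⟪ q ^ 2 ⨾ q ^ 2 ⟫

    E≉0 : ∀ k → ¬ E k ≈ 0#
    E≉0 = ⟪⟫≉0 λ k e → q^≉1 (k ℕ.+ suc k) (trans (^-homo-* q (suc k) (suc k)) (trans (sym ([q^2]^ (suc k))) e))

    -- The split-off factor starts at q² q²⁽ⁿ⁺ˢ⁾, and n + s = 2s + N makes this c²Q.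
    E-split : ∀ j → E (n ℕ.+ (s ℕ.+ j)) ≈ E (n ℕ.+ s) * ⟪ c * c * Q ⨾ q ^ 2 ⟫ j
    E-split j = begin
      E (n ℕ.+ (s ℕ.+ j))                                        ≡⟨ ≡.cong E (ℕₚ.+-assoc n s j) ⟨
      E (n ℕ.+ s ℕ.+ j)                                          ≈⟨ ⟪⟫-+ (q ^ 2) (q ^ 2) (n ℕ.+ s) j ⟩
      E (n ℕ.+ s) * ⟪ q ^ 2 * (q ^ 2) ^ (n ℕ.+ s) ⨾ q ^ 2 ⟫ j    ≈⟨ *-congˡ (⟪⟫-congˡ (q ^ 2) j base) ⟩
      E (n ℕ.+ s) * ⟪ c * c * Q ⨾ q ^ 2 ⟫ j                      ∎
      where
      q^n+s : q ^ (n ℕ.+ s) ≈ q ^ s * q ^ N * q ^ s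
      q^n+s = trans (^-homo-* q n s) (*-congʳ q^n≈)
      c≈ : c ≈ q * (q ^ s * q ^ s)
      c≈ = *-congˡ (^-homo-* q s s)
      base : q ^ 2 * (q ^ 2) ^ (n ℕ.+ s) ≈ c * c * Q
      base = begin
        (q ^ 2) ^ suc (n ℕ.+ s)                                   ≈⟨ [q^2]^ (suc (n ℕ.+ s)) ⟩
        q * q ^ (n ℕ.+ s) * (q * q ^ (n ℕ.+ s))                   ≈⟨ *-cong (*-congˡ q^n+s) (*-congˡ q^n+s) ⟩
        _ ≈⟨ solve 3 (λ q s N → q ⊗ (s ⊗ N ⊗ s) ⊗ (q ⊗ (s ⊗ N ⊗ s)) ⊜ q ⊗ (s ⊗ s) ⊗ (q ⊗ (s ⊗ s)) ⊗ (N ⊗ N)) refl q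
          (q ^ s) (q ^ N) ⟩
        _ ≈⟨ *-congʳ (*-cong c≈ c≈) ⟨
        c * c * Q ∎

    qⁿ qᵏ : ℕ → Carrier
    qⁿ m = q ^ᶻ (ℤ.- (+ (m ℕ.^ 2)))
    qᵏ k = q ^ᶻ (+ (k ℕ.^ 2) ℤ.- + (2 ℕ.* n ℕ.* k))

    H : Carrier
    H = q ^ n * q ^ n

    m^2 : ∀ m → m ℕ.^ 2 ≡.≡ m ℕ.* m
    m^2 m = ≡.cong (m ℕ.*_) (ℕₚ.*-identityʳ m)

    H^ : ∀ k → H ^ k ≈ q ^ (2 ℕ.* n ℕ.* k)
    H^ k = trans (^-congˡ k (sym q^2n)) (^-assocʳ q (2 ℕ.* n) k)

    -- All signs, powers of q and factorials in base q² are matched here. Reversal at s accounts for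
    -- `E N`, reversal at k for `E (N ∸ j)`, and each uses up one of the two factors `E n`.
    key : ∀ {j} → j ℕ.≤ N → let k = s ℕ.+ j in
      (- 1#) ^ n * (E n * E n) * qⁿ n * ((- 1#) ^ k * qᵏ k) * (E N ⁻¹ * E (N ∸ j) ⁻¹)
        ≈ ⟪ Y ⨾ q ^ 2 ⟫ s * q ^ s * (⟪ Y ⨾ q ^ 2 ⟫ s * ⟪ y ⨾ q ^ 2 ⟫ j * (q ^ s * q ^ j)) * κ
    key {j} j≤N = cancel-E _ (E N) _ (E (N ∸ j)) _ _ _ _ (⟪ Y ⨾ q ^ 2 ⟫ k) _ (q ^ k) _
      (*-cancelˡ M≉0 (prefactor (⟪ Y ⨾ q ^ 2 ⟫ s) (q ^ s) (E N) (H ^ s) (⟪ Y ⨾ q ^ 2 ⟫ k) (q ^ k) (E (N ∸ j))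
        (H ^ k) κ
        (q ^ (N ℕ.* N)) (qⁿ n) (q ^ (n ℕ.* n)) (qᵏ k) (q ^ (k ℕ.* k)) (q ^ (s ℕ.* s))
        ((- 1#) ^ n) ((- 1#) ^ k) ((- 1#) ^ s) ((- 1#) ^ N) (E n)
        (reversal N s (ℕₚ.+-comm N s) Y*H≈1) (reversal (N ∸ j) k N∸j+k Y*H≈1) κ*q^N²
        qⁿ≈ qᵏ≈ (^-homo-* (- 1#) s N) H^s≈))
      (⁻¹-inverseʳ (E≉0 N)) (⁻¹-inverseʳ (E≉0 (N ∸ j))) (⟪⟫-+ Y (q ^ 2) s j) (^-homo-* q s j)
      where
      k : ℕ
      k = s ℕ.+ j
      N∸j+k : (N ∸ j) ℕ.+ k ≡.≡ n
      N∸j+k = ≡.trans (ℕₚ.+-comm (N ∸ j) k) (≡.trans (ℕₚ.+-assoc s j _) (≡.cong (s ℕ.+_) (ℕₚ.m+[n∸m]≡n j≤N)))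
      qⁿ≈ : qⁿ n * q ^ (n ℕ.* n) ≈ 1#
      qⁿ≈ = trans (*-congˡ (reflexive (≡.cong (q ^_) (≡.sym (m^2 n))))) (^ᶻ-neg q≉0 (n ℕ.^ 2))
      qᵏ≈ : qᵏ k * H ^ k ≈ q ^ (k ℕ.* k)
      qᵏ≈ = trans (*-congˡ (H^ k)) (trans (^ᶻ-minus q≉0 (k ℕ.^ 2) (2 ℕ.* n ℕ.* k))
        (reflexive (≡.cong (q ^_) (m^2 k))))
      H^s≈ : H ^ s * q ^ (N ℕ.* N) ≈ q ^ (s ℕ.* s) * q ^ (n ℕ.* n)
      H^s≈ = begin
        H ^ s * q ^ (N ℕ.* N)                   ≈⟨ *-congʳ (H^ s) ⟩
        q ^ (2 ℕ.* n ℕ.* s) * q ^ (N ℕ.* N)     ≈⟨ ^-homo-* q (2 ℕ.* n ℕ.* s) (N ℕ.* N) ⟨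
        q ^ (2 ℕ.* n ℕ.* s ℕ.+ N ℕ.* N)         ≡⟨ ≡.cong (q ^_)
          (solveℕ 2 (λ s N → conℕ 2 :* (s :+ N) :* s :+ N :* N := s :* s :+ (s :+ N) :* (s :+ N)) ≡.refl s N) ⟩
        q ^ (s ℕ.* s ℕ.+ n ℕ.* n)               ≈⟨ ^-homo-* q (s ℕ.* s) (n ℕ.* n) ⟩
        q ^ (s ℕ.* s) * q ^ (n ℕ.* n)           ∎
      M≉0 : ¬ H ^ s * H ^ k * q ^ (N ℕ.* N) * q ^ (n ℕ.* n) ≈ 0#
      M≉0 = *-nonzero (*-nonzero (*-nonzero (H^≉0 s) (H^≉0 k)) (^≉0 q≉0 (N ℕ.* N))) (^≉0 q≉0 (n ℕ.* n))
        where
        H^≉0 : ∀ k → ¬ H ^ k ≈ 0#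
        H^≉0 k e = ^≉0 q≉0 (2 ℕ.* n ℕ.* k) (trans (sym (H^ k)) e)

    A : Carrier
    A = ((- 1#) ^ n * E n ^ 2 * qⁿ n) / (E (n ∸ s) * E (n ℕ.+ s))

    A≈ : A ≈ (- 1#) ^ n * (E n * E n) * qⁿ n * (E N ⁻¹ * E (n ℕ.+ s) ⁻¹)
    A≈ = *-cong (*-congʳ (*-congˡ (^2 (E n))))
      (trans (⁻¹-cong (*-congʳ (reflexive (≡.cong E (ℕₚ.m+n∸m≡n s N))))) (⁻¹-* (E≉0 N) (E≉0 (n ℕ.+ s))))

    right : ℕ → Carrier
    right k = ((- 1#) ^ k * E (n ℕ.+ k) * ⟪ x ⨾ q ⟫ k * ⟪ q / x ⨾ q ⟫ k * qᵏ k)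
      / (E (n ∸ k) * ⟪ q ⨾ q ⟫ (k ∸ s) * ⟪ q ⨾ q ⟫ (k ℕ.+ s) * ⟪ q ⨾ q ⟫ (2 ℕ.* k))

    -- Both (q;q)ₖ₊ₛ and (q;q)₂ₖ contribute a factor (q;q)₂ₛ to the denominator; these are the two
    -- hidden in the two copies of `C`.
    right≈ : ∀ {j} → j ℕ.≤ N →
      A * right (s ℕ.+ j) ≈ C * ⟪ x ⨾ q ⟫ s * (C * ⟪ q / x ⨾ q ⟫ s)
        * (b° j * q ^ j * (⟪ x * q ^ s ⨾ q ⟫ j * ⟪ q / x * q ^ s ⨾ q ⟫ j))
    right≈ {j} j≤N = begin
      A * right (s ℕ.+ j)
        ≈⟨ *-cong A≈ (*-cong (*-congʳ (*-cong (*-cong (*-congˡ (E-split j)) (⟪⟫-+ x q s j)) (⟪⟫-+ (q / x) q s j)))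
             (trans (⁻¹-cong (*-cong (*-cong (*-cong (reflexive (≡.cong E (ℕₚ.[m+n]∸[m+o]≡n∸o s N j))) (s+j∸s j))
                                             (⟪q⟫-split j (s+j+s j))) (⟪q⟫-split (j ℕ.+ j) 2[s+j]))) den⁻¹)) ⟩
      _ ≈⟨ *-congˡ (*-congˡ (trans (*-congʳ (*-assoc _ _ _)) (*-assoc _ _ _))) ⟩
      -- `E (n ℕ.+ s)`, split off from the numerator, cancels against the same factor in the
      -- denominator of `A`.
      _ ≈⟨ separate-E _ _ _ _ _ _ _ _ _ _ _ (⁻¹-inverseʳ (E≉0 (n ℕ.+ s))) ⟩
      _ ≈⟨ *-congʳ (key j≤N) ⟩
      _ ≈⟨ regroup _ _ _ _ _ _ _ _ _ _ _ _ _ _ ⟩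
      _ ≈⟨ *-congˡ (*-congʳ (*-congʳ (*-congˡ (trans (⁻¹-* (*-nonzero (⟪q⟫≉0 j) (⟪c⟫≉0 j)) (⟪c⟫≉0 (j ℕ.+ j)))
             (*-congʳ (⁻¹-* (⟪q⟫≉0 j) (⟪c⟫≉0 j))))))) ⟨
      _ ∎
      where
      2[s+j] : 2 ℕ.* (s ℕ.+ j) ≡.≡ s ℕ.+ s ℕ.+ (j ℕ.+ j)
      2[s+j] = solveℕ 2 (λ s j → conℕ 2 :* (s :+ j) := s :+ s :+ (j :+ j)) ≡.refl s j
      den⁻¹ : _
      den⁻¹ = begin
        (E (N ∸ j) * ⟪ q ⨾ q ⟫ j * (⟪ q ⨾ q ⟫ (s ℕ.+ s) * ⟪ c ⨾ q ⟫ j) *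
          (⟪ q ⨾ q ⟫ (s ℕ.+ s) * ⟪ c ⨾ q ⟫ (j ℕ.+ j))) ⁻¹
          ≈⟨ ⁻¹-* (*-nonzero EG≉0 (Gc≉0 j)) (Gc≉0 (j ℕ.+ j)) ⟩
        _ ≈⟨ *-cong (trans (⁻¹-* EG≉0 (Gc≉0 j)) (*-cong (⁻¹-* (E≉0 (N ∸ j)) (⟪q⟫≉0 j))
          (⁻¹-* (⟪q⟫≉0 (s ℕ.+ s)) (⟪c⟫≉0 j))))
               (⁻¹-* (⟪q⟫≉0 (s ℕ.+ s)) (⟪c⟫≉0 (j ℕ.+ j))) ⟩
        E (N ∸ j) ⁻¹ * ⟪ q ⨾ q ⟫ j ⁻¹ * (⟪ q ⨾ q ⟫ (s ℕ.+ s) ⁻¹ * ⟪ c ⨾ q ⟫ j ⁻¹) *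
          (⟪ q ⨾ q ⟫ (s ℕ.+ s) ⁻¹ * ⟪ c ⨾ q ⟫ (j ℕ.+ j) ⁻¹) ∎
        where
        EG≉0 : ¬ E (N ∸ j) * ⟪ q ⨾ q ⟫ j ≈ 0#
        EG≉0 = *-nonzero (E≉0 (N ∸ j)) (⟪q⟫≉0 j)
        Gc≉0 : ∀ i → ¬ ⟪ q ⨾ q ⟫ (s ℕ.+ s) * ⟪ c ⨾ q ⟫ i ≈ 0#
        Gc≉0 i = *-nonzero (⟪q⟫≉0 (s ℕ.+ s)) (⟪c⟫≉0 i)

    product-of-sums : sumFromTo s n (left x) * sumFromTo s n (left (q / x)) ≈ A * sumFromTo s n right
    product-of-sums = begin
      sumFromTo s n (left x) * sumFromTo s n (left (q / x))
        ≈⟨ *-cong (left-sum x) (left-sum (q / x)) ⟩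
      C * ⟪ x ⨾ q ⟫ s * U (x * q ^ s) * (C * ⟪ q / x ⨾ q ⟫ s * U (q / x * q ^ s))
        ≈⟨ solve 4 (λ c d u v → c ⊗ u ⊗ (d ⊗ v) ⊜ c ⊗ d ⊗ (u ⊗ v)) refl _ _ _ _ ⟩
      C * ⟪ x ⨾ q ⟫ s * (C * ⟪ q / x ⨾ q ⟫ s) * (U (x * q ^ s) * U (q / x * q ^ s))
        ≈⟨ *-congˡ (product-formula U-c _ _ X*X′≈c) ⟩
      C * ⟪ x ⨾ q ⟫ s * (C * ⟪ q / x ⨾ q ⟫ s) * P (x * q ^ s) (q / x * q ^ s)
        ≈⟨ ∑≤-* N _ _ ⟩
      _ ≈⟨ ∑≤-cong′ N right≈ ⟨
      ∑≤ N (λ j → A * right (s ℕ.+ j))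
        ≈⟨ ∑≤-* N _ _ ⟨
      A * ∑≤ N (λ j → right (s ℕ.+ j))
        ≈⟨ *-congˡ (sumFromTo-∑≤ s N right) ⟨
      A * sumFromTo s n right ∎
      where
      X*X′≈c : x * q ^ s * (q / x * q ^ s) ≈ c
      X*X′≈c = begin
        x * q ^ s * (q * x ⁻¹ * q ^ s)    ≈⟨ solve 4 (λ x i q w → x ⊗ w ⊗ (q ⊗ i ⊗ w) ⊜ x ⊗ i ⊗ (q ⊗ (w ⊗ w))) refl
          x (x ⁻¹) q (q ^ s) ⟩
        x * x ⁻¹ * (q * (q ^ s * q ^ s))  ≈⟨ *-cong (⁻¹-inverseʳ x≉0) (*-congˡ (sym (^-homo-* q s s))) ⟩
        1# * c                            ≈⟨ *-identityˡ c ⟩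
        c                                 ∎

  -- Stated without abbreviations so that its instance at ℚ(q,x) is syntactically the
  -- theorem; a conversion check that unfolds the fractions is infeasible.
  product-of-sums : ∀ (q x : Carrier) → ¬ q ≈ 0# → (∀ k → ¬ q ^ suc k ≈ 1#) → ¬ x ≈ 0# →
    ∀ (n s : ℕ) → s ℕ.≤ n →
    (∑[ k from s to n ]
        (⟪ q ^ᶻ (ℤ.- (+ (2 ℕ.* n))) ⨾ q ^ 2 ⟫ k * ⟪ x ⨾ q ⟫ k * q ^ k)
      / (⟪ q ⨾ q ⟫ (k ∸ s) * ⟪ q ⨾ q ⟫ (k ℕ.+ s)))
    * (∑[ k from s to n ]
        (⟪ q ^ᶻ (ℤ.- (+ (2 ℕ.* n))) ⨾ q ^ 2 ⟫ k * ⟪ q / x ⨾ q ⟫ k * q ^ k)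
      / (⟪ q ⨾ q ⟫ (k ∸ s) * ⟪ q ⨾ q ⟫ (k ℕ.+ s)))
    ≈
      ((- 1#) ^ n * ⟪ q ^ 2 ⨾ q ^ 2 ⟫ n ^ 2 * q ^ᶻ (ℤ.- (+ (n ℕ.^ 2))))
    / (⟪ q ^ 2 ⨾ q ^ 2 ⟫ (n ∸ s) * ⟪ q ^ 2 ⨾ q ^ 2 ⟫ (n ℕ.+ s))
    * (∑[ k from s to n ]
        ((- 1#) ^ k * ⟪ q ^ 2 ⨾ q ^ 2 ⟫ (n ℕ.+ k) * ⟪ x ⨾ q ⟫ k * ⟪ q / x ⨾ q ⟫ k
          * q ^ᶻ (+ (k ℕ.^ 2) ℤ.- + (2 ℕ.* n ℕ.* k)))
      / (⟪ q ^ 2 ⨾ q ^ 2 ⟫ (n ∸ k) * ⟪ q ⨾ q ⟫ (k ∸ s) * ⟪ q ⨾ q ⟫ (k ℕ.+ s)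
          * ⟪ q ⨾ q ⟫ (2 ℕ.* k)))
  product-of-sums q x q≉0 q^≉1 x≉0 n s s≤n with ℕₚ.m≤n⇒∃[o]m+o≡n s≤n
  ... | N , ≡.refl = Formula.product-of-sums q x q≉0 q^≉1 x≉0 s N

open import Defs using (q; x; _≈_; _*_; -_; 1#; _/_; _^_; _^ᶻ_; ⟪_⨾_⟫; sumFromTo)

-- In ℚ(q,x) the indeterminates are nonzero and q is not a root of unity.

module _ where
  open Field ℚ⟨q,x⟩.fractionField using (_≟_; 0#)
  open ℚ⟨q,x⟩ using (num; den; cross)
  module ℤqx = IntegralDomain ℤ[q][x].domain

  q≉0 : ¬ q ≈ 0#
  q≉0 = toWitnessFalse {a? = q ≟ 0#} tt

  x≉0 : ¬ x ≈ 0#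
  x≉0 = toWitnessFalse {a? = x ≟ 0#} tt

  -- The value at q = x = 0.
  coeff₀₀ : ℤ[q][x].Poly → ℤ
  coeff₀₀ p = ℤ[q].coeff (ℤ[q][x].coeff p 0) 0

  coeff₀₀-num : ∀ z → coeff₀₀ (num (q * z)) ≡ + 0
  coeff₀₀-num z with num z
  ... | []             = ≡.refl
  ... | [] ∷ _         = ≡.refl
  ... | (_ ∷ _) ∷ _    = ≡.refl

  coeff₀₀-den : ∀ z → coeff₀₀ (den z) ≡ + 1 → coeff₀₀ (den (q * z)) ≡ + 1
  coeff₀₀-den z e with den z
  coeff₀₀-den z ≡.refl | (.(+ 1) ∷ _) ∷ _ = ≡.refl

  q^-den : ∀ k → coeff₀₀ (den (q ^ k)) ≡ + 1
  q^-den zero    = ≡.refl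
  q^-den (suc k) = coeff₀₀-den (q ^ k) (q^-den k)

  -- If the power were 1, its numerator and denominator would be equal polynomials, but their values
  -- at q = x = 0 are 0 and 1. The denominator has to be followed because fractions are unreduced
  -- products.
  q^≉1 : ∀ k → ¬ q ^ suc k ≈ 1#
  q^≉1 k e with ≡.trans (≡.sym (coeff₀₀-num (q ^ k))) (≡.trans (ℤ[q].at (ℤ[q][x].at num≈den 0) 0) (q^-den (suc k)))
    where
    num≈den : num (q ^ suc k) ℤqx.≈ den (q ^ suc k)
    num≈den = ℤqx.trans (ℤqx.sym (ℤqx.*-identityʳ _)) (ℤqx.trans (cross e) (ℤqx.*-identityˡ _))
  ... | ()

theorem2p5 : ∀ (n s : ℕ) → s ≤ n →
    (∑[ k from s to n ]
    (⟪ q ^ᶻ (ℤ.- (+ (2 ℕ.* n))) ⨾ q ^ 2 ⟫ k * ⟪ x ⨾ q ⟫ k * q ^ k)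
    / (⟪ q ⨾ q ⟫ (k ∸ s) * ⟪ q ⨾ q ⟫ (k ℕ.+ s)))
    * (∑[ k from s to n ]
    (⟪ q ^ᶻ (ℤ.- (+ (2 ℕ.* n))) ⨾ q ^ 2 ⟫ k * ⟪ q / x ⨾ q ⟫ k * q ^ k)
    / (⟪ q ⨾ q ⟫ (k ∸ s) * ⟪ q ⨾ q ⟫ (k ℕ.+ s)))
    ≈
    ((- 1#) ^ n * ⟪ q ^ 2 ⨾ q ^ 2 ⟫ n ^ 2 * q ^ᶻ (ℤ.- (+ (n ℕ.^ 2))))
    / (⟪ q ^ 2 ⨾ q ^ 2 ⟫ (n ∸ s) * ⟪ q ^ 2 ⨾ q ^ 2 ⟫ (n ℕ.+ s))
    * (∑[ k from s to n ]
    ((- 1#) ^ k * ⟪ q ^ 2 ⨾ q ^ 2 ⟫ (n ℕ.+ k) * ⟪ x ⨾ q ⟫ k * ⟪ q / x ⨾ q ⟫ k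
    * q ^ᶻ (+ (k ℕ.^ 2) ℤ.- + (2 ℕ.* n ℕ.* k)))
    / (⟪ q ^ 2 ⨾ q ^ 2 ⟫ (n ∸ k) * ⟪ q ⨾ q ⟫ (k ∸ s) * ⟪ q ⨾ q ⟫ (k ℕ.+ s)
    * ⟪ q ⨾ q ⟫ (2 ℕ.* k)))
theorem2p5 = Specialisation.product-of-sums ℚ⟨q,x⟩.fractionField q x q≉0 q^≉1 x≉0
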